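{- Let $\Lambda,\Lambda_1,\Lambda_2$ be three $A$-lattices of the same rank $r\geqslant1$ such that $\Lambda\subseteq\Lambda_1\cap\Lambda_2$. Then $\Lambda_1\cap\Lambda_2$ and $\Lambda_1+\Lambda_2$ are also $A$-lattices of rank $r$. Moreover, we have $$\log_q\mathcal{D}(\Lambda_1\cap\Lambda_2)+\log_q\mathcal{D}(\Lambda_1+\Lambda_2)=\log_q\mathcal{D}(\Lambda_1)+\log_q\mathcal{D}(\Lambda_2).$$
   Context: $\mathbb{F}_q$ is a finite field with $q$ elements, $A=\mathbb{F}_q[T]$, $K_0=\mathbb{F}_q(T)$, and $\mathrm{ord}_\infty$ is the valuation on $K_0$ with $\mathrm{ord}_\infty(a)=-\deg a$ for $a\in A$. $\mathbb{C}_\infty$ is the completion of an algebraic closure of the completion $K_{0,\infty}$ of $K_0$ at $\infty$, with normalized absolute value $|x|_\infty=q^{ -\mathrm{ord}_\infty(x)}$ ($\mathrm{ord}_\infty$ extended to $\mathbb{C}_\infty$). An $A$-lattice is a finitely generated $A$-submodule $\Lambda\subset\mathbb{C}_\infty$ which is discrete (it has finite intersection with every ball of $\mathbb{C}_\infty$); its rank is its rank as an $A$-module (it is torsion-free, hence free). A successive minimum basis of a rank $r$ lattice $\Lambda$ is an ordered $A$-basis $(\eta_1,\dots,\eta_r)$ of $\Lambda$ with $|\eta_1|_\infty\geqslant\dots\geqslant|\eta_r|_\infty$ such that, for each $k$, $\eta_k$ has minimal absolute value among the elements of $\Lambda\smallsetminus(A\eta_{k+1}+\dots+A\eta_r)$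 (for $k=r$: among nonzero elements of $\Lambda$). Such a basis exists and the tuple $(|\eta_1|_\infty,\dots,|\eta_r|_\infty)$ depends only on $\Lambda$. The covolume of $\Lambda$ is $\mathcal{D}(\Lambda)=|\eta_1|_\infty\cdots|\eta_r|_\infty$ for any successive minimum basis. -}

module Defs where

open import Level using (Level; suc; _⊔_)
open import Algebra.Bundles using (CommutativeRing)
open import Algebra.Morphism.Structures using (IsRingHomomorphism)
import Algebra.Properties.CommutativeMonoid.Sum as Sum
open import Data.Fin.Base as Fin using (Fin)
open import Data.Integer.Base using (+_)
open import Data.List.Base using (List; []; _∷_; foldr; map)
open import Data.List.Relation.Unary.All using (All)
import Data.List.Membership.Setoid as Membership
open import Data.Nat.Base as ℕ using (ℕ; zero)
open import Data.Product.Base using (Σ-syntax; ∃-syntax; _×_)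
open import Data.Rational.Base as ℚ using (ℚ; 0ℚ)
open import Data.Vec.Functional as Vector using (Vector)
open import Function.Bundles using (Inverse; _⇔_)
open import Relation.Binary.PropositionalEquality.Core using (_≡_)
open import Relation.Binary.PropositionalEquality.Properties using (setoid)
open import Relation.Nullary.Negation.Core using (¬_)
open import Relation.Unary using (Pred; _∈_)

-- The values {0} ∪ q^ℚ of the absolute value of ℂ∞.  The number q^s is
-- represented by its exponent s, so that log_q (q^ s) is s; the order and
-- the product are those of the real numbers represented, since q > 1.
data Value : Set where
  0ᵛ : Value
  q^ : ℚ → Value

infix 4 _≤ᵛ_
infixl 6 _⊔ᵛ_
infixl 7 _·_

data _≤ᵛ_ : Value → Value → Set where
  0≤  : ∀ {v} → 0ᵛ ≤ᵛ v
  q^≤ : ∀ {s t} → s ℚ.≤ t → q^ s ≤ᵛ q^ t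

_·_ : Value → Value → Value
0ᵛ   · _    = 0ᵛ
q^ _ · 0ᵛ   = 0ᵛ
q^ s · q^ t = q^ (s ℚ.+ t)

_⊔ᵛ_ : Value → Value → Value
0ᵛ   ⊔ᵛ v    = v
q^ s ⊔ᵛ 0ᵛ   = q^ s
q^ s ⊔ᵛ q^ t = q^ (s ℚ.⊔ t)

∏ᵛ : ∀ {n} → Vector Value n → Value
∏ᵛ = Vector.foldr _·_ (q^ 0ℚ)

IsField : ∀ {c ℓ} → CommutativeRing c ℓ → Set (c ⊔ ℓ)
IsField R = ¬ (0# ≈ 1#) × (∀ x → ¬ (x ≈ 0#) → ∃[ y ] x * y ≈ 1#)
  where open CommutativeRing R

-- A polynomial is the list of its coefficients, constant term first.
-- Trailing zeros are allowed, so [] is not the only zero polynomial.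
module Polynomial {c ℓ} (R : CommutativeRing c ℓ) where
  open CommutativeRing R

  Poly : Set c
  Poly = List Carrier

  coeff : Poly → ℕ → Carrier
  coeff []      _         = 0#
  coeff (x ∷ _) zero      = x
  coeff (_ ∷ p) (ℕ.suc n) = coeff p n

  IsZero : Poly → Set ℓ
  IsZero p = ∀ n → coeff p n ≈ 0#

  HasDegree : Poly → ℕ → Set ℓ
  HasDegree p n = ¬ (coeff p n ≈ 0#) × (∀ m → n ℕ.< m → coeff p m ≈ 0#)

  eval : Poly → Carrier → Carrier
  eval p x = foldr (λ a y → a + x * y) 0# p

record FiniteField (a ℓ : Level) (q : ℕ) : Set (suc (a ⊔ ℓ)) where
  field
    commutativeRing : CommutativeRing a ℓ
    isField         : IsField commutativeRing
    enumeration     : Inverse (CommutativeRing.setoid commutativeRing) (setoid (Fin q))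

-- A completion of an algebraic closure of the completion of K₀ = 𝔽_q(T) at ∞.
-- The intermediate fields are subfields of the big field: K₀ consists of the
-- fractions, K₀∞ is the topological closure of K₀ (complete, as the big field
-- is), and Ω consists of the elements algebraic over K₀∞.  What is required is
-- that Ω be algebraically closed and that the big field be a completion of Ω.
record ℂ∞ {a ℓ q} (𝔽 : FiniteField a ℓ q) (c ℓ′ : Level)
          : Set (a ⊔ ℓ ⊔ suc (c ⊔ ℓ′)) where
  private
    module F = CommutativeRing (FiniteField.commutativeRing 𝔽)
    module A = Polynomial (FiniteField.commutativeRing 𝔽)
  field
    commutativeRing : CommutativeRing c ℓ′
    isField         : IsField commutativeRing
  open CommutativeRing commutativeRing public
  open Polynomial commutativeRing public
  field
    ι     : F.Carrier → Carrier
    ι-hom : IsRingHomomorphism F.rawRing rawRing ι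
    T     : Carrier

  evalᴬ : A.Poly → Carrier
  evalᴬ f = eval (map ι f) T

  field
    ∣_∣        : Carrier → Value
    ∣∣-cong    : ∀ {x y} → x ≈ y → ∣ x ∣ ≡ ∣ y ∣
    ∣∣-zero    : ∀ x → (∣ x ∣ ≡ 0ᵛ) ⇔ (x ≈ 0#)
    ∣∣-mult    : ∀ x y → ∣ x * y ∣ ≡ ∣ x ∣ · ∣ y ∣
    ∣∣-ultra   : ∀ x y → ∣ x + y ∣ ≤ᵛ ∣ x ∣ ⊔ᵛ ∣ y ∣
    -- ord_∞ f = − deg f and ∣ f ∣ = q^(− ord_∞ f); in particular T is
    -- transcendental over 𝔽_q.
    ∣∣-degree  : ∀ f n → A.HasDegree f n → ∣ evalᴬ f ∣ ≡ q^ (+ n ℚ./ 1)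

  K₀ : Pred Carrier (a ⊔ ℓ ⊔ ℓ′)
  K₀ x = ∃[ f ] ∃[ g ] ¬ A.IsZero g × evalᴬ g * x ≈ evalᴬ f

  K₀∞ : Pred Carrier (a ⊔ ℓ ⊔ c ⊔ ℓ′)
  K₀∞ x = ∀ s → ∃[ y ] y ∈ K₀ × ∣ x - y ∣ ≤ᵛ q^ s

  Ω : Pred Carrier (a ⊔ ℓ ⊔ c ⊔ ℓ′)
  Ω x = ∃[ p ] All K₀∞ p × ¬ IsZero p × eval p x ≈ 0#

  IsCauchy : (ℕ → Carrier) → Set
  IsCauchy u = ∀ s → ∃[ N ] ∀ m n → N ℕ.≤ m → N ℕ.≤ n → ∣ u m - u n ∣ ≤ᵛ q^ s

  ConvergesTo : (ℕ → Carrier) → Carrier → Set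
  ConvergesTo u x = ∀ s → ∃[ N ] ∀ n → N ℕ.≤ n → ∣ u n - x ∣ ≤ᵛ q^ s

  field
    -- A root in the big field of a nonzero polynomial over Ω is algebraic over
    -- K₀∞, so it does not have to be required to lie in Ω.
    Ω-closed : ∀ p n → All Ω p → HasDegree p (ℕ.suc n) → ∃[ x ] eval p x ≈ 0#
    Ω-dense  : ∀ x s → ∃[ y ] y ∈ Ω × ∣ x - y ∣ ≤ᵛ q^ s
    complete : ∀ u → IsCauchy u → ∃[ x ] ConvergesTo u x

module Lattices {a ℓ q} {𝔽 : FiniteField a ℓ q} {c ℓ′} (ℂ : ℂ∞ 𝔽 c ℓ′) where
  open ℂ∞ ℂ
  open Sum +-commutativeMonoid using (sum)
  private module A = Polynomial (FiniteField.commutativeRing 𝔽)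

  record IsSubmodule {p} (Λ : Pred Carrier p) : Set (a ⊔ c ⊔ ℓ′ ⊔ p) where
    field
      resp     : ∀ {x y} → x ≈ y → x ∈ Λ → y ∈ Λ
      0-closed : 0# ∈ Λ
      +-closed : ∀ {x y} → x ∈ Λ → y ∈ Λ → x + y ∈ Λ
      •-closed : ∀ f {x} → x ∈ Λ → evalᴬ f * x ∈ Λ

  lin : ∀ {n} → Vector A.Poly n → Vector Carrier n → Carrier
  lin f η = sum (λ i → evalᴬ (f i) * η i)

  Span : ∀ {n} → Vector Carrier n → Pred Carrier (a ⊔ ℓ′)
  Span η x = ∃[ f ] x ≈ lin f η

  -- The span of the vectors of η with index strictly greater than k.
  SpanAfter : ∀ {n} → Vector Carrier n → Fin n → Pred Carrier (a ⊔ ℓ ⊔ ℓ′)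
  SpanAfter η k x = ∃[ f ] (∀ i → i Fin.≤ k → A.IsZero (f i)) × x ≈ lin f η

  Generates : ∀ {n p} → Vector Carrier n → Pred Carrier p → Set (a ⊔ c ⊔ ℓ′ ⊔ p)
  Generates η Λ = ∀ x → x ∈ Λ ⇔ x ∈ Span η

  LinearlyIndependent : ∀ {n} → Vector Carrier n → Set (a ⊔ ℓ ⊔ ℓ′)
  LinearlyIndependent η = ∀ f → lin f η ≈ 0# → ∀ i → A.IsZero (f i)

  IsBasis : ∀ {n p} → Vector Carrier n → Pred Carrier p → Set (a ⊔ ℓ ⊔ c ⊔ ℓ′ ⊔ p)
  IsBasis η Λ = Generates η Λ × LinearlyIndependent η

  Finite : ∀ {p} → Pred Carrier p → Set (c ⊔ ℓ′ ⊔ p)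
  Finite P = ∃[ xs ] ∀ x → x ∈ P ⇔ x ∈ˡ xs
    where open Membership (CommutativeRing.setoid commutativeRing) renaming (_∈_ to _∈ˡ_)

  Ball : Carrier → ℚ → Pred Carrier _
  Ball z s x = ∣ x - z ∣ ≤ᵛ q^ s

  record IsLattice {p} (Λ : Pred Carrier p) : Set (a ⊔ ℓ ⊔ c ⊔ ℓ′ ⊔ p) where
    field
      isSubmodule       : IsSubmodule Λ
      finitelyGenerated : ∃[ n ] Σ[ g ∈ Vector Carrier n ] Generates g Λ
      discrete          : ∀ z s → Finite (λ x → x ∈ Λ × x ∈ Ball z s)

  -- Lattices are free A-modules, so their rank is the size of a basis.
  HasRank : ∀ {p} → Pred Carrier p → ℕ → Set (a ⊔ ℓ ⊔ c ⊔ ℓ′ ⊔ p)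
  HasRank Λ r = Σ[ η ∈ Vector Carrier r ] IsBasis η Λ

  IsLatticeOfRank : ∀ {p} → ℕ → Pred Carrier p → Set (a ⊔ ℓ ⊔ c ⊔ ℓ′ ⊔ p)
  IsLatticeOfRank r Λ = IsLattice Λ × HasRank Λ r

  infixl 6 _+ᴸ_
  _+ᴸ_ : ∀ {p₁ p₂} → Pred Carrier p₁ → Pred Carrier p₂ → Pred Carrier (c ⊔ ℓ′ ⊔ p₁ ⊔ p₂)
  (Λ₁ +ᴸ Λ₂) x = ∃[ y ] ∃[ z ] y ∈ Λ₁ × z ∈ Λ₂ × x ≈ y + z

  HasMinimalAbs : ∀ {p} → Carrier → Pred Carrier p → Set (c ⊔ p)
  HasMinimalAbs y P = y ∈ P × (∀ x → x ∈ P → ∣ y ∣ ≤ᵛ ∣ x ∣)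

  record IsSuccessiveMinimumBasis {r p} (η : Vector Carrier r) (Λ : Pred Carrier p)
         : Set (a ⊔ ℓ ⊔ c ⊔ ℓ′ ⊔ p) where
    field
      isBasis    : IsBasis η Λ
      decreasing : ∀ i j → i Fin.≤ j → ∣ η j ∣ ≤ᵛ ∣ η i ∣
      minimal    : ∀ k → HasMinimalAbs (η k) (λ x → x ∈ Λ × ¬ (x ∈ SpanAfter η k))

  -- The covolume of the rank r lattice Λ is D: the value ∏ᵢ ∣ηᵢ∣ common to all
  -- successive minimum bases, of which there has to be at least one.
  IsCovolume : ∀ {p} → ℕ → Pred Carrier p → Value → Set (a ⊔ ℓ ⊔ c ⊔ ℓ′ ⊔ p)
  IsCovolume r Λ D =
      (Σ[ η ∈ Vector Carrier r ] IsSuccessiveMinimumBasis η Λ)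
    × (∀ (η : Vector Carrier r) → IsSuccessiveMinimumBasis η Λ → ∏ᵛ (λ i → ∣ η i ∣) ≡ D)

  -- log_q of the covolume of Λ is d.
  IsLogCovolume : ∀ {p} → ℕ → Pred Carrier p → ℚ → Set (a ⊔ ℓ ⊔ c ⊔ ℓ′ ⊔ p)
  IsLogCovolume r Λ d = IsCovolume r Λ (q^ d)

{-# OPTIONS --safe #-}

-- Successive minimum bases are orthogonal, |Σ aᵢ ηᵢ| = max |aᵢ| |ηᵢ|, so the ball of
-- radius q^s in a lattice has q^N(s) elements, where N(s) = Σᵢ #{ d ∈ ℕ : d + log|ηᵢ| ≤ s }.
-- Since Λ has a common denominator with respect to Λ₁, every element of Λ₁ is congruent
-- modulo Λ to one of bounded absolute value; hence the sequence
-- 0 → Λ₁ ∩ Λ₂ → Λ₁ × Λ₂ → Λ₁ + Λ₂ → 0 stays exact when restricted to large balls, and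
-- counting elements gives N∩(s) + N₊(s) = N₁(s) + N₂(s) for all large s.  Averaging over s
-- in a unit interval turns N into an affine function of the logarithm of the covolume.
module Submission where

open import Defs
open import Level using (_⊔_)
open import Algebra.Bundles using (CommutativeMonoid; CommutativeRing)
open import Algebra.Morphism.Structures using (IsRingHomomorphism)
import Algebra.Properties.AbelianGroup as AbelianGroupProperties
import Algebra.Properties.CommutativeMonoid.Sum as CommutativeMonoidSum
import Algebra.Properties.CommutativeSemigroup as CommutativeSemigroupProperties
import Algebra.Properties.Ring as RingProperties
import Algebra.Properties.Semiring.Exp as Exp
import Algebra.Properties.Semiring.Mult as SemiringMult
import Algebra.Properties.Semiring.Sum as Sum
import Algebra.Solver.Ring as RingSolver
open import Algebra.Solver.Ring.AlmostCommutativeRing as Old using (_-Raw-AlmostCommutative⟶_)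
open import Data.Fin.Base as Fin using (Fin; zero; suc; punchIn; combine; remQuot)
open import Data.Fin.Patterns using (0F; 1F; 2F; 3F)
import Data.Fin.Properties as Fin
open import Data.Integer.Base as ℤ using (ℤ; +_; -[1+_])
import Data.Integer.Properties as ℤ
import Data.Integer.Solver as ℤSolver
open import Data.List.Base as List using (List; []; _∷_)
import Data.List.Membership.Setoid as Membership
import Data.List.Membership.Setoid.Properties as MembershipProperties
open import Data.List.Relation.Unary.Any as Any using (Any; here; there)
open import Data.Maybe.Base as Maybe using (nothing)
open import Data.Nat.Base as ℕ using (ℕ; zero; suc)
import Data.Nat.Divisibility as ℕ
import Data.Nat.DivMod as ℕ
import Data.Nat.Properties as ℕ
open import Data.Product.Base using (_×_; _,_; ∃-syntax; Σ-syntax; proj₁; proj₂; uncurry)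
open import Data.Rational.Base as ℚ using (ℚ; 0ℚ)
import Data.Rational.Properties as ℚ
open import Data.Rational.Unnormalised.Base as ℚᵘ using (mkℚᵘ; *≡*; *≤*)
import Data.Rational.Unnormalised.Properties as ℚᵘ
open import Data.Sum.Base using (_⊎_; inj₁; inj₂)
open import Data.Unit.Polymorphic.Base using (⊤; tt)
open import Data.Vec.Functional as Vector using (Vector; tail; insertAt)
open import Data.Vec.Functional.Properties using (insertAt-lookup; insertAt-punchIn)
open import Function.Base using (_∘_)
open import Function.Bundles using (Inverse; Equivalence; _⇔_; mk⇔)
open import Relation.Binary.Definitions using (tri<; tri≈; tri>)
open import Relation.Binary.PropositionalEquality.Core
  using (_≡_; refl; sym; trans; cong; cong₂; subst; subst₂)
open import Relation.Binary.PropositionalEquality.Properties using (module ≡-Reasoning)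
import Relation.Binary.Reasoning.Setoid as SetoidReasoning
open import Relation.Nullary using (¬_; Dec; yes; no; contradiction; ¬?)
open import Relation.Nullary.Decidable using (map′; decidable-stable; _×-dec_; dec⇒maybe)
open import Relation.Unary using (Pred; _∈_; _∉_; _⊆_; _∩_)
import Tactic.RingSolver.Core.AlmostCommutativeRing as New
import Tactic.RingSolver.NonReflective as NonReflective

-- At one radius the counting identity relates only integer parts of s - log|ηᵢ|, and the exponents
-- of the four lattices may have different fractional parts, so no single radius determines the
-- covolumes. The averaging radii have exponents S/M, (S+1)/M, ..., (S+M-1)/M, where M is a common
-- denominator of all exponents and of the threshold, and S/M bounds them all from above; Hermite's
-- identity then removes the integer parts exactly. Reduction modulo Λ is applied in Λ₁ only: the
-- part removed lies in Λ, hence can be moved to Λ₂. Elsewhere the obstacle is effectivity. Minimal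
-- vectors come from searching finite lists, which requires deciding membership in a span;
-- orthogonality of the vectors already found provides this, because it makes balls in their span
-- explicitly enumerable. Hence minimality and orthogonality are established alternately, one vector
-- at a time. Neither a basis of Λ₁ ∩ Λ₂ or Λ₁ + Λ₂ nor discreteness of the sum is available
-- beforehand: ranks are bounded through dependence of any r + 1 elements, and discreteness is
-- pulled back from Λ along multiplication by a common denominator.

-- Natural numbers as rational exponents

-- Opaque because unification cannot see through the gcd in _/_.
opaque
  fromℕ : ℕ → ℚ
  fromℕ n = + n ℚ./ 1

  fromℕ≡ : ∀ n → fromℕ n ≡ + n ℚ./ 1
  fromℕ≡ n = refl

  fromℕ-pos : ∀ n → ℚ.Positive (fromℕ (suc n))
  fromℕ-pos n = ℚ.normalize-pos (suc n) 1

  fromℕ-0 : fromℕ 0 ≡ 0ℚ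
  fromℕ-0 = refl

  toℚᵘ-fromℕ : ∀ n → ℚ.toℚᵘ (fromℕ n) ℚᵘ.≃ mkℚᵘ (+ n) 0
  toℚᵘ-fromℕ n = ℚ.toℚᵘ-fromℚᵘ (mkℚᵘ (+ n) 0)

  fromℕ-+ : ∀ m n → fromℕ (m ℕ.+ n) ≡ fromℕ m ℚ.+ fromℕ n
  fromℕ-+ m n = ℚ.toℚᵘ-injective (begin
    ℚ.toℚᵘ (fromℕ (m ℕ.+ n))                       ≈⟨ toℚᵘ-fromℕ (m ℕ.+ n) ⟩
    mkℚᵘ (+ (m ℕ.+ n)) 0
      ≈⟨ *≡* (cong (ℤ._* + 1) (cong₂ ℤ._+_ (sym (ℤ.*-identityʳ (+ m))) (sym (ℤ.*-identityʳ (+ n))))) ⟩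
    mkℚᵘ (+ m) 0 ℚᵘ.+ mkℚᵘ (+ n) 0                 ≈⟨ ℚᵘ.+-cong (toℚᵘ-fromℕ m) (toℚᵘ-fromℕ n) ⟨
    ℚ.toℚᵘ (fromℕ m) ℚᵘ.+ ℚ.toℚᵘ (fromℕ n)         ≈⟨ ℚ.toℚᵘ-homo-+ (fromℕ m) (fromℕ n) ⟨
    ℚ.toℚᵘ (fromℕ m ℚ.+ fromℕ n)                   ∎)
    where open ℚᵘ.≃-Reasoning

  fromℕ-* : ∀ m n → fromℕ (m ℕ.* n) ≡ fromℕ m ℚ.* fromℕ n
  fromℕ-* m n = ℚ.toℚᵘ-injective (begin
    ℚ.toℚᵘ (fromℕ (m ℕ.* n))                       ≈⟨ toℚᵘ-fromℕ (m ℕ.* n) ⟩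
    mkℚᵘ (+ (m ℕ.* n)) 0                           ≈⟨ *≡* (cong (ℤ._* + 1) (ℤ.pos-* m n)) ⟩
    mkℚᵘ (+ m) 0 ℚᵘ.* mkℚᵘ (+ n) 0                 ≈⟨ ℚᵘ.*-cong (toℚᵘ-fromℕ m) (toℚᵘ-fromℕ n) ⟨
    ℚ.toℚᵘ (fromℕ m) ℚᵘ.* ℚ.toℚᵘ (fromℕ n)         ≈⟨ ℚ.toℚᵘ-homo-* (fromℕ m) (fromℕ n) ⟨
    ℚ.toℚᵘ (fromℕ m ℚ.* fromℕ n)                   ∎)
    where open ℚᵘ.≃-Reasoning

  fromℕ-mono-≤ : ∀ {m n} → m ℕ.≤ n → fromℕ m ℚ.≤ fromℕ n
  fromℕ-mono-≤ {m} {n} m≤n = ℚ.toℚᵘ-cancel-≤ (begin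
    ℚ.toℚᵘ (fromℕ m)  ≃⟨ toℚᵘ-fromℕ m ⟩
    mkℚᵘ (+ m) 0      ≤⟨ *≤* (ℤ.*-monoʳ-≤-nonNeg (+ 1) (ℤ.+≤+ m≤n)) ⟩
    mkℚᵘ (+ n) 0      ≃⟨ toℚᵘ-fromℕ n ⟨
    ℚ.toℚᵘ (fromℕ n)  ∎)
    where open ℚᵘ.≤-Reasoning

  fromℕ-cancel-≤ : ∀ {m n} → fromℕ m ℚ.≤ fromℕ n → m ℕ.≤ n
  fromℕ-cancel-≤ {m} {n} m≤n = ℤ.drop‿+≤+ (ℤ.*-cancelʳ-≤-pos (+ m) (+ n) (+ 1) (ℚᵘ.drop-*≤* (begin
    mkℚᵘ (+ m) 0      ≃⟨ toℚᵘ-fromℕ m ⟨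
    ℚ.toℚᵘ (fromℕ m)  ≤⟨ ℚ.toℚᵘ-mono-≤ m≤n ⟩
    ℚ.toℚᵘ (fromℕ n)  ≃⟨ toℚᵘ-fromℕ n ⟩
    mkℚᵘ (+ n) 0      ∎)))
    where open ℚᵘ.≤-Reasoning

-- The ordered monoid of absolute values

infix 4 _<ᵛ_ _≤ᵛ?_ _≟ᵛ_

_<ᵛ_ : Value → Value → Set
u <ᵛ v = ¬ v ≤ᵛ u

q^-injective : ∀ {s t} → q^ s ≡ q^ t → s ≡ t
q^-injective refl = refl

q^-cancel-≤ : ∀ {s t} → q^ s ≤ᵛ q^ t → s ℚ.≤ t
q^-cancel-≤ (q^≤ s≤t) = s≤t

≤ᵛ-refl : ∀ {v} → v ≤ᵛ v
≤ᵛ-refl {0ᵛ}   = 0≤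
≤ᵛ-refl {q^ s} = q^≤ ℚ.≤-refl

≤ᵛ-reflexive : ∀ {u v} → u ≡ v → u ≤ᵛ v
≤ᵛ-reflexive refl = ≤ᵛ-refl

≤ᵛ-trans : ∀ {u v w} → u ≤ᵛ v → v ≤ᵛ w → u ≤ᵛ w
≤ᵛ-trans 0≤      _       = 0≤
≤ᵛ-trans (q^≤ p) (q^≤ r) = q^≤ (ℚ.≤-trans p r)

≤ᵛ-antisym : ∀ {u v} → u ≤ᵛ v → v ≤ᵛ u → u ≡ v
≤ᵛ-antisym 0≤      0≤      = refl
≤ᵛ-antisym (q^≤ p) (q^≤ r) = cong q^ (ℚ.≤-antisym p r)

≤ᵛ-total : ∀ u v → u ≤ᵛ v ⊎ v ≤ᵛ u
≤ᵛ-total 0ᵛ     v      = inj₁ 0≤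
≤ᵛ-total (q^ s) 0ᵛ     = inj₂ 0≤
≤ᵛ-total (q^ s) (q^ t) with ℚ.≤-total s t
... | inj₁ s≤t = inj₁ (q^≤ s≤t)
... | inj₂ t≤s = inj₂ (q^≤ t≤s)

_≤ᵛ?_ : ∀ u v → Dec (u ≤ᵛ v)
0ᵛ   ≤ᵛ? v    = yes 0≤
q^ s ≤ᵛ? 0ᵛ   = no λ ()
q^ s ≤ᵛ? q^ t = map′ q^≤ q^-cancel-≤ (s ℚ.≤? t)

_≟ᵛ_ : ∀ (u v : Value) → Dec (u ≡ v)
0ᵛ   ≟ᵛ 0ᵛ   = yes refl
0ᵛ   ≟ᵛ q^ t = no λ ()
q^ s ≟ᵛ 0ᵛ   = no λ ()
q^ s ≟ᵛ q^ t = map′ (cong q^) q^-injective (s ℚ.≟ t)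

<ᵛ⇒≤ᵛ : ∀ {u v} → u <ᵛ v → u ≤ᵛ v
<ᵛ⇒≤ᵛ {u} {v} u<v with ≤ᵛ-total u v
... | inj₁ u≤v = u≤v
... | inj₂ v≤u = contradiction v≤u u<v

≤ᵛ-<ᵛ-trans : ∀ {u v w} → u ≤ᵛ v → v <ᵛ w → u <ᵛ w
≤ᵛ-<ᵛ-trans u≤v v<w w≤u = v<w (≤ᵛ-trans w≤u u≤v)

<ᵛ-≤ᵛ-trans : ∀ {u v w} → u <ᵛ v → v ≤ᵛ w → u <ᵛ w
<ᵛ-≤ᵛ-trans u<v v≤w w≤u = u<v (≤ᵛ-trans v≤w w≤u)

0<q^ : ∀ {s} → 0ᵛ <ᵛ q^ s
0<q^ ()

u≤u⊔v : ∀ u v → u ≤ᵛ u ⊔ᵛ v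
u≤u⊔v 0ᵛ     v      = 0≤
u≤u⊔v (q^ s) 0ᵛ     = ≤ᵛ-refl
u≤u⊔v (q^ s) (q^ t) = q^≤ (ℚ.p≤p⊔q s t)

v≤u⊔v : ∀ u v → v ≤ᵛ u ⊔ᵛ v
v≤u⊔v 0ᵛ     v      = ≤ᵛ-refl
v≤u⊔v (q^ s) 0ᵛ     = 0≤
v≤u⊔v (q^ s) (q^ t) = q^≤ (ℚ.p≤q⊔p s t)

⊔ᵛ-sel : ∀ u v → u ⊔ᵛ v ≡ u ⊎ u ⊔ᵛ v ≡ v
⊔ᵛ-sel 0ᵛ     v      = inj₂ refl
⊔ᵛ-sel (q^ s) 0ᵛ     = inj₁ refl
⊔ᵛ-sel (q^ s) (q^ t) with ℚ.⊔-sel s t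
... | inj₁ eq = inj₁ (cong q^ eq)
... | inj₂ eq = inj₂ (cong q^ eq)

⊔ᵛ-lub : ∀ {u v w} → u ≤ᵛ w → v ≤ᵛ w → u ⊔ᵛ v ≤ᵛ w
⊔ᵛ-lub {u} {v} u≤w v≤w with ⊔ᵛ-sel u v
... | inj₁ eq = subst (_≤ᵛ _) (sym eq) u≤w
... | inj₂ eq = subst (_≤ᵛ _) (sym eq) v≤w

⊔ᵛ-lub-< : ∀ {u v w} → u <ᵛ w → v <ᵛ w → u ⊔ᵛ v <ᵛ w
⊔ᵛ-lub-< {u} {v} u<w v<w with ⊔ᵛ-sel u v
... | inj₁ eq = subst (_<ᵛ _) (sym eq) u<w
... | inj₂ eq = subst (_<ᵛ _) (sym eq) v<w

u≤v⇒u⊔v≡v : ∀ {u v} → u ≤ᵛ v → u ⊔ᵛ v ≡ v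
u≤v⇒u⊔v≡v u≤v = ≤ᵛ-antisym (⊔ᵛ-lub u≤v ≤ᵛ-refl) (v≤u⊔v _ _)

v≤u⇒u⊔v≡u : ∀ {u v} → v ≤ᵛ u → u ⊔ᵛ v ≡ u
v≤u⇒u⊔v≡u v≤u = ≤ᵛ-antisym (⊔ᵛ-lub ≤ᵛ-refl v≤u) (u≤u⊔v _ _)

·-comm : ∀ u v → u · v ≡ v · u
·-comm 0ᵛ     0ᵛ     = refl
·-comm 0ᵛ     (q^ t) = refl
·-comm (q^ s) 0ᵛ     = refl
·-comm (q^ s) (q^ t) = cong q^ (ℚ.+-comm s t)

·-identityˡ : ∀ u → q^ 0ℚ · u ≡ u
·-identityˡ 0ᵛ     = refl
·-identityˡ (q^ s) = cong q^ (ℚ.+-identityˡ s)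

·-monoʳ-≤ : ∀ w {u v} → u ≤ᵛ v → w · u ≤ᵛ w · v
·-monoʳ-≤ 0ᵛ     _       = 0≤
·-monoʳ-≤ (q^ s) 0≤      = 0≤
·-monoʳ-≤ (q^ s) (q^≤ p) = q^≤ (ℚ.+-monoʳ-≤ s p)

·-monoˡ-≤ : ∀ w {u v} → u ≤ᵛ v → u · w ≤ᵛ v · w
·-monoˡ-≤ w {u} {v} u≤v = subst₂ _≤ᵛ_ (·-comm w u) (·-comm w v) (·-monoʳ-≤ w u≤v)

·-cancelˡ-≤ : ∀ s {u v} → q^ s · u ≤ᵛ q^ s · v → u ≤ᵛ v
·-cancelˡ-≤ s {0ᵛ}   {v}    _       = 0≤
·-cancelˡ-≤ s {q^ t} {q^ u} (q^≤ p) with ℚ.<-cmp t u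
... | tri< t<u _ _ = q^≤ (ℚ.<⇒≤ t<u)
... | tri≈ _ t≡u _ = q^≤ (ℚ.≤-reflexive t≡u)
... | tri> _ _ u<t = contradiction (ℚ.<-≤-trans (ℚ.+-monoʳ-< s u<t) p) (ℚ.<-irrefl refl)

·-monoʳ-< : ∀ s {u v} → u <ᵛ v → q^ s · u <ᵛ q^ s · v
·-monoʳ-< s u<v = u<v ∘ ·-cancelˡ-≤ s

-- The ring solver with integer coefficients, which unlike coefficients in R
-- itself let it see that x - x vanishes.
module IntegerSolver {c ℓ} (R : CommutativeRing c ℓ) where
  open CommutativeRing R renaming (refl to ≈-refl; sym to ≈-sym; trans to ≈-trans)
  open AbelianGroupProperties +-abelianGroup
  open RingProperties ring using (-‿distribˡ-*)
  open SemiringMult semiring using (×-homo-+; ×1-homo-*) renaming (_×_ to _×ᴿ_)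
  open SetoidReasoning setoid

  fromℤ : ℤ → Carrier
  fromℤ (+ n)    = n ×ᴿ 1#
  fromℤ -[1+ n ] = - (suc n ×ᴿ 1#)

  fromℤ-⊖ : ∀ m n → fromℤ (m ℤ.⊖ n) ≈ m ×ᴿ 1# - n ×ᴿ 1#
  fromℤ-⊖ m       zero    = ≈-sym (≈-trans (+-congˡ ε⁻¹≈ε) (+-identityʳ _))
  fromℤ-⊖ zero    (suc n) = ≈-sym (+-identityˡ _)
  fromℤ-⊖ (suc m) (suc n) = begin
    fromℤ (suc m ℤ.⊖ suc n)                    ≡⟨ cong fromℤ (ℤ.[1+m]⊖[1+n]≡m⊖n m n) ⟩
    fromℤ (m ℤ.⊖ n)                            ≈⟨ fromℤ-⊖ m n ⟩
    m ×ᴿ 1# - n ×ᴿ 1#                            ≈⟨ +-congʳ (xyx⁻¹≈y 1# (m ×ᴿ 1#)) ⟨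
    (1# + m ×ᴿ 1# - 1#) - n ×ᴿ 1#                ≈⟨ +-assoc _ _ _ ⟩
    (1# + m ×ᴿ 1#) + (- 1# - n ×ᴿ 1#)            ≈⟨ +-congˡ (⁻¹-∙-comm 1# (n ×ᴿ 1#)) ⟩
    (1# + m ×ᴿ 1#) - (1# + n ×ᴿ 1#)              ∎

  fromℤ-neg : ∀ i → fromℤ (ℤ.- i) ≈ - fromℤ i
  fromℤ-neg (+ zero)  = ≈-sym ε⁻¹≈ε
  fromℤ-neg (+ suc n) = ≈-refl
  fromℤ-neg -[1+ n ]  = ≈-sym (⁻¹-involutive _)

  fromℤ-+ : ∀ i j → fromℤ (i ℤ.+ j) ≈ fromℤ i + fromℤ j
  fromℤ-+ (+ m)    (+ n)    = ×-homo-+ 1# m n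
  fromℤ-+ (+ m)    -[1+ n ] = fromℤ-⊖ m (suc n)
  fromℤ-+ -[1+ m ] (+ n)    = ≈-trans (fromℤ-⊖ n (suc m)) (+-comm _ _)
  fromℤ-+ -[1+ m ] -[1+ n ] = begin
    fromℤ (-[1+ m ] ℤ.+ -[1+ n ])             ≡⟨ cong fromℤ (ℤ.neg-distrib-+ (+ suc m) (+ suc n)) ⟨
    - ((suc m ℕ.+ suc n) ×ᴿ 1#)                ≈⟨ -‿cong (×-homo-+ 1# (suc m) (suc n)) ⟩
    - (suc m ×ᴿ 1# + suc n ×ᴿ 1#)               ≈⟨ ⁻¹-∙-comm _ _ ⟨
    - (suc m ×ᴿ 1#) - suc n ×ᴿ 1#               ∎

  fromℤ-+* : ∀ m j → fromℤ (+ m ℤ.* j) ≈ m ×ᴿ 1# * fromℤ j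
  fromℤ-+* m (+ n)    = begin
    fromℤ (+ m ℤ.* + n)    ≡⟨ cong fromℤ (ℤ.pos-* m n) ⟨
    (m ℕ.* n) ×ᴿ 1#         ≈⟨ ×1-homo-* m n ⟩
    m ×ᴿ 1# * (n ×ᴿ 1#)      ∎
  fromℤ-+* m -[1+ n ] = begin
    fromℤ (+ m ℤ.* -[1+ n ])        ≡⟨ cong fromℤ (ℤ.neg-distribʳ-* (+ m) (+ suc n)) ⟨
    fromℤ (ℤ.- (+ m ℤ.* + suc n))   ≈⟨ fromℤ-neg (+ m ℤ.* + suc n) ⟩
    - fromℤ (+ m ℤ.* + suc n)       ≈⟨ -‿cong (fromℤ-+* m (+ suc n)) ⟩
    - (m ×ᴿ 1# * (suc n ×ᴿ 1#))       ≈⟨ RingProperties.-‿distribʳ-* ring _ _ ⟩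
    m ×ᴿ 1# * - (suc n ×ᴿ 1#)         ∎

  fromℤ-* : ∀ i j → fromℤ (i ℤ.* j) ≈ fromℤ i * fromℤ j
  fromℤ-* (+ m)    j = fromℤ-+* m j
  fromℤ-* -[1+ m ] j = begin
    fromℤ (-[1+ m ] ℤ.* j)          ≡⟨ cong fromℤ (ℤ.neg-distribˡ-* (+ suc m) j) ⟨
    fromℤ (ℤ.- (+ suc m ℤ.* j))     ≈⟨ fromℤ-neg (+ suc m ℤ.* j) ⟩
    - fromℤ (+ suc m ℤ.* j)         ≈⟨ -‿cong (fromℤ-+* (suc m) j) ⟩
    - (suc m ×ᴿ 1# * fromℤ j)        ≈⟨ -‿distribˡ-* _ _ ⟩
    - (suc m ×ᴿ 1#) * fromℤ j        ∎

  fromℤ-homomorphism : ℤ.+-*-rawRing -Raw-AlmostCommutative⟶ Old.fromCommutativeRing R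
  fromℤ-homomorphism = record
    { ⟦_⟧    = fromℤ
    ; +-homo = fromℤ-+
    ; *-homo = fromℤ-*
    ; -‿homo = fromℤ-neg
    ; 0-homo = ≈-refl
    ; 1-homo = +-identityʳ 1#
    }

  open RingSolver ℤ.+-*-rawRing (Old.fromCommutativeRing R) fromℤ-homomorphism
    (λ i j → Maybe.map (λ i≡j → reflexive (cong fromℤ i≡j)) (dec⇒maybe (i ℤ.≟ j)))
    public using (solve; _:+_; _:*_; _:-_; :-_; _:=_)

-- Counting admissible degrees and averaging over radii

module ℕSum = CommutativeMonoidSum ℕ.+-0-commutativeMonoid

fromℕ-ub : ∀ p → p ℚ.≤ fromℕ ℤ.∣ ℚ.↥ p ∣
fromℕ-ub p@record{} = ℚ.toℚᵘ-cancel-≤ (ℚᵘ.≤-respʳ-≃ (ℚᵘ.≃-sym (toℚᵘ-fromℕ _)) (*≤* (begin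
  ℚ.↥ p ℤ.* + 1                     ≡⟨ ℤ.*-identityʳ (ℚ.↥ p) ⟩
  ℚ.↥ p                             ≤⟨ i≤∣i∣ (ℚ.↥ p) ⟩
  + ℤ.∣ ℚ.↥ p ∣                     ≤⟨ ℤ.+≤+ (ℕ.m≤m*n ℤ.∣ ℚ.↥ p ∣ (ℚ.↧ₙ p)) ⟩
  + (ℤ.∣ ℚ.↥ p ∣ ℕ.* ℚ.↧ₙ p)        ≡⟨ ℤ.pos-* ℤ.∣ ℚ.↥ p ∣ (ℚ.↧ₙ p) ⟩
  + ℤ.∣ ℚ.↥ p ∣ ℤ.* ℚ.↧ p           ∎)))
  where
  open ℤ.≤-Reasoning
  i≤∣i∣ : ∀ i → i ℤ.≤ + ℤ.∣ i ∣
  i≤∣i∣ (+ n)    = ℤ.≤-refl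
  i≤∣i∣ -[1+ n ] = ℤ.-≤+

-- n is the number of d with q^d q^m ≤ q^s.
Fits : ℚ → ℚ → ℕ → Set
Fits m s n = ∀ d → fromℕ d ℚ.+ m ℚ.≤ s ⇔ d ℕ.< n

-- The admissible degrees are closed downwards and bounded by the numerator of `s - m`, so
-- descending from that bound the first admissible degree is the largest one, and the count is its
-- successor.
Fits-exists : ∀ m s → ∃[ n ] Fits m s n
Fits-exists m s = search (suc ℤ.∣ ℚ.↥ (s ℚ.- m) ∣) (λ d D<d fits → ℕ.<⇒≱ D<d (fromℕ-cancel-≤ (bound d fits)))
  where
  bound : ∀ d → fromℕ d ℚ.+ m ℚ.≤ s → fromℕ d ℚ.≤ fromℕ ℤ.∣ ℚ.↥ (s ℚ.- m) ∣
  bound d fits = begin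
    fromℕ d                         ≡⟨ ℚ.+-identityʳ (fromℕ d) ⟨
    fromℕ d ℚ.+ 0ℚ                  ≡⟨ cong (fromℕ d ℚ.+_) (ℚ.+-inverseʳ m) ⟨
    fromℕ d ℚ.+ (m ℚ.- m)           ≡⟨ ℚ.+-assoc (fromℕ d) m (ℚ.- m) ⟨
    fromℕ d ℚ.+ m ℚ.- m             ≤⟨ ℚ.+-monoˡ-≤ (ℚ.- m) fits ⟩
    s ℚ.- m                         ≤⟨ fromℕ-ub (s ℚ.- m) ⟩
    fromℕ ℤ.∣ ℚ.↥ (s ℚ.- m) ∣       ∎
    where open ℚ.≤-Reasoning
  search : ∀ D → (∀ d → D ℕ.≤ d → ¬ fromℕ d ℚ.+ m ℚ.≤ s) → ∃[ n ] Fits m s n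
  search zero    above = 0 , λ d → mk⇔ (λ fits → contradiction fits (above d ℕ.z≤n)) (λ ())
  search (suc D) above with fromℕ D ℚ.+ m ℚ.≤? s
  ... | yes fits = suc D , λ d → mk⇔ (λ fits′ → ℕ.≰⇒> (λ D<d → above d D<d fits′))
                     (λ { (ℕ.s≤s d≤D) → ℚ.≤-trans (ℚ.+-monoˡ-≤ m (fromℕ-mono-≤ d≤D)) fits })
  ... | no ¬fits = search D λ d D≤d fits → ¬fits (ℚ.≤-trans (ℚ.+-monoˡ-≤ m (fromℕ-mono-≤ D≤d)) fits)

module ℚSum = CommutativeMonoidSum ℚ.+-0-commutativeMonoid
module ℚ+ = AbelianGroupProperties ℚ.+-0-abelianGroup

module _ (M : ℕ) .{{_ : ℕ.NonZero M}} where

  -- The 1 counts `d = 0`, which always qualifies because `n` is a natural number. This is the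
  -- closed form of the number in `Fits` once everything is scaled by `M`.
  1+⌊_/M⌋ : ℕ → ℕ
  1+⌊ n /M⌋ = suc (n ℕ./ M)

  <1+⌊/⌋ : ∀ d n → d ℕ.* M ℕ.≤ n ⇔ d ℕ.< 1+⌊ n /M⌋
  <1+⌊/⌋ d n = mk⇔
    (λ dM≤n → ℕ.s≤s (subst (ℕ._≤ n ℕ./ M) (ℕ.m*n/n≡m d M) (ℕ./-monoˡ-≤ M dM≤n)))
    (λ { (ℕ.s≤s d≤n/M) → ℕ.≤-trans (ℕ.*-monoˡ-≤ M d≤n/M) (ℕ.m/n*n≤m n M) })

  1+⌊/⌋-shift : ∀ n → 1+⌊ n ℕ.+ M /M⌋ ≡ suc 1+⌊ n /M⌋
  1+⌊/⌋-shift n = cong suc (trans (ℕ.+-distrib-/-∣ʳ n (ℕ.∣-refl {M}))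
    (trans (cong (n ℕ./ M ℕ.+_) (ℕ.n/n≡1 M)) (ℕ.+-comm (n ℕ./ M) 1)))

  -- Hermite's identity.
  sum-1+⌊/⌋ : ∀ n → ℕSum.sum {M} (λ k → 1+⌊ n ℕ.+ Fin.toℕ k /M⌋) ≡ n ℕ.+ M
  sum-1+⌊/⌋ zero    = trans
    (ℕSum.sum-cong-≗ {M} (λ k → cong suc (ℕ.m<n⇒m/n≡0 (Fin.toℕ<n k))))
    (sum-ones M)
    where
    sum-ones : ∀ m → ℕSum.sum {m} (λ _ → 1) ≡ m
    sum-ones zero    = refl
    sum-ones (suc m) = cong suc (sum-ones m)
  -- The windows starting at `n` and `n + 1` overlap: prefixing the term at `n` to the later one
  -- gives `M + 1` consecutive terms, of which the first `M` fall under the induction hypothesis and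
  -- the last is one more than the term at `n`.
  sum-1+⌊/⌋ (suc n) = ℕ.+-cancelˡ-≡ 1+⌊ n /M⌋ _ _ (begin
    1+⌊ n /M⌋ ℕ.+ ℕSum.sum {M} (λ k → 1+⌊ suc n ℕ.+ Fin.toℕ k /M⌋)
      ≡⟨ cong₂ ℕ._+_ (cong 1+⌊_/M⌋ (sym (ℕ.+-identityʳ n)))
           (ℕSum.sum-cong-≗ {M} (λ k → cong 1+⌊_/M⌋ (sym (ℕ.+-suc n (Fin.toℕ k))))) ⟩
    ℕSum.sum {suc M} t
      ≡⟨ ℕSum.sum-init-last t ⟩
    ℕSum.sum {M} (Vector.init t) ℕ.+ Vector.last t
      ≡⟨ cong₂ ℕ._+_ (ℕSum.sum-cong-≗ {M} (λ k → cong (λ j → 1+⌊ n ℕ.+ j /M⌋) (Fin.toℕ-inject₁ k)))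
           (cong (λ j → 1+⌊ n ℕ.+ j /M⌋) (Fin.toℕ-fromℕ M)) ⟩
    ℕSum.sum {M} (λ k → 1+⌊ n ℕ.+ Fin.toℕ k /M⌋) ℕ.+ 1+⌊ n ℕ.+ M /M⌋
      ≡⟨ cong₂ ℕ._+_ (sum-1+⌊/⌋ n) (1+⌊/⌋-shift n) ⟩
    n ℕ.+ M ℕ.+ suc 1+⌊ n /M⌋
      ≡⟨ trans (ℕ.+-suc _ _) (ℕ.+-comm (suc (n ℕ.+ M)) _) ⟩
    1+⌊ n /M⌋ ℕ.+ (suc n ℕ.+ M) ∎)
    where
    open ≡-Reasoning
    t : Vector ℕ (suc M)
    t k = 1+⌊ n ℕ.+ Fin.toℕ k /M⌋

  sum-sum-1+⌊/⌋ : ∀ {r} (w : Vector ℕ r) →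
    ℕSum.sum {M} (λ k → ℕSum.sum {r} (λ i → 1+⌊ w i ℕ.+ Fin.toℕ k /M⌋)) ≡ ℕSum.sum w ℕ.+ ℕSum.sum {r} (λ _ → M)
  sum-sum-1+⌊/⌋ {r} w = trans (ℕSum.∑-comm {M} {r} _) (trans
    (ℕSum.sum-cong-≗ {r} (λ i → sum-1+⌊/⌋ (w i))) (ℕSum.∑-distrib-+ {r} w (λ _ → M)))

-- m = (S - w) / M: finitely many rationals m are encoded by naturals w with common M and S.
Scaled : ℕ → ℕ → ℚ → ℕ → Set
Scaled M S m w = fromℕ M ℚ.* m ℚ.+ fromℕ w ≡ fromℕ S

clear-denominator : ∀ m → ∃[ d ] ∃[ w ] ∃[ n ] Scaled (suc d) n m w
clear-denominator m@(ℚ.mkℚ i d _) = d , w i , n i , ℚ.toℚᵘ-injective (begin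
  ℚ.toℚᵘ (fromℕ (suc d) ℚ.* m ℚ.+ fromℕ (w i))
    ≈⟨ ℚ.toℚᵘ-homo-+ (fromℕ (suc d) ℚ.* m) (fromℕ (w i)) ⟩
  ℚ.toℚᵘ (fromℕ (suc d) ℚ.* m) ℚᵘ.+ ℚ.toℚᵘ (fromℕ (w i))
    ≈⟨ ℚᵘ.+-cong (ℚᵘ.≃-trans (ℚ.toℚᵘ-homo-* (fromℕ (suc d)) m)
         (ℚᵘ.*-cong (toℚᵘ-fromℕ (suc d)) (ℚᵘ.≃-refl {ℚ.toℚᵘ m}))) (toℚᵘ-fromℕ (w i)) ⟩
  mkℚᵘ (+ suc d) 0 ℚᵘ.* mkℚᵘ i d ℚᵘ.+ mkℚᵘ (+ w i) 0
    ≈⟨ *≡* cross ⟩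
  mkℚᵘ (+ n i) 0
    ≈⟨ toℚᵘ-fromℕ (n i) ⟨
  ℚ.toℚᵘ (fromℕ (n i)) ∎)
  where
  open ℚᵘ.≃-Reasoning
  -- `n` and `w` are the positive and the negative part of the numerator, which keeps both offset
  -- and weight natural.
  w : ℤ → ℕ
  w (+ n)    = 0
  w -[1+ n ] = suc n
  n : ℤ → ℕ
  n (+ n)    = n
  n -[1+ _ ] = 0
  i+w≡n : ∀ i → i ℤ.+ + w i ≡ + n i
  i+w≡n (+ n)    = ℤ.+-identityʳ (+ n)
  i+w≡n -[1+ n ] = ℤ.+-inverseˡ (+ suc n)
  cross : (+ suc d ℤ.* i ℤ.* + 1 ℤ.+ + w i ℤ.* + (1 ℕ.* suc d)) ℤ.* + 1 ≡ + n i ℤ.* + (1 ℕ.* suc d ℕ.* 1)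
  cross = trans (cong (λ e → (+ suc d ℤ.* i ℤ.* + 1 ℤ.+ + w i ℤ.* e) ℤ.* + 1) (cong +_ (ℕ.*-identityˡ (suc d))))
    (trans (collect (+ suc d) i (+ w i)) (trans (cong (+ suc d ℤ.*_) (i+w≡n i))
    (trans (ℤ.*-comm (+ suc d) (+ n i)) (cong (λ e → + n i ℤ.* + e) (sym (trans (ℕ.*-identityʳ (1 ℕ.* suc d)) (ℕ.*-identityˡ (suc d))))))))
    where
    open ℤSolver.+-*-Solver
    collect : ∀ d i w → (d ℤ.* i ℤ.* + 1 ℤ.+ w ℤ.* d) ℤ.* + 1 ≡ d ℤ.* (i ℤ.+ w)
    collect = solve 3 (λ d i w → (d :* i :* con (+ 1) :+ w :* d) :* con (+ 1) := d :* (i :+ w)) refl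

open NonReflective (New.fromCommutativeRing ℚ.+-*-commutativeRing (λ _ → nothing))
  using (_⊜_; _⊕_; _⊗_) renaming (solve to solveℚ)

-- Two scales merge by multiplying their moduli. The offsets have to agree as well, so each equation
-- is multiplied by the modulus of the other and then receives the other's scaled offset on both
-- sides.
Scaled-new : ∀ {d w n m} M S → Scaled d n m w → Scaled (M ℕ.* d) (d ℕ.* S ℕ.+ M ℕ.* n) m (d ℕ.* S ℕ.+ M ℕ.* w)
Scaled-new {d} {w} {n} {m} M S eq = begin
  fromℕ (M ℕ.* d) ℚ.* m ℚ.+ fromℕ (d ℕ.* S ℕ.+ M ℕ.* w)
    ≡⟨ cong₂ (λ x y → x ℚ.* m ℚ.+ y) (fromℕ-* M d) (trans (fromℕ-+ (d ℕ.* S) (M ℕ.* w)) (cong (fromℕ (d ℕ.* S) ℚ.+_) (fromℕ-* M w))) ⟩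
  fromℕ M ℚ.* fromℕ d ℚ.* m ℚ.+ (fromℕ (d ℕ.* S) ℚ.+ fromℕ M ℚ.* fromℕ w)
    ≡⟨ solveℚ 5 (λ M d m e w → (M ⊗ d ⊗ m ⊕ (e ⊕ M ⊗ w)) ⊜ (e ⊕ M ⊗ (d ⊗ m ⊕ w))) refl (fromℕ M) (fromℕ d) m (fromℕ (d ℕ.* S)) (fromℕ w) ⟩
  fromℕ (d ℕ.* S) ℚ.+ fromℕ M ℚ.* (fromℕ d ℚ.* m ℚ.+ fromℕ w)
    ≡⟨ cong (λ x → fromℕ (d ℕ.* S) ℚ.+ fromℕ M ℚ.* x) eq ⟩
  fromℕ (d ℕ.* S) ℚ.+ fromℕ M ℚ.* fromℕ n
    ≡⟨ trans (fromℕ-+ (d ℕ.* S) (M ℕ.* n)) (cong (fromℕ (d ℕ.* S) ℚ.+_) (fromℕ-* M n)) ⟨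
  fromℕ (d ℕ.* S ℕ.+ M ℕ.* n) ∎
  where open ≡-Reasoning

Scaled-old : ∀ {M S m w} d e → Scaled M S m w → Scaled (M ℕ.* d) (d ℕ.* S ℕ.+ e) m (d ℕ.* w ℕ.+ e)
Scaled-old {M} {S} {m} {w} d e eq = begin
  fromℕ (M ℕ.* d) ℚ.* m ℚ.+ fromℕ (d ℕ.* w ℕ.+ e)
    ≡⟨ cong₂ (λ x y → x ℚ.* m ℚ.+ y) (fromℕ-* M d) (trans (fromℕ-+ (d ℕ.* w) e) (cong (ℚ._+ fromℕ e) (fromℕ-* d w))) ⟩
  fromℕ M ℚ.* fromℕ d ℚ.* m ℚ.+ (fromℕ d ℚ.* fromℕ w ℚ.+ fromℕ e)
    ≡⟨ solveℚ 5 (λ M d m e w → (M ⊗ d ⊗ m ⊕ (d ⊗ w ⊕ e)) ⊜ (d ⊗ (M ⊗ m ⊕ w) ⊕ e)) refl (fromℕ M) (fromℕ d) m (fromℕ e) (fromℕ w) ⟩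
  fromℕ d ℚ.* (fromℕ M ℚ.* m ℚ.+ fromℕ w) ℚ.+ fromℕ e
    ≡⟨ cong (λ x → fromℕ d ℚ.* x ℚ.+ fromℕ e) eq ⟩
  fromℕ d ℚ.* fromℕ S ℚ.+ fromℕ e
    ≡⟨ trans (fromℕ-+ (d ℕ.* S) e) (cong (ℚ._+ fromℕ e) (fromℕ-* d S)) ⟨
  fromℕ (d ℕ.* S ℕ.+ e) ∎
  where open ≡-Reasoning

Scaled-sum : ∀ {M S r} {m : Vector ℚ r} {w : Vector ℕ r} → (∀ i → Scaled M S (m i) (w i)) →
             fromℕ M ℚ.* ℚSum.sum m ℚ.+ fromℕ (ℕSum.sum w) ≡ fromℕ (ℕSum.sum {r} (λ _ → S))
Scaled-sum {M} {S} {zero}  {m} {w} scaled = trans (cong (ℚ._+ fromℕ 0) (ℚ.*-zeroʳ (fromℕ M))) (ℚ.+-identityˡ (fromℕ 0))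
Scaled-sum {M} {S} {suc r} {m} {w} scaled = begin
  fromℕ M ℚ.* (m zero ℚ.+ ℚSum.sum (tail m)) ℚ.+ fromℕ (w zero ℕ.+ ℕSum.sum (tail w))
    ≡⟨ cong (fromℕ M ℚ.* (m zero ℚ.+ ℚSum.sum (tail m)) ℚ.+_) (fromℕ-+ (w zero) (ℕSum.sum (tail w))) ⟩
  fromℕ M ℚ.* (m zero ℚ.+ ℚSum.sum (tail m)) ℚ.+ (fromℕ (w zero) ℚ.+ fromℕ (ℕSum.sum (tail w)))
    ≡⟨ solveℚ 5 (λ M m n w v → (M ⊗ (m ⊕ n) ⊕ (w ⊕ v)) ⊜ (M ⊗ m ⊕ w ⊕ (M ⊗ n ⊕ v))) refl
         (fromℕ M) (m zero) (ℚSum.sum (tail m)) (fromℕ (w zero)) (fromℕ (ℕSum.sum (tail w))) ⟩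
  fromℕ M ℚ.* m zero ℚ.+ fromℕ (w zero) ℚ.+ (fromℕ M ℚ.* ℚSum.sum (tail m) ℚ.+ fromℕ (ℕSum.sum (tail w)))
    ≡⟨ cong₂ ℚ._+_ (scaled zero) (Scaled-sum {M} {S} {r} (scaled ∘ suc)) ⟩
  fromℕ S ℚ.+ fromℕ (ℕSum.sum {r} (λ _ → S))
    ≡⟨ fromℕ-+ S (ℕSum.sum {r} (λ _ → S)) ⟨
  fromℕ (S ℕ.+ ℕSum.sum {r} (λ _ → S)) ∎
  where open ≡-Reasoning

common-scale : ∀ {n} (m : Vector ℚ n) →
               ∃[ M ] ∃[ S ] Σ[ w ∈ Vector ℕ n ] ∀ i → Scaled (suc M) S (m i) (w i)
common-scale {zero}  m = 0 , 0 , (λ ()) , λ ()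
common-scale {suc n} m =
  let d , w₀ , n₀ , scaled₀ = clear-denominator (m zero)
      M , S , w , scaled = common-scale (tail m)
  -- Scales are returned as predecessors: this is one less than `suc M ℕ.* suc d`.
  in d ℕ.+ M ℕ.* suc d , suc d ℕ.* S ℕ.+ suc M ℕ.* n₀
   , (λ { zero → suc d ℕ.* S ℕ.+ suc M ℕ.* w₀ ; (suc i) → suc d ℕ.* w i ℕ.+ suc M ℕ.* n₀ })
   , λ { zero    → Scaled-new {suc d} {w₀} {n₀} (suc M) S scaled₀
       ; (suc i) → Scaled-old {suc M} {S} (suc d) (suc M ℕ.* n₀) (scaled i) }

module _ {M S : ℕ} where
  private instance
    M-pos : ℚ.Positive (fromℕ (suc M))
    M-pos = fromℕ-pos M

  -- Multiplied by the modulus, `m` becomes `S - w` and `s` becomes `S + k`; the offset `S` cancels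
  -- and an inequality between natural numbers remains.
  scaled-≤ : ∀ {d m w s k} → Scaled (suc M) S m w → fromℕ (suc M) ℚ.* s ≡ fromℕ (S ℕ.+ k) →
             fromℕ d ℚ.+ m ℚ.≤ s ⇔ d ℕ.* suc M ℕ.≤ w ℕ.+ k
  scaled-≤ {d} {m} {w} {s} {k} scaled Ms≡ = mk⇔
    (λ d+m≤s → ℕ.+-cancelʳ-≤ S _ _ (fromℕ-cancel-≤ (subst₂ ℚ._≤_ left right
      (ℚ.+-monoˡ-≤ (fromℕ w) (ℚ.*-monoˡ-≤-nonNeg (fromℕ (suc M)) {{ℚ.pos⇒nonNeg (fromℕ (suc M))}} d+m≤s)))))
    (λ dM≤ → ℚ.*-cancelˡ-≤-pos (fromℕ (suc M)) (ℚ-+-cancelʳ-≤ (fromℕ w) (subst₂ ℚ._≤_ (sym left) (sym right)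
      (fromℕ-mono-≤ (ℕ.+-monoˡ-≤ S dM≤)))))
    where
    open ≡-Reasoning
    ℚ-+-cancelʳ-≤ : ∀ z {x y} → x ℚ.+ z ℚ.≤ y ℚ.+ z → x ℚ.≤ y
    ℚ-+-cancelʳ-≤ z {x} {y} x+z≤y+z = subst₂ ℚ._≤_ (cancel x) (cancel y) (ℚ.+-monoˡ-≤ (ℚ.- z) x+z≤y+z)
      where
      cancel : ∀ x → x ℚ.+ z ℚ.- z ≡ x
      cancel x = trans (ℚ.+-assoc x z (ℚ.- z)) (trans (cong (x ℚ.+_) (ℚ.+-inverseʳ z)) (ℚ.+-identityʳ x))
    left : fromℕ (suc M) ℚ.* (fromℕ d ℚ.+ m) ℚ.+ fromℕ w ≡ fromℕ (d ℕ.* suc M ℕ.+ S)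
    left = begin
      fromℕ (suc M) ℚ.* (fromℕ d ℚ.+ m) ℚ.+ fromℕ w
        ≡⟨ cong (ℚ._+ fromℕ w) (ℚ.*-distribˡ-+ (fromℕ (suc M)) (fromℕ d) m) ⟩
      fromℕ (suc M) ℚ.* fromℕ d ℚ.+ fromℕ (suc M) ℚ.* m ℚ.+ fromℕ w
        ≡⟨ ℚ.+-assoc (fromℕ (suc M) ℚ.* fromℕ d) _ _ ⟩
      fromℕ (suc M) ℚ.* fromℕ d ℚ.+ (fromℕ (suc M) ℚ.* m ℚ.+ fromℕ w)
        ≡⟨ cong₂ ℚ._+_ (trans (ℚ.*-comm (fromℕ (suc M)) (fromℕ d)) (sym (fromℕ-* d (suc M)))) scaled ⟩
      fromℕ (d ℕ.* suc M) ℚ.+ fromℕ S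
        ≡⟨ fromℕ-+ (d ℕ.* suc M) S ⟨
      fromℕ (d ℕ.* suc M ℕ.+ S) ∎
    right : fromℕ (suc M) ℚ.* s ℚ.+ fromℕ w ≡ fromℕ (w ℕ.+ k ℕ.+ S)
    right = begin
      fromℕ (suc M) ℚ.* s ℚ.+ fromℕ w     ≡⟨ cong (ℚ._+ fromℕ w) Ms≡ ⟩
      fromℕ (S ℕ.+ k) ℚ.+ fromℕ w         ≡⟨ fromℕ-+ (S ℕ.+ k) w ⟨
      fromℕ (S ℕ.+ k ℕ.+ w)               ≡⟨ cong fromℕ (trans (ℕ.+-comm (S ℕ.+ k) w)
                                               (trans (cong (w ℕ.+_) (ℕ.+-comm S k)) (sym (ℕ.+-assoc w k S)))) ⟩
      fromℕ (w ℕ.+ k ℕ.+ S)               ∎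

  scaled-Fits : ∀ {m w s k} → Scaled (suc M) S m w → fromℕ (suc M) ℚ.* s ≡ fromℕ (S ℕ.+ k) →
                Fits m s (1+⌊_/M⌋ (suc M) (w ℕ.+ k))
  scaled-Fits {m} {w} {s} {k} scaled Ms≡ d = mk⇔
    (Equivalence.to (<1+⌊/⌋ (suc M) d (w ℕ.+ k)) ∘ Equivalence.to (scaled-≤ {d} {m} {w} {s} {k} scaled Ms≡))
    (Equivalence.from (scaled-≤ {d} {m} {w} {s} {k} scaled Ms≡) ∘ Equivalence.from (<1+⌊/⌋ (suc M) d (w ℕ.+ k)))

  divide-scale : ∀ t → ∃[ s ] fromℕ (suc M) ℚ.* s ≡ fromℕ t
  divide-scale t = ℚ.1/_ (fromℕ (suc M)) {{nonZero}} ℚ.* fromℕ t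
    , trans (sym (ℚ.*-assoc (fromℕ (suc M)) _ _))
        (trans (cong (ℚ._* fromℕ t) (ℚ.*-inverseʳ (fromℕ (suc M)) {{nonZero}})) (ℚ.*-identityˡ (fromℕ t)))
    where
    nonZero : ℚ.NonZero (fromℕ (suc M))
    nonZero = ℚ.pos⇒nonZero (fromℕ (suc M))

  *-cancelˡ-scale : ∀ {x y} → fromℕ (suc M) ℚ.* x ≡ fromℕ (suc M) ℚ.* y → x ≡ y
  *-cancelˡ-scale eq = ℚ.≤-antisym
    (ℚ.*-cancelˡ-≤-pos (fromℕ (suc M)) (ℚ.≤-reflexive eq))
    (ℚ.*-cancelˡ-≤-pos (fromℕ (suc M)) (ℚ.≤-reflexive (sym eq)))

-- Summing the equation over M consecutive radii q^(t/M) turns the step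
-- functions into affine functions of the exponents m.
balance : ∀ {r} (m : Fin 4 → Vector ℚ r) R →
  (∀ s → R ℚ.≤ s → (k : Fin 4 → Vector ℕ r) → (∀ x i → Fits (m x i) s (k x i)) →
     ℕSum.sum (k 0F) ℕ.+ ℕSum.sum (k 1F) ≡ ℕSum.sum (k 2F) ℕ.+ ℕSum.sum (k 3F)) →
  ℚSum.sum (m 0F) ℚ.+ ℚSum.sum (m 1F) ≡ ℚSum.sum (m 2F) ℚ.+ ℚSum.sum (m 3F)
balance {r} m R counts =
  -- The threshold `R` is scaled along with the 4r exponents. Its weight is a natural number, so `R`
  -- is at most S/M and every radius used below is large enough.
  let M-1 , S , w′ , scaled′ = common-scale {suc (4 ℕ.* r)} (R Vector.∷ (λ i → uncurry m (remQuot {4} r i)))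
  in fromScale M-1 S (w′ zero) (λ x i → w′ (suc (combine x i))) (scaled′ zero)
       (λ x i → subst (λ y → Scaled (suc M-1) S y (w′ (suc (combine x i))))
          (cong (uncurry m) (Fin.remQuot-combine x i)) (scaled′ (suc (combine x i))))
  where
  fromScale : ∀ M-1 S wR (w : Fin 4 → Vector ℕ r) → Scaled (suc M-1) S R wR →
              (∀ x i → Scaled (suc M-1) S (m x i) (w x i)) →
              ℚSum.sum (m 0F) ℚ.+ ℚSum.sum (m 1F) ≡ ℚSum.sum (m 2F) ℚ.+ ℚSum.sum (m 3F)
  fromScale M-1 S wR w scaledR scaled = *-cancelˡ-scale {M-1} {S} (ℚ+.∙-cancelʳ (fromℕ (W 0F ℕ.+ W 1F)) _ _ (begin
    fromℕ M ℚ.* (E 0F ℚ.+ E 1F) ℚ.+ fromℕ (W 0F ℕ.+ W 1F)      ≡⟨ total 0F 1F ⟩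
    fromℕ (V ℕ.+ V)                                            ≡⟨ total 2F 3F ⟨
    fromℕ M ℚ.* (E 2F ℚ.+ E 3F) ℚ.+ fromℕ (W 2F ℕ.+ W 3F)      ≡⟨ cong (λ n → fromℕ M ℚ.* (E 2F ℚ.+ E 3F) ℚ.+ fromℕ n) weights ⟨
    fromℕ M ℚ.* (E 2F ℚ.+ E 3F) ℚ.+ fromℕ (W 0F ℕ.+ W 1F)      ∎))
    where
    open ≡-Reasoning
    M : ℕ
    M = suc M-1
    W : Fin 4 → ℕ
    W x = ℕSum.sum (w x)
    E : Fin 4 → ℚ
    E x = ℚSum.sum (m x)
    V : ℕ
    V = ℕSum.sum {r} (λ _ → S)
    total : ∀ x y → fromℕ M ℚ.* (E x ℚ.+ E y) ℚ.+ fromℕ (W x ℕ.+ W y) ≡ fromℕ (V ℕ.+ V)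
    total x y = begin
      fromℕ M ℚ.* (E x ℚ.+ E y) ℚ.+ fromℕ (W x ℕ.+ W y)
        ≡⟨ cong₂ ℚ._+_ (ℚ.*-distribˡ-+ (fromℕ M) (E x) (E y)) (fromℕ-+ (W x) (W y)) ⟩
      fromℕ M ℚ.* E x ℚ.+ fromℕ M ℚ.* E y ℚ.+ (fromℕ (W x) ℚ.+ fromℕ (W y))
        ≡⟨ interchange (fromℕ M ℚ.* E x) (fromℕ M ℚ.* E y) (fromℕ (W x)) (fromℕ (W y)) ⟩
      fromℕ M ℚ.* E x ℚ.+ fromℕ (W x) ℚ.+ (fromℕ M ℚ.* E y ℚ.+ fromℕ (W y))
        ≡⟨ cong₂ ℚ._+_ (Scaled-sum {M} {S} {r} (scaled x)) (Scaled-sum {M} {S} {r} (scaled y)) ⟩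
      fromℕ V ℚ.+ fromℕ V
        ≡⟨ fromℕ-+ V V ⟨
      fromℕ (V ℕ.+ V) ∎
      where open CommutativeSemigroupProperties (CommutativeMonoid.commutativeSemigroup ℚ.+-0-commutativeMonoid) using (interchange)
    N : Fin 4 → Fin M → ℕ
    N x k = ℕSum.sum {r} (λ i → 1+⌊_/M⌋ M (w x i ℕ.+ Fin.toℕ k))
    R≤ : ∀ {s k} → fromℕ M ℚ.* s ≡ fromℕ (S ℕ.+ k) → R ℚ.≤ s
    R≤ {s} {k} Ms≡ = subst (ℚ._≤ s) (trans (cong (ℚ._+ R) fromℕ-0) (ℚ.+-identityˡ R))
      (Equivalence.from (scaled-≤ {M-1} {S} {0} {R} {wR} {s} {k} scaledR Ms≡) ℕ.z≤n)
    step : ∀ k → N 0F k ℕ.+ N 1F k ≡ N 2F k ℕ.+ N 3F k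
    step k = let s , Ms≡ = divide-scale {M-1} {S} (S ℕ.+ Fin.toℕ k) in
      counts s (R≤ {s} {Fin.toℕ k} Ms≡) (λ x i → 1+⌊_/M⌋ M (w x i ℕ.+ Fin.toℕ k))
        (λ x i → scaled-Fits {M-1} {S} {m x i} {w x i} {s} {Fin.toℕ k} (scaled x i) Ms≡)
    collect : ∀ x y → ℕSum.sum {M} (λ k → N x k ℕ.+ N y k) ≡ W x ℕ.+ W y ℕ.+ (ℕSum.sum {r} (λ _ → M) ℕ.+ ℕSum.sum {r} (λ _ → M))
    collect x y = trans (ℕSum.∑-distrib-+ {M} (N x) (N y)) (trans
      (cong₂ ℕ._+_ (sum-sum-1+⌊/⌋ M {r} (w x)) (sum-sum-1+⌊/⌋ M {r} (w y)))
      (interchange (W x) _ (W y) _))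
      where open CommutativeSemigroupProperties ℕ.+-commutativeSemigroup using (interchange)
    -- By Hermite's identity each index contributes its weight plus `M`; the total of the latter is
    -- the same on both sides.
    weights : W 0F ℕ.+ W 1F ≡ W 2F ℕ.+ W 3F
    weights = ℕ.+-cancelʳ-≡ _ _ _ (trans (sym (collect 0F 1F)) (trans (ℕSum.sum-cong-≗ {M} step) (collect 2F 3F)))

^-injectiveʳ : ∀ {b m n} → 1 ℕ.< b → b ℕ.^ m ≡ b ℕ.^ n → m ≡ n
^-injectiveʳ {b} {m} {n} 1<b eq with ℕ.<-cmp m n
... | tri< m<n _ _ = contradiction eq (ℕ.<⇒≢ (ℕ.^-monoʳ-< b 1<b m<n))
... | tri≈ _ m≡n _ = m≡n
... | tri> _ _ n<m = contradiction (sym eq) (ℕ.<⇒≢ (ℕ.^-monoʳ-< b 1<b n<m))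

×-injective⇒≤ : ∀ {k l m n} (f : Fin k → Fin l → Fin m × Fin n) →
                (∀ {i i′ j j′} → f i j ≡ f i′ j′ → i ≡ i′ × j ≡ j′) → k ℕ.* l ℕ.≤ m ℕ.* n
×-injective⇒≤ {k} {l} {m} {n} f f-injective = Fin.injective⇒≤ {f = g} λ {x} {y} eq →
  let i≡ , j≡ = f-injective {proj₁ (split x)} {proj₁ (split y)} {proj₂ (split x)} {proj₂ (split y)}
        (trans (sym (Fin.remQuot-combine _ _)) (trans (cong (remQuot n) eq) (Fin.remQuot-combine _ _)))
  in trans (sym (Fin.combine-remQuot {k} l x)) (trans (cong₂ combine i≡ j≡) (Fin.combine-remQuot {k} l y))
  where
  split : Fin (k ℕ.* l) → Fin k × Fin l
  split = remQuot {k} l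
  g : Fin (k ℕ.* l) → Fin (m ℕ.* n)
  g x = uncurry combine (uncurry f (split x))

-- Absolute values of constants and of powers of T

module Covolume {a ℓ q} {𝔽 : FiniteField a ℓ q} {c ℓ′} (ℂ : ℂ∞ 𝔽 c ℓ′) where
  open ℂ∞ ℂ hiding (zero) renaming (refl to ≈-refl; sym to ≈-sym; trans to ≈-trans)
  open Lattices ℂ
  open IntegerSolver (ℂ∞.commutativeRing ℂ)
  open Exp semiring using (_^_)
  open Sum semiring
    using (sum; sum-cong-≋; sum-remove; sum-replicate-zero; ∑-comm; ∑-distrib-+; *-distribˡ-sum; *-distribʳ-sum)
  open RingProperties ring using (-1*x≈-x; -‿distribˡ-*; -‿distribʳ-*)
  open AbelianGroupProperties +-abelianGroup using (x∙y⁻¹≈ε⇒x≈y; ε⁻¹≈ε; inverseˡ-unique)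
  open Membership setoid using (find; lose) renaming (_∈_ to _∈ˡ_)
  open SetoidReasoning setoid

  module F = CommutativeRing (FiniteField.commutativeRing 𝔽)
  module A = Polynomial (FiniteField.commutativeRing 𝔽)
  module ι = IsRingHomomorphism ι-hom

  _≟𝔽_ : ∀ x y → Dec (x F.≈ y)
  x ≟𝔽 y = map′
    (λ eq → F.trans (F.sym (strictlyInverseʳ x)) (F.trans (from-cong eq) (strictlyInverseʳ y)))
    to-cong (to x Fin.≟ to y)
    where open Inverse (FiniteField.enumeration 𝔽)

  ∣∣≡0⇒≈0 : ∀ {x} → ∣ x ∣ ≡ 0ᵛ → x ≈ 0#
  ∣∣≡0⇒≈0 = Equivalence.to (∣∣-zero _)

  ≈0⇒∣∣≡0 : ∀ {x} → x ≈ 0# → ∣ x ∣ ≡ 0ᵛ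
  ≈0⇒∣∣≡0 = Equivalence.from (∣∣-zero _)

  ≈0⇒∣∣≤ : ∀ {x v} → x ≈ 0# → ∣ x ∣ ≤ᵛ v
  ≈0⇒∣∣≤ x≈0 = subst (_≤ᵛ _) (sym (≈0⇒∣∣≡0 x≈0)) 0≤

  ∣∣≡q^⇒≉0 : ∀ {x s} → ∣ x ∣ ≡ q^ s → ¬ x ≈ 0#
  ∣∣≡q^⇒≉0 eq x≈0 with () ← trans (sym eq) (≈0⇒∣∣≡0 x≈0)

  ≉0⇒∣∣≡q^ : ∀ {x} → ¬ x ≈ 0# → ∃[ s ] ∣ x ∣ ≡ q^ s
  ≉0⇒∣∣≡q^ {x} x≉0 with ∣ x ∣ in eq
  ... | 0ᵛ   = contradiction (∣∣≡0⇒≈0 eq) x≉0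
  ... | q^ s = s , refl

  -- The exponents of absolute values are rational numbers, so vanishing can be read off decidably
  -- from `∣ x ∣`. All later searches through lists of elements rest on this.
  _≟0 : ∀ x → Dec (x ≈ 0#)
  x ≟0 = map′ ∣∣≡0⇒≈0 ≈0⇒∣∣≡0 (∣ x ∣ ≟ᵛ 0ᵛ)

  _≟_ : ∀ x y → Dec (x ≈ y)
  x ≟ y = map′ (x∙y⁻¹≈ε⇒x≈y x y) (λ x≈y → ≈-trans (+-congʳ x≈y) (-‿inverseʳ y)) ((x - y) ≟0)

  *-≈0 : ∀ {x y} → ¬ x ≈ 0# → x * y ≈ 0# → y ≈ 0#
  *-≈0 {x} {y} x≉0 xy≈0 with ∣ x ∣ in eqx | ∣ y ∣ in eqy | ∣∣-mult x y
  ... | 0ᵛ   | _    | _  = contradiction (∣∣≡0⇒≈0 eqx) x≉0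
  ... | q^ s | 0ᵛ   | _  = ∣∣≡0⇒≈0 eqy
  ... | q^ s | q^ t | eq = contradiction xy≈0 (∣∣≡q^⇒≉0 eq)

  *-≉0 : ∀ {x y} → ¬ x ≈ 0# → ¬ y ≈ 0# → ¬ x * y ≈ 0#
  *-≉0 x≉0 y≉0 = y≉0 ∘ *-≈0 x≉0

  inverse : ∀ {x} → ¬ x ≈ 0# → ∃[ y ] x * y ≈ 1#
  inverse = proj₂ (ℂ∞.isField ℂ) _

  ∣∣-+-≤ : ∀ {x y v} → ∣ x ∣ ≤ᵛ v → ∣ y ∣ ≤ᵛ v → ∣ x + y ∣ ≤ᵛ v
  ∣∣-+-≤ p r = ≤ᵛ-trans (∣∣-ultra _ _) (⊔ᵛ-lub p r)

  ∣∣-+-< : ∀ {x y v} → ∣ x ∣ <ᵛ v → ∣ y ∣ <ᵛ v → ∣ x + y ∣ <ᵛ v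
  ∣∣-+-< p r = ≤ᵛ-<ᵛ-trans (∣∣-ultra _ _) (⊔ᵛ-lub-< p r)

  ∣ι∣ : ∀ {x} → ¬ x F.≈ F.0# → ∣ ι x ∣ ≡ q^ 0ℚ
  ∣ι∣ {x} x≉0 = trans
    (∣∣-cong (≈-sym (≈-trans (+-congˡ (zeroʳ T)) (+-identityʳ (ι x)))))
    (∣∣-degree (x ∷ []) 0 (x≉0 , λ { (suc m) _ → F.refl }))

  ι≈0⇒≈0 : ∀ {x} → ι x ≈ 0# → x F.≈ F.0#
  ι≈0⇒≈0 {x} ιx≈0 with x ≟𝔽 F.0#
  ... | yes x≈0 = x≈0
  ... | no  x≉0 = contradiction ιx≈0 (∣∣≡q^⇒≉0 (∣ι∣ x≉0))

  ∣ι∣≤ : ∀ x → ∣ ι x ∣ ≤ᵛ q^ 0ℚ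
  ∣ι∣≤ x with x ≟𝔽 F.0#
  ... | yes x≈0 = ≈0⇒∣∣≤ (≈-trans (ι.⟦⟧-cong x≈0) ι.0#-homo)
  ... | no  x≉0 = ≤ᵛ-reflexive (∣ι∣ x≉0)

  𝔽-1≉0 : ¬ F.1# F.≈ F.0#
  𝔽-1≉0 = proj₁ (FiniteField.isField 𝔽) ∘ F.sym

  ∣1∣ : ∣ 1# ∣ ≡ q^ 0ℚ
  ∣1∣ = trans (∣∣-cong (≈-sym ι.1#-homo)) (∣ι∣ 𝔽-1≉0)

  1≉0 : ¬ 1# ≈ 0#
  1≉0 = ∣∣≡q^⇒≉0 ∣1∣

  -- The number -1 is a nonzero constant, hence has absolute value 1.
  ∣-∣ : ∀ x → ∣ - x ∣ ≡ ∣ x ∣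
  ∣-∣ x = trans (trans (∣∣-cong (≈-sym -1x≈-x)) (∣∣-mult (ι (F.- F.1#)) x))
                (trans (cong (_· ∣ x ∣) (∣ι∣ -1≉0)) (·-identityˡ ∣ x ∣))
    where
    -1≉0 : ¬ F.- F.1# F.≈ F.0#
    -1≉0 eq = 𝔽-1≉0 (F.trans (F.sym (F.+-identityʳ F.1#)) (F.trans (F.+-congˡ (F.sym eq)) (F.-‿inverseʳ F.1#)))
    -1x≈-x : ι (F.- F.1#) * x ≈ - x
    -1x≈-x = ≈-trans (*-congʳ (≈-trans (ι.-‿homo F.1#) (-‿cong ι.1#-homo))) (-1*x≈-x x)

  ∣∣-sub-≤ : ∀ {x y v} → ∣ x ∣ ≤ᵛ v → ∣ y ∣ ≤ᵛ v → ∣ x - y ∣ ≤ᵛ v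
  ∣∣-sub-≤ {y = y} p r = ∣∣-+-≤ p (subst (_≤ᵛ _) (sym (∣-∣ y)) r)

  ∣∣-sub-< : ∀ {x y v} → ∣ x ∣ <ᵛ v → ∣ y ∣ <ᵛ v → ∣ x - y ∣ <ᵛ v
  ∣∣-sub-< {y = y} p r = ∣∣-+-< p (subst (_<ᵛ _) (sym (∣-∣ y)) r)

  ∣∣-isosceles : ∀ {x y} → ∣ y ∣ <ᵛ ∣ x ∣ → ∣ x + y ∣ ≡ ∣ x ∣
  ∣∣-isosceles {x} {y} y<x = ≤ᵛ-antisym (∣∣-+-≤ ≤ᵛ-refl (<ᵛ⇒≤ᵛ y<x)) x≤x+y
    where
    x≤x+y : ∣ x ∣ ≤ᵛ ∣ x + y ∣
    x≤x+y with ∣ x ∣ ≤ᵛ? ∣ x + y ∣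
    ... | yes p = p
    ... | no  p = contradiction
      (≤ᵛ-reflexive (∣∣-cong (≈-sym (solve 2 (λ x y → x :+ y :- y := x) ≈-refl x y))))
      (∣∣-sub-< p y<x)

  ∣T∣ : ∣ T ∣ ≡ q^ (fromℕ 1)
  ∣T∣ = trans (∣∣-cong (≈-sym (≈-trans (+-cong ι.0#-homo
          (*-congˡ (≈-trans (+-cong ι.1#-homo (zeroʳ T)) (+-identityʳ 1#))))
          (≈-trans (+-identityˡ _) (*-identityʳ T)))))
        (trans (∣∣-degree (F.0# ∷ F.1# ∷ []) 1 (𝔽-1≉0 , λ { (suc (suc m)) _ → F.refl ; (suc zero) (ℕ.s≤s ()) }))
          (cong q^ (sym (fromℕ≡ 1))))

  T≉0 : ¬ T ≈ 0#
  T≉0 = ∣∣≡q^⇒≉0 ∣T∣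

  ∣T^∣ : ∀ n → ∣ T ^ n ∣ ≡ q^ (fromℕ n)
  ∣T^∣ zero    = trans ∣1∣ (cong q^ (sym fromℕ-0))
  ∣T^∣ (suc n) = trans (∣∣-mult T (T ^ n)) (trans (cong₂ _·_ ∣T∣ (∣T^∣ n)) (cong q^ (sym (fromℕ-+ 1 n))))

  ∣T*∣ : ∀ {x n} → ∣ x ∣ ≡ q^ (fromℕ n) → ∣ T * x ∣ ≡ q^ (fromℕ (suc n))
  ∣T*∣ {x} {n} eq = trans (∣∣-mult T x) (trans (cong₂ _·_ ∣T∣ eq) (cong q^ (sym (fromℕ-+ 1 n))))

  ∣T*∣< : ∀ {x n} → ∣ x ∣ <ᵛ q^ (fromℕ n) → ∣ T * x ∣ <ᵛ q^ (fromℕ (suc n))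
  ∣T*∣< {x} {n} x<n = subst₂ _<ᵛ_ (sym (trans (∣∣-mult T x) (cong (_· ∣ x ∣) ∣T∣)))
    (cong q^ (sym (fromℕ-+ 1 n))) (·-monoʳ-< (fromℕ 1) x<n)

  1<q^fromℕ-suc : ∀ n → q^ 0ℚ <ᵛ q^ (fromℕ (suc n))
  1<q^fromℕ-suc n p with () ← fromℕ-cancel-≤ {suc n} {0} (subst (fromℕ (suc n) ℚ.≤_) (sym fromℕ-0) (q^-cancel-≤ p))

  ∣ι∣<suc : ∀ x n → ∣ ι x ∣ <ᵛ q^ (fromℕ (suc n))
  ∣ι∣<suc x n = ≤ᵛ-<ᵛ-trans (∣ι∣≤ x) (1<q^fromℕ-suc n)

  -- The ring A = 𝔽_q[T] as a subring of ℂ∞.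
  𝔸 : Pred Carrier (a ⊔ ℓ′)
  𝔸 x = ∃[ f ] x ≈ evalᴬ f

  𝔸-resp : ∀ {x y} → x ≈ y → x ∈ 𝔸 → y ∈ 𝔸
  𝔸-resp x≈y (f , x≈f) = f , ≈-trans (≈-sym x≈y) x≈f

  𝔸-eval : ∀ f → evalᴬ f ∈ 𝔸
  𝔸-eval f = f , ≈-refl

  𝔸-0 : 0# ∈ 𝔸
  𝔸-0 = [] , ≈-refl

  𝔸-ι : ∀ x → ι x ∈ 𝔸
  𝔸-ι x = x ∷ [] , ≈-sym (≈-trans (+-congˡ (zeroʳ T)) (+-identityʳ (ι x)))

  𝔸-1 : 1# ∈ 𝔸
  𝔸-1 = 𝔸-resp ι.1#-homo (𝔸-ι F.1#)

  𝔸-horner : ∀ x {y} → y ∈ 𝔸 → ι x + T * y ∈ 𝔸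
  𝔸-horner x (f , y≈f) = x ∷ f , +-congˡ (*-congˡ y≈f)

  𝔸-T* : ∀ {y} → y ∈ 𝔸 → T * y ∈ 𝔸
  𝔸-T* y∈𝔸 = 𝔸-resp (≈-trans (+-congʳ ι.0#-homo) (+-identityˡ _)) (𝔸-horner F.0# y∈𝔸)

  evalᴬ-+ : ∀ f g → evalᴬ f + evalᴬ g ∈ 𝔸
  evalᴬ-+ []      g       = g , +-identityˡ _
  evalᴬ-+ (x ∷ f) []      = x ∷ f , +-identityʳ _
  evalᴬ-+ (x ∷ f) (y ∷ g) = 𝔸-resp
    (≈-trans (+-congʳ (ι.+-homo x y))
      (solve 5 (λ x y t f g → x :+ y :+ t :* (f :+ g) := x :+ t :* f :+ (y :+ t :* g)) ≈-refl _ _ _ _ _))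
    (𝔸-horner (x F.+ y) (evalᴬ-+ f g))

  𝔸-+ : ∀ {x y} → x ∈ 𝔸 → y ∈ 𝔸 → x + y ∈ 𝔸
  𝔸-+ (f , x≈f) (g , y≈g) = 𝔸-resp (≈-sym (+-cong x≈f y≈g)) (evalᴬ-+ f g)

  evalᴬ-ι* : ∀ x f → ι x * evalᴬ f ∈ 𝔸
  evalᴬ-ι* x []      = 𝔸-resp (≈-sym (zeroʳ (ι x))) 𝔸-0
  evalᴬ-ι* x (y ∷ f) = 𝔸-resp
    (≈-trans (+-congʳ (ι.*-homo x y))
      (solve 4 (λ x y t f → x :* y :+ t :* (x :* f) := x :* (y :+ t :* f)) ≈-refl _ _ _ _))
    (𝔸-horner (x F.* y) (evalᴬ-ι* x f))

  𝔸-* : ∀ {x y} → x ∈ 𝔸 → y ∈ 𝔸 → x * y ∈ 𝔸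
  𝔸-* (f , x≈f) (g , y≈g) = 𝔸-resp (≈-sym (*-cong x≈f y≈g)) (evalᴬ-* f g)
    where
    evalᴬ-* : ∀ f g → evalᴬ f * evalᴬ g ∈ 𝔸
    evalᴬ-* []      g = 𝔸-resp (≈-sym (zeroˡ _)) 𝔸-0
    evalᴬ-* (x ∷ f) g = 𝔸-resp
      (solve 4 (λ x t f g → x :* g :+ t :* (f :* g) := (x :+ t :* f) :* g) ≈-refl _ _ _ _)
      (𝔸-+ (evalᴬ-ι* x g) (𝔸-T* (evalᴬ-* f g)))

  𝔸-neg : ∀ {x} → x ∈ 𝔸 → - x ∈ 𝔸
  𝔸-neg {x} x∈𝔸 = 𝔸-resp
    (≈-trans (*-congʳ (≈-trans (ι.-‿homo F.1#) (-‿cong ι.1#-homo))) (-1*x≈-x x))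
    (𝔸-* (𝔸-ι (F.- F.1#)) x∈𝔸)

  𝔸-sub : ∀ {x y} → x ∈ 𝔸 → y ∈ 𝔸 → x - y ∈ 𝔸
  𝔸-sub x∈𝔸 y∈𝔸 = 𝔸-+ x∈𝔸 (𝔸-neg y∈𝔸)

  -- Leading terms and division with remainder in 𝔽_q[T]

  -- Coefficient lists may end in zeros, so degree and leading coefficient are attached to the
  -- element of ℂ∞ instead. The strict bound on `rest` already forces the absolute value to be that
  -- of the leading term.
  record LeadingForm (x : Carrier) : Set (a ⊔ ℓ ⊔ c ⊔ ℓ′) where
    field
      degree  : ℕ
      lc      : F.Carrier
      lc≉0    : ¬ lc F.≈ F.0#
      rest    : Carrier
      rest∈𝔸  : rest ∈ 𝔸
      ≈rest+  : x ≈ rest + ι lc * T ^ degree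
      ∣rest∣< : ∣ rest ∣ <ᵛ q^ (fromℕ degree)

    ∣lead∣ : ∣ ι lc * T ^ degree ∣ ≡ q^ (fromℕ degree)
    ∣lead∣ = trans (∣∣-mult _ _) (trans (cong₂ _·_ (∣ι∣ lc≉0) (∣T^∣ degree)) (·-identityˡ _))

    ∣∣≡ : ∣ x ∣ ≡ q^ (fromℕ degree)
    ∣∣≡ = trans (∣∣-cong (≈-trans ≈rest+ (+-comm _ _)))
            (trans (∣∣-isosceles (<ᵛ-≤ᵛ-trans ∣rest∣< (≤ᵛ-reflexive (sym ∣lead∣)))) ∣lead∣)

  evalᴬ-leading : ∀ f → evalᴬ f ≈ 0# ⊎ LeadingForm (evalᴬ f)
  evalᴬ-leading []      = inj₁ ≈-refl
  evalᴬ-leading (x ∷ f) with evalᴬ-leading f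
  ... | inj₂ l = inj₂ (record
    { degree  = suc degree
    ; lc      = lc
    ; lc≉0    = lc≉0
    ; rest    = ι x + T * rest
    ; rest∈𝔸  = 𝔸-horner x rest∈𝔸
    ; ≈rest+  = ≈-trans (+-congˡ (*-congˡ ≈rest+))
        (solve 5 (λ x t r l p → x :+ t :* (r :+ l :* p) := x :+ t :* r :+ l :* (t :* p)) ≈-refl _ _ _ _ _)
    ; ∣rest∣< = ∣∣-+-< (∣ι∣<suc x degree) (∣T*∣< ∣rest∣<)
    })
    where open LeadingForm l
  ... | inj₁ f≈0 with x ≟𝔽 F.0#
  ...   | yes x≈0 = inj₁ (≈-trans (+-cong (≈-trans (ι.⟦⟧-cong x≈0) ι.0#-homo) (*-congˡ f≈0))
                                  (≈-trans (+-identityˡ _) (zeroʳ T)))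
  ...   | no  x≉0 = inj₂ (record
    { degree  = 0
    ; lc      = x
    ; lc≉0    = x≉0
    ; rest    = 0#
    ; rest∈𝔸  = 𝔸-0
    ; ≈rest+  = begin
        ι x + T * evalᴬ f   ≈⟨ +-congˡ (≈-trans (*-congˡ f≈0) (zeroʳ T)) ⟩
        ι x + 0#            ≈⟨ +-comm _ _ ⟩
        0# + ι x            ≈⟨ +-congˡ (*-identityʳ (ι x)) ⟨
        0# + ι x * 1#       ∎
    ; ∣rest∣< = subst (_<ᵛ _) (sym (≈0⇒∣∣≡0 ≈-refl)) 0<q^
    })

  leading : ∀ {x} → x ∈ 𝔸 → x ≈ 0# ⊎ LeadingForm x
  leading (f , x≈f) with evalᴬ-leading f
  ... | inj₁ f≈0 = inj₁ (≈-trans x≈f f≈0)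
  ... | inj₂ l   = inj₂ (record { LeadingForm l ; ≈rest+ = ≈-trans x≈f (LeadingForm.≈rest+ l) })

  IsZero⇒evalᴬ≈0 : ∀ f → A.IsZero f → evalᴬ f ≈ 0#
  IsZero⇒evalᴬ≈0 []      f≈0 = ≈-refl
  IsZero⇒evalᴬ≈0 (x ∷ f) f≈0 = ≈-trans
    (+-cong (≈-trans (ι.⟦⟧-cong (f≈0 0)) ι.0#-homo) (*-congˡ (IsZero⇒evalᴬ≈0 f (f≈0 ∘ suc))))
    (≈-trans (+-identityˡ _) (zeroʳ T))

  -- A nonzero `y` would make `T * y` larger than every constant, so nothing could cancel it. This
  -- is the source of the uniqueness of coefficients.
  constant≈0 : ∀ x {y} → y ∈ 𝔸 → ι x + T * y ≈ 0# → y ≈ 0#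
  constant≈0 x {y} y∈𝔸 eq with leading y∈𝔸
  ... | inj₁ y≈0 = y≈0
  ... | inj₂ l   = contradiction (≈-trans (+-comm _ _) eq)
    (∣∣≡q^⇒≉0 (trans (∣∣-isosceles (<ᵛ-≤ᵛ-trans (∣ι∣<suc x degree) (≤ᵛ-reflexive (sym ∣Ty∣)))) ∣Ty∣))
    where
    open LeadingForm l
    ∣Ty∣ = ∣T*∣ {y} {degree} ∣∣≡

  evalᴬ≈0⇒IsZero : ∀ f → evalᴬ f ≈ 0# → A.IsZero f
  evalᴬ≈0⇒IsZero []      _  n       = F.refl
  evalᴬ≈0⇒IsZero (x ∷ f) eq with constant≈0 x (𝔸-eval f) eq
  ... | f≈0 = λ where
    zero    → ι≈0⇒≈0 (≈-trans (≈-sym (≈-trans (+-congˡ (≈-trans (*-congˡ f≈0) (zeroʳ T))) (+-identityʳ _))) eq)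
    (suc n) → evalᴬ≈0⇒IsZero f f≈0 n

  -- Dividing by `T ^ n` cuts the coefficient list after `n` entries. The strict bound on `r` is
  -- what makes the later rounding argument work.
  split : ∀ n {x} → x ∈ 𝔸 →
          ∃[ r ] ∃[ y ] r ∈ 𝔸 × y ∈ 𝔸 × x ≈ r + T ^ n * y × ∣ r ∣ <ᵛ q^ (fromℕ n)
  split n (f , x≈f) with splitEval n f
    where
    splitEval : ∀ n f → ∃[ r ] ∃[ y ] r ∈ 𝔸 × y ∈ 𝔸 × evalᴬ f ≈ r + T ^ n * y × ∣ r ∣ <ᵛ q^ (fromℕ n)
    splitEval zero    f       = 0# , evalᴬ f , 𝔸-0 , 𝔸-eval f
      , ≈-sym (≈-trans (+-identityˡ _) (*-identityˡ _)) , subst (_<ᵛ _) (sym (≈0⇒∣∣≡0 ≈-refl)) 0<q^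
    splitEval (suc n) []      = 0# , 0# , 𝔸-0 , 𝔸-0
      , ≈-sym (≈-trans (+-identityˡ _) (zeroʳ _)) , subst (_<ᵛ _) (sym (≈0⇒∣∣≡0 ≈-refl)) 0<q^
    splitEval (suc n) (x ∷ f) with r , y , r∈𝔸 , y∈𝔸 , eq , r<n ← splitEval n f =
      ι x + T * r , y , 𝔸-horner x r∈𝔸 , y∈𝔸
      , ≈-trans (+-congˡ (*-congˡ eq))
          (solve 5 (λ x t r p y → x :+ t :* (r :+ p :* y) := x :+ t :* r :+ t :* p :* y) ≈-refl _ _ _ _ _)
      , ∣∣-+-< (∣ι∣<suc x n) (∣T*∣< r<n)
  ... | r , y , r∈𝔸 , y∈𝔸 , eq , r<n = r , y , r∈𝔸 , y∈𝔸 , ≈-trans x≈f eq , r<n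

  -- Take the quotient of the two leading coefficients in 𝔽_q: after subtraction only lower terms
  -- survive.
  cancelLeading : ∀ {u v} (l : LeadingForm u) (m : LeadingForm v) →
                  LeadingForm.degree l ≡ LeadingForm.degree m →
                  ∃[ x ] ∣ u - v * ι x ∣ <ᵛ ∣ v ∣
  cancelLeading {u} {v} l m degree≡
    with y , eq ← proj₂ (FiniteField.isField 𝔽) (LeadingForm.lc m) (LeadingForm.lc≉0 m) =
    x , subst₂ _<ᵛ_ (∣∣-cong (≈-sym u-vx≈)) (sym M.∣∣≡) (∣∣-sub-< l< m<)
    where
    module L = LeadingForm l
    module M = LeadingForm m
    x = y F.* L.lc
    lc*x≈ : ι M.lc * ι x ≈ ι L.lc
    lc*x≈ = ≈-trans (≈-sym (ι.*-homo _ _)) (ι.⟦⟧-cong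
      (F.trans (F.sym (F.*-assoc _ _ _)) (F.trans (F.*-congʳ eq) (F.*-identityˡ _))))
    u-vx≈ : u - v * ι x ≈ L.rest - M.rest * ι x
    u-vx≈ = begin
      u - v * ι x
        ≈⟨ +-cong L.≈rest+ (-‿cong (*-congʳ M.≈rest+)) ⟩
      L.rest + ι L.lc * T ^ L.degree - (M.rest + ι M.lc * T ^ M.degree) * ι x
        ≡⟨ cong (λ d → L.rest + ι L.lc * T ^ d - (M.rest + ι M.lc * T ^ M.degree) * ι x) degree≡ ⟩
      L.rest + ι L.lc * T ^ M.degree - (M.rest + ι M.lc * T ^ M.degree) * ι x
        ≈⟨ solve 6 (λ r l t s m x → r :+ l :* t :- (s :+ m :* t) :* x := r :- s :* x :+ (l :- m :* x) :* t)
             ≈-refl _ _ _ _ _ _ ⟩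
      L.rest - M.rest * ι x + (ι L.lc - ι M.lc * ι x) * T ^ M.degree
        ≈⟨ +-congˡ (*-congʳ (+-congˡ (-‿cong lc*x≈))) ⟩
      L.rest - M.rest * ι x + (ι L.lc - ι L.lc) * T ^ M.degree
        ≈⟨ solve 3 (λ r l t → r :+ (l :- l) :* t := r) ≈-refl _ _ _ ⟩
      L.rest - M.rest * ι x ∎
    l< : ∣ L.rest ∣ <ᵛ q^ (fromℕ M.degree)
    l< = subst (λ d → _ <ᵛ q^ (fromℕ d)) degree≡ L.∣rest∣<
    m< : ∣ M.rest * ι x ∣ <ᵛ q^ (fromℕ M.degree)
    m< = ≤ᵛ-<ᵛ-trans (≤ᵛ-trans (≤ᵛ-reflexive (∣∣-mult _ _))
           (≤ᵛ-trans (·-monoʳ-≤ ∣ M.rest ∣ (∣ι∣≤ x))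
             (≤ᵛ-reflexive (trans (·-comm _ (q^ 0ℚ)) (·-identityˡ _))))) M.∣rest∣<

  -- Here the quotient is a constant: zero if the degree of `u` is smaller than that of `v`, and the
  -- one from `cancelLeading` if they are equal.
  divideStep : ∀ {u v} → u ∈ 𝔸 → (m : LeadingForm v) → ∣ u ∣ <ᵛ q^ (fromℕ (suc (LeadingForm.degree m))) →
               ∃[ w ] w ∈ 𝔸 × ∣ u - v * w ∣ <ᵛ ∣ v ∣
  divideStep {u} {v} u∈𝔸 m u< = byDegree (leading u∈𝔸)
    where
    module M = LeadingForm m
    keep : ∣ u ∣ <ᵛ ∣ v ∣ → ∃[ w ] w ∈ 𝔸 × ∣ u - v * w ∣ <ᵛ ∣ v ∣
    keep p = 0# , 𝔸-0 , subst (_<ᵛ ∣ v ∣) (∣∣-cong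
      (≈-sym (≈-trans (+-congˡ (≈-trans (-‿cong (zeroʳ v)) ε⁻¹≈ε)) (+-identityʳ u)))) p
    byDegree : u ≈ 0# ⊎ LeadingForm u → ∃[ w ] w ∈ 𝔸 × ∣ u - v * w ∣ <ᵛ ∣ v ∣
    byDegree (inj₁ u≈0) = keep (subst₂ _<ᵛ_ (sym (≈0⇒∣∣≡0 u≈0)) (sym M.∣∣≡) 0<q^)
    byDegree (inj₂ l) with ℕ.<-cmp (LeadingForm.degree l) M.degree
    ... | tri< l<m _ _ = keep (subst₂ _<ᵛ_ (sym (LeadingForm.∣∣≡ l)) (sym M.∣∣≡)
            (λ m≤l → ℕ.<⇒≱ l<m (fromℕ-cancel-≤ (q^-cancel-≤ m≤l))))
    ... | tri≈ _ l≡m _ = let y , p = cancelLeading l m l≡m in ι y , 𝔸-ι y , p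
    ... | tri> _ _ m<l = contradiction (≤ᵛ-trans (q^≤ (fromℕ-mono-≤ m<l)) (≤ᵛ-reflexive (sym (LeadingForm.∣∣≡ l)))) u<

  -- Long division along Horner's scheme: `T` times the remainder of the tail, plus the next
  -- coefficient, has degree at most that of `v`, so one `divideStep` restores the bound.
  divideEval : ∀ {v} → v ∈ 𝔸 → LeadingForm v → ∀ f → ∃[ w ] w ∈ 𝔸 × ∣ evalᴬ f - v * w ∣ <ᵛ ∣ v ∣
  divideEval {v} v∈𝔸 m []      = divideStep 𝔸-0 m
    (≤ᵛ-<ᵛ-trans (≤ᵛ-reflexive (≈0⇒∣∣≡0 ≈-refl)) 0<q^)
  divideEval {v} v∈𝔸 m (x ∷ f) =
    let w , w∈𝔸 , r<v = divideEval v∈𝔸 m f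
        y , y∈𝔸 , p = divideStep (𝔸-horner x (𝔸-sub (𝔸-eval f) (𝔸-* v∈𝔸 w∈𝔸))) m
           (∣∣-+-< (∣ι∣<suc x (LeadingForm.degree m)) (∣T*∣< (<ᵛ-≤ᵛ-trans r<v (≤ᵛ-reflexive (LeadingForm.∣∣≡ m)))))
    in T * w + y , 𝔸-+ (𝔸-T* w∈𝔸) y∈𝔸 , subst (_<ᵛ ∣ v ∣) (∣∣-cong (shift y)) p
    where
    shift : ∀ {w} y → ι x + T * (evalᴬ f - v * w) - v * y ≈ ι x + T * evalᴬ f - v * (T * w + y)
    shift y = solve 6 (λ x t f v w y → x :+ t :* (f :- v :* w) :- v :* y := x :+ t :* f :- v :* (t :* w :+ y))
      ≈-refl _ _ _ _ _ _

  divide : ∀ {u v} → u ∈ 𝔸 → v ∈ 𝔸 → ¬ v ≈ 0# → ∃[ w ] w ∈ 𝔸 × ∣ u - v * w ∣ <ᵛ ∣ v ∣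
  divide {u} {v} (f , u≈f) v∈𝔸 v≉0 with leading v∈𝔸
  ... | inj₁ v≈0 = contradiction v≈0 v≉0
  ... | inj₂ m   with w , w∈𝔸 , p ← divideEval v∈𝔸 m f = w , w∈𝔸
    , subst (_<ᵛ ∣ v ∣) (∣∣-cong (+-congʳ (≈-sym u≈f))) p

  -- Linear algebra over 𝔽_q[T]

  sum-≈0 : ∀ {n} {t : Vector Carrier n} → (∀ i → t i ≈ 0#) → sum t ≈ 0#
  sum-≈0 {n} t≈0 = ≈-trans (sum-cong-≋ t≈0) (sum-replicate-zero n)

  -- Gaussian elimination without division.
  relation : ∀ {m n} (F : Fin m → Fin n → Carrier) → (∀ i j → F i j ∈ 𝔸) → n ℕ.< m →
             Σ[ g ∈ Vector Carrier m ] (∀ i → g i ∈ 𝔸) × (∃[ i ] ¬ g i ≈ 0#) × (∀ j → sum (λ i → g i * F i j) ≈ 0#)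
  relation {suc m} {zero}  F F∈𝔸 _           = (λ _ → 1#) , (λ _ → 𝔸-1) , (zero , 1≉0) , λ ()
  relation {suc m} {suc n} F F∈𝔸 (ℕ.s≤s n<m) with Fin.any? (λ i → ¬? (F i zero ≟0))
  -- A vanishing first column imposes no condition. The first row is discarded with it, which keeps
  -- more rows than columns, and gets coefficient zero.
  ... | no  column≈0 = let g , g∈𝔸 , (k , gk≉0) , rel = relation (λ i j → F (suc i) (suc j)) (λ i j → F∈𝔸 (suc i) (suc j)) n<m
    in 0# Vector.∷ g
     , (λ { zero → 𝔸-0 ; (suc i) → g∈𝔸 i })
     , (suc k , gk≉0)
     , λ { zero    → sum-≈0 {t = λ i → (0# Vector.∷ g) i * F i zero} λ i →
             ≈-trans (*-congˡ (decidable-stable (F i zero ≟0) (λ p → column≈0 (i , p)))) (zeroʳ _)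
         ; (suc j) → ≈-trans (+-cong (zeroˡ _) (rel j)) (+-identityˡ 0#) }
  ... | yes (p , pivot≉0) =
    let g , g∈𝔸 , (k , gk≉0) , rel = relation F′ F′∈𝔸 n<m
    in  h g , h∈𝔸 g∈𝔸
      , (punchIn p k , λ eq → *-≉0 pivot≉0 gk≉0 (≈-trans (reflexive (sym (insertAt-punchIn (λ i → F p zero * g i) p _ k))) eq))
      , h-rel g rel
    where
    -- Cross-multiplication with the pivot row `p` clears the first column and stays inside 𝔽_q[T].
    F′ : Fin m → Fin n → Carrier
    F′ i j = F p zero * F (punchIn p i) (suc j) - F (punchIn p i) zero * F p (suc j)
    F′∈𝔸 : ∀ i j → F′ i j ∈ 𝔸
    F′∈𝔸 i j = 𝔸-sub (𝔸-* (F∈𝔸 _ _) (F∈𝔸 _ _)) (𝔸-* (F∈𝔸 _ _) (F∈𝔸 _ _))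
    -- Expanding a relation `g` between the rows of `F′` gives row `punchIn p i` the coefficient
    -- `F p zero * g i` and collects this sum in front of the pivot row.
    h₀ : Vector Carrier m → Carrier
    h₀ g = - sum (λ i → g i * F (punchIn p i) zero)
    h : Vector Carrier m → Vector Carrier (suc m)
    h g = insertAt (λ i → F p zero * g i) p (h₀ g)
    𝔸-sum : ∀ {n} {t : Vector Carrier n} → (∀ i → t i ∈ 𝔸) → sum t ∈ 𝔸
    𝔸-sum {zero}  t∈𝔸 = 𝔸-0
    𝔸-sum {suc n} t∈𝔸 = 𝔸-+ (t∈𝔸 zero) (𝔸-sum (t∈𝔸 ∘ suc))
    h∈𝔸 : ∀ {g} → (∀ i → g i ∈ 𝔸) → ∀ i → h g i ∈ 𝔸
    h∈𝔸 {g} g∈𝔸 i with p Fin.≟ i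
    ... | yes refl = 𝔸-resp (reflexive (sym (insertAt-lookup _ p _)))
                       (𝔸-neg (𝔸-sum (λ i → 𝔸-* (g∈𝔸 i) (F∈𝔸 _ _))))
    ... | no  p≢i  = subst (λ i → h g i ∈ 𝔸) (Fin.punchIn-punchOut p≢i)
      (𝔸-resp (reflexive (sym (insertAt-punchIn _ p _ (Fin.punchOut p≢i)))) (𝔸-* (F∈𝔸 _ _) (g∈𝔸 _)))
    identity₁ : ∀ g b x c y → g * b * - x + c * (g * y) ≈ c * (g * y) - b * g * x
    identity₁ = solve 5 (λ g b x c y → g :* b :* :- x :+ c :* (g :* y) := c :* (g :* y) :- b :* g :* x) ≈-refl
    identity₂ : ∀ c g x → c * (g * x) - x * g * c ≈ 0#
    identity₂ c g x = ≈-trans (+-congʳ (≈-trans (*-comm c _) (*-congʳ (*-comm g x)))) (-‿inverseʳ _)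
    identity₃ : ∀ c g y b x → c * (g * y) - b * g * x ≈ g * (c * y - b * x)
    identity₃ = solve 5 (λ c g y b x → c :* (g :* y) :- b :* g :* x := g :* (c :* y :- b :* x)) ≈-refl
    expand : ∀ g j → sum (λ i → h g i * F i j) ≈
      sum (λ i → F p zero * (g i * F (punchIn p i) j) - F (punchIn p i) zero * g i * F p j)
    expand g j = begin
      sum (λ i → h g i * F i j)
        ≈⟨ sum-remove {i = p} (λ i → h g i * F i j) ⟩
      h g p * F p j + sum (λ i → h g (punchIn p i) * F (punchIn p i) j)
        ≈⟨ +-cong (*-congʳ (reflexive (insertAt-lookup _ p _)))
             (sum-cong-≋ (λ i → ≈-trans (*-congʳ (reflexive (insertAt-punchIn _ p _ i))) (*-assoc _ _ _))) ⟩
      h₀ g * F p j + sum (λ i → F p zero * (g i * F (punchIn p i) j))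
        ≈⟨ +-congʳ (≈-trans (≈-sym (-‿distribˡ-* _ _)) (-‿distribʳ-* _ _)) ⟩
      sum (λ i → g i * F (punchIn p i) zero) * - F p j + sum (λ i → F p zero * (g i * F (punchIn p i) j))
        ≈⟨ +-congʳ (*-distribʳ-sum {m} (- F p j) _) ⟩
      sum (λ i → g i * F (punchIn p i) zero * - F p j) + sum (λ i → F p zero * (g i * F (punchIn p i) j))
        ≈⟨ ∑-distrib-+ {m} _ _ ⟨
      sum (λ i → g i * F (punchIn p i) zero * - F p j + F p zero * (g i * F (punchIn p i) j))
        ≈⟨ sum-cong-≋ (λ i → identity₁ (g i) (F (punchIn p i) zero) (F p j) (F p zero) (F (punchIn p i) j)) ⟩
      sum (λ i → F p zero * (g i * F (punchIn p i) j) - F (punchIn p i) zero * g i * F p j) ∎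
    h-rel : ∀ g → (∀ j → sum (λ i → g i * F′ i j) ≈ 0#) → ∀ j → sum (λ i → h g i * F i j) ≈ 0#
    h-rel g rel zero    = ≈-trans (expand g zero) (sum-≈0 (λ i →
      identity₂ (F p zero) (g i) (F (punchIn p i) zero)))
    h-rel g rel (suc j) = ≈-trans (expand g (suc j)) (≈-trans (sum-cong-≋ (λ i →
      identity₃ (F p zero) (g i) (F (punchIn p i) (suc j)) (F (punchIn p i) zero) (F p (suc j)))) (rel j))

  module _ {p} {M : Pred Carrier p} (isSubmodule : IsSubmodule M) where
    open IsSubmodule isSubmodule

    𝔸*-closed : ∀ {x y} → x ∈ 𝔸 → y ∈ M → x * y ∈ M
    𝔸*-closed (f , x≈f) y∈M = resp (*-congʳ (≈-sym x≈f)) (•-closed f y∈M)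

    neg-closed : ∀ {x} → x ∈ M → - x ∈ M
    neg-closed {x} x∈M = resp (-1*x≈-x x) (𝔸*-closed (𝔸-neg 𝔸-1) x∈M)

    sub-closed : ∀ {x y} → x ∈ M → y ∈ M → x - y ∈ M
    sub-closed x∈M y∈M = +-closed x∈M (neg-closed y∈M)

    Span⊆ : ∀ {n} {η : Vector Carrier n} → (∀ i → η i ∈ M) → Span η ⊆ M
    Span⊆ {zero}  η∈M (f , x≈) = resp (≈-sym x≈) 0-closed
    Span⊆ {suc n} η∈M (f , x≈) = resp (≈-sym x≈)
      (+-closed (•-closed (f zero) (η∈M zero)) (Span⊆ {n} (η∈M ∘ suc) (f ∘ suc , ≈-refl)))

  Span-cons : ∀ {n} (η : Vector Carrier (suc n)) {x y z} →
              y ∈ 𝔸 → z ∈ Span (tail η) → x ≈ y * η zero + z → x ∈ Span η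
  Span-cons η (f , y≈f) (g , z≈g) x≈ = f Vector.∷ g , ≈-trans x≈ (+-cong (*-congʳ y≈f) z≈g)

  Span-isSubmodule : ∀ {n} (η : Vector Carrier n) → IsSubmodule (Span η)
  Span-isSubmodule {zero} η = record
    { resp     = λ x≈y (f , x≈) → f , ≈-trans (≈-sym x≈y) x≈
    ; 0-closed = (λ ()) , ≈-refl
    ; +-closed = λ (f , x≈) (_ , y≈) → f , ≈-trans (+-cong x≈ y≈) (+-identityˡ 0#)
    ; •-closed = λ f (g , x≈) → g , ≈-trans (*-congˡ x≈) (zeroʳ _)
    }
  Span-isSubmodule {suc n} η = record
    { resp     = λ x≈y (f , x≈) → f , ≈-trans (≈-sym x≈y) x≈
    ; 0-closed = Span-cons η 𝔸-0 T.0-closed (≈-sym (≈-trans (+-identityʳ _) (zeroˡ _)))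
    ; +-closed = λ (f , x≈) (g , y≈) → Span-cons η (evalᴬ-+ (f zero) (g zero))
        (T.+-closed (f ∘ suc , ≈-refl) (g ∘ suc , ≈-refl))
        (≈-trans (+-cong x≈ y≈) (regroup _ _ _ _ _))
    ; •-closed = λ f (g , x≈) → Span-cons η (𝔸-* (𝔸-eval f) (𝔸-eval (g zero)))
        (T.•-closed f (g ∘ suc , ≈-refl))
        (≈-trans (*-congˡ x≈) (≈-trans (distribˡ _ _ _) (+-congʳ (≈-sym (*-assoc _ _ _)))))
    }
    where
    module T = IsSubmodule (Span-isSubmodule {n} (tail η))
    regroup : ∀ x e y z w → x * e + y + (z * e + w) ≈ (x + z) * e + (y + w)
    regroup = solve 5 (λ x e y z w → x :* e :+ y :+ (z :* e :+ w) := (x :+ z) :* e :+ (y :+ w)) ≈-refl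

  Span-tail⊆ : ∀ {n} (η : Vector Carrier (suc n)) → Span (tail η) ⊆ Span η
  Span-tail⊆ η x∈ = Span-cons η 𝔸-0 x∈ (≈-sym (≈-trans (+-congʳ (zeroˡ _)) (+-identityˡ _)))

  η∈Span : ∀ {n} (η : Vector Carrier n) i → η i ∈ Span η
  η∈Span {suc n} η zero    = Span-cons η 𝔸-1 (IsSubmodule.0-closed (Span-isSubmodule {n} (tail η)))
    (≈-sym (≈-trans (+-identityʳ _) (*-identityˡ _)))
  η∈Span {suc n} η (suc i) = Span-tail⊆ η (η∈Span (tail η) i)

  -- A positive form of the failure of `LinearlyIndependent`: the coefficients and a nonzero one
  -- among them are exhibited, since the leading one will serve as a denominator in
  -- `clearDenominator`.
  Dependent : ∀ {n} → Vector Carrier n → Set (a ⊔ c ⊔ ℓ′)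
  Dependent {n} η = Σ[ g ∈ Vector Carrier n ]
    (∀ i → g i ∈ 𝔸) × (∃[ i ] ¬ g i ≈ 0#) × sum (λ i → g i * η i) ≈ 0#

  dependent⇒¬independent : ∀ {n} {η : Vector Carrier n} → Dependent η → ¬ LinearlyIndependent η
  dependent⇒¬independent (g , g∈𝔸 , (k , gk≉0) , rel) independent = gk≉0
    (≈-trans (proj₂ (g∈𝔸 k)) (IsZero⇒evalᴬ≈0 (proj₁ (g∈𝔸 k)) (independent (proj₁ ∘ g∈𝔸)
      (≈-trans (sum-cong-≋ (λ i → *-congʳ (≈-sym (proj₂ (g∈𝔸 i))))) rel) k)))

  -- The coordinates of the `v i` form a matrix with more rows than columns; a relation between its
  -- rows carries over to the `v i` after exchanging the two sums.
  Span-dependent : ∀ {m n} {v : Vector Carrier m} {η : Vector Carrier n} →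
                   (∀ i → v i ∈ Span η) → n ℕ.< m → Dependent v
  Span-dependent {m} {n} {v} {η} v∈Span n<m =
    let g , g∈𝔸 , nonzero , rel = relation F (λ i j → 𝔸-eval (proj₁ (v∈Span i) j)) n<m
    in g , g∈𝔸 , nonzero , (begin
      sum (λ i → g i * v i)                                  ≈⟨ sum-cong-≋ {m} (λ i → *-congˡ (proj₂ (v∈Span i))) ⟩
      sum (λ i → g i * sum (λ j → F i j * η j))              ≈⟨ sum-cong-≋ {m} (λ i → *-distribˡ-sum {n} (g i) _) ⟩
      sum (λ i → sum (λ j → g i * (F i j * η j)))            ≈⟨ ∑-comm {m} {n} _ ⟩
      sum (λ j → sum (λ i → g i * (F i j * η j)))            ≈⟨ sum-cong-≋ {n} (λ j → sum-cong-≋ {m} (λ i → *-assoc (g i) (F i j) (η j))) ⟨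
      sum (λ j → sum (λ i → g i * F i j * η j))              ≈⟨ sum-cong-≋ {n} (λ j → *-distribʳ-sum {m} (η j) _) ⟨
      sum (λ j → sum (λ i → g i * F i j) * η j)              ≈⟨ sum-≈0 {n} (λ j → ≈-trans (*-congʳ (rel j)) (zeroˡ (η j))) ⟩
      0#                                                     ∎)
    where
    F : Fin m → Fin n → Carrier
    F i j = evalᴬ (proj₁ (v∈Span i) j)

  -- Chains of minimal vectors and their orthogonality

  SpanAfter-suc⁺ : ∀ {n} {η : Vector Carrier (suc n)} {k} → SpanAfter (tail η) k ⊆ SpanAfter η (suc k)
  SpanAfter-suc⁺ {k = k} (f , f≈0 , x≈) = [] Vector.∷ f
    , (λ { zero _ _ → F.refl ; (suc i) (ℕ.s≤s i≤k) → f≈0 i i≤k })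
    , ≈-trans x≈ (≈-sym (≈-trans (+-congʳ (zeroˡ _)) (+-identityˡ _)))

  SpanAfter-suc⁻ : ∀ {n} {η : Vector Carrier (suc n)} {k} → SpanAfter η (suc k) ⊆ SpanAfter (tail η) k
  SpanAfter-suc⁻ (f , f≈0 , x≈) = f ∘ suc , (λ i i≤k → f≈0 (suc i) (ℕ.s≤s i≤k))
    , ≈-trans x≈ (≈-trans (+-congʳ (≈-trans (*-congʳ (IsZero⇒evalᴬ≈0 (f zero) (f≈0 zero ℕ.z≤n))) (zeroˡ _))) (+-identityˡ _))

  SpanAfter-zero⁺ : ∀ {n} {η : Vector Carrier (suc n)} → Span (tail η) ⊆ SpanAfter η zero
  SpanAfter-zero⁺ (f , x≈) = [] Vector.∷ f
    , (λ { zero _ _ → F.refl })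
    , ≈-trans x≈ (≈-sym (≈-trans (+-congʳ (zeroˡ _)) (+-identityˡ _)))

  SpanAfter-zero⁻ : ∀ {n} {η : Vector Carrier (suc n)} → SpanAfter η zero ⊆ Span (tail η)
  SpanAfter-zero⁻ (f , f≈0 , x≈) = f ∘ suc
    , ≈-trans x≈ (≈-trans (+-congʳ (≈-trans (*-congʳ (IsZero⇒evalᴬ≈0 (f zero) (f≈0 zero ℕ.z≤n))) (zeroˡ _))) (+-identityˡ _))

  -- A successive minimum basis of M without the requirement to span M.
  record Chain {n p} (M : Pred Carrier p) (η : Vector Carrier n) : Set (a ⊔ ℓ ⊔ c ⊔ ℓ′ ⊔ p) where
    field
      decreasing : ∀ i j → i Fin.≤ j → ∣ η j ∣ ≤ᵛ ∣ η i ∣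
      minimal    : ∀ k → HasMinimalAbs (η k) (λ x → x ∈ M × x ∉ SpanAfter η k)

    η∈M : ∀ i → η i ∈ M
    η∈M i = proj₁ (proj₁ (minimal i))

  module _ {p} {M : Pred Carrier p} where

    Chain-tail : ∀ {n} {η : Vector Carrier (suc n)} → Chain M η → Chain M (tail η)
    Chain-tail {n} {η} chain = record
      { decreasing = λ i j i≤j → decreasing (suc i) (suc j) (ℕ.s≤s i≤j)
      ; minimal    = λ k →
          let (x∈M , x∉) , x-min = minimal (suc k)
          in (x∈M , λ x∈ → x∉ (SpanAfter-suc⁺ {n} {η} {k} x∈))
           , λ y (y∈M , y∉) → x-min y (y∈M , λ y∈ → y∉ (SpanAfter-suc⁻ {n} {η} {k} y∈))
      }
      where open Chain chain

    Chain-head : ∀ {n} {η : Vector Carrier (suc n)} → Chain M η →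
                 HasMinimalAbs (η zero) (λ x → x ∈ M × x ∉ Span (tail η))
    Chain-head {n} {η} chain =
      let (x∈M , x∉) , x-min = Chain.minimal chain zero
      in (x∈M , λ x∈ → x∉ (SpanAfter-zero⁺ {n} {η} x∈))
       , λ y (y∈M , y∉) → x-min y (y∈M , λ y∈ → y∉ (SpanAfter-zero⁻ {n} {η} y∈))

    Chain-[] : {η : Vector Carrier 0} → Chain M η
    Chain-[] = record { decreasing = λ () ; minimal = λ () }

    Chain-cons : ∀ {n} {η : Vector Carrier n} {x} → Chain M η →
                 HasMinimalAbs x (λ y → y ∈ M × y ∉ Span η) → Chain M (x Vector.∷ η)
    Chain-cons {n} {η} {x} chain ((x∈M , x∉) , x-min) = record
      { decreasing = decreasing′
      ; minimal    = λ where
          zero    → (x∈M , λ x∈ → x∉ (SpanAfter-zero⁻ {n} {x Vector.∷ η} x∈))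
                  , λ y (y∈M , y∉) → x-min y (y∈M , λ y∈ → y∉ (SpanAfter-zero⁺ {n} {x Vector.∷ η} y∈))
          (suc k) →
            let (ηk∈M , ηk∉) , ηk-min = minimal k
            in (ηk∈M , λ ηk∈ → ηk∉ (SpanAfter-suc⁻ {n} {x Vector.∷ η} {k} ηk∈))
             , λ y (y∈M , y∉) → ηk-min y (y∈M , λ y∈ → y∉ (SpanAfter-suc⁺ {n} {x Vector.∷ η} {k} y∈))
      }
      where
      open Chain chain
      -- Lying outside the whole span of `η`, `x` was already a candidate when `η j` was chosen as
      -- minimal.
      ≤x : ∀ j → ∣ η j ∣ ≤ᵛ ∣ x ∣
      ≤x j = proj₂ (minimal j) x (x∈M , λ (f , _ , x≈) → x∉ (f , x≈))
      decreasing′ : ∀ i j → i Fin.≤ j → ∣ (x Vector.∷ η) j ∣ ≤ᵛ ∣ (x Vector.∷ η) i ∣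
      decreasing′ zero    zero    _           = ≤ᵛ-refl
      decreasing′ zero    (suc j) _           = ≤x j
      decreasing′ (suc i) (suc j) (ℕ.s≤s i≤j) = decreasing i j i≤j

  -- The maximum formula is split off one vector at a time, matching both the construction of chains
  -- by prepending and the induction in counting.
  Orthogonal : ∀ {n} → Vector Carrier n → Set (a ⊔ c ⊔ ℓ′)
  Orthogonal {zero}  η = ⊤
  Orthogonal {suc n} η = ¬ η zero ≈ 0#
    × (∀ {x y} → x ∈ 𝔸 → y ∈ Span (tail η) → ∣ x * η zero + y ∣ ≡ ∣ x * η zero ∣ ⊔ᵛ ∣ y ∣)
    × Orthogonal (tail η)

  orthogonal⇒independent : ∀ {n} {η : Vector Carrier n} → Orthogonal η → LinearlyIndependent η
  orthogonal⇒independent {suc n} {η} (η₀≉0 , orth , orthTail) f rel = λ where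
      zero    → evalᴬ≈0⇒IsZero (f zero) (*-≈0 η₀≉0 (≈-trans (*-comm _ _) head≈0))
      (suc i) → orthogonal⇒independent {n} orthTail (f ∘ suc) tail≈0 i
    where
    rest∈Span : lin (f ∘ suc) (tail η) ∈ Span (tail η)
    rest∈Span = f ∘ suc , ≈-refl
    ∣⊔∣≡0 : ∣ evalᴬ (f zero) * η zero ∣ ⊔ᵛ ∣ lin (f ∘ suc) (tail η) ∣ ≡ 0ᵛ
    ∣⊔∣≡0 = trans (sym (orth (𝔸-eval (f zero)) rest∈Span)) (≈0⇒∣∣≡0 rel)
    head≈0 : evalᴬ (f zero) * η zero ≈ 0#
    head≈0 = ∣∣≡0⇒≈0 (≤ᵛ-antisym (≤ᵛ-trans (u≤u⊔v _ _) (≤ᵛ-reflexive ∣⊔∣≡0)) 0≤)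
    tail≈0 : lin (f ∘ suc) (tail η) ≈ 0#
    tail≈0 = ∣∣≡0⇒≈0 (≤ᵛ-antisym (≤ᵛ-trans (v≤u⊔v _ _) (≤ᵛ-reflexive ∣⊔∣≡0)) 0≤)

  ∣*∣<q^·q^ : ∀ {x y s t} → ∣ x ∣ <ᵛ q^ s → ∣ y ∣ ≤ᵛ q^ t → ∣ x * y ∣ <ᵛ q^ s · q^ t
  ∣*∣<q^·q^ {x} {y} {s} {t} x<s y≤t = ≤ᵛ-<ᵛ-trans
    (≤ᵛ-trans (≤ᵛ-reflexive (∣∣-mult x y)) (·-monoʳ-≤ ∣ x ∣ y≤t))
    (subst₂ _<ᵛ_ (·-comm (q^ t) ∣ x ∣) (·-comm (q^ t) (q^ s)) (·-monoʳ-< t x<s))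

  -- Every coefficient is rounded by `split`. The remainders have absolute value below q^d, and the
  -- ultrametric inequality keeps the total error strictly below the bound, whatever the number of
  -- vectors.
  splitSpan : ∀ d {n s} {η : Vector Carrier n} → (∀ i → ∣ η i ∣ ≤ᵛ q^ s) → ∀ {y} → y ∈ Span η →
              ∃[ z ] z ∈ Span η × ∣ y - T ^ d * z ∣ <ᵛ q^ (fromℕ d) · q^ s
  splitSpan d {zero} {s} {η} η≤s {y} (f , y≈) = 0# , (f , ≈-refl)
    , ≤ᵛ-<ᵛ-trans (≈0⇒∣∣≤ (≈-trans (+-cong y≈ (≈-trans (-‿cong (zeroʳ _)) ε⁻¹≈ε)) (+-identityˡ 0#))) 0<q^
  splitSpan d {suc n} {s} {η} η≤s {y} (f , y≈) =
    let r , x , _ , x∈𝔸 , f₀≈ , r<d = split d (𝔸-eval (f zero))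
        z , z∈ , z< = splitSpan d {n} {s} {tail η} (η≤s ∘ suc) (f ∘ suc , ≈-refl)
    in x * η zero + z , Span-cons η x∈𝔸 z∈ ≈-refl
     , ≤ᵛ-<ᵛ-trans (≤ᵛ-reflexive (∣∣-cong (≈-trans (+-congʳ (≈-trans y≈ (+-congʳ (*-congʳ f₀≈)))) (regroup r (T ^ d) x (η zero) _ z))))
         (∣∣-+-< (∣*∣<q^·q^ r<d (η≤s zero)) z<)
    where
    regroup : ∀ r t x e y z → (r + t * x) * e + y - t * (x * e + z) ≈ r * e + (y - t * z)
    regroup = solve 6 (λ r t x e y z → (r :+ t :* x) :* e :+ y :- t :* (x :* e :+ z) := r :* e :+ (y :- t :* z)) ≈-refl

  module _ {p} {M : Pred Carrier p} (isSubmodule : IsSubmodule M) where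
    open IsSubmodule isSubmodule

    -- If |x η₀ + y| dropped below |x η₀| = |y|, then dividing by T^(deg x) and
    -- rounding would give an element lc(x) η₀ + z of M smaller than η₀.
    noCancellation : ∀ {n} {η : Vector Carrier (suc n)} → Chain M η → ∀ {x y} →
                     LeadingForm x → y ∈ Span (tail η) → ∣ x * η zero ∣ ≤ᵛ ∣ x * η zero + y ∣
    noCancellation {n} {η} chain {x} {y} l y∈ = decidable-stable (_ ≤ᵛ? _) impossible
      where
      open LeadingForm l
      module S = IsSubmodule (Span-isSubmodule {n} (tail η))
      η₀-min : HasMinimalAbs (η zero) (λ x → x ∈ M × x ∉ Span (tail η))
      η₀-min = Chain-head {n = n} {η} chain
      η₀∉ : η zero ∉ Span (tail η)
      η₀∉ = proj₂ (proj₁ η₀-min)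
      η₀≉0 : ¬ η zero ≈ 0#
      η₀≉0 η₀≈0 = η₀∉ (S.resp (≈-sym η₀≈0) S.0-closed)
      e : ℚ
      e = proj₁ (≉0⇒∣∣≡q^ η₀≉0)
      ∣η₀∣≡ : ∣ η zero ∣ ≡ q^ e
      ∣η₀∣≡ = proj₂ (≉0⇒∣∣≡q^ η₀≉0)
      ∣xη₀∣≡ : ∣ x * η zero ∣ ≡ q^ (fromℕ degree) · q^ e
      ∣xη₀∣≡ = trans (∣∣-mult x (η zero)) (cong₂ _·_ ∣∣≡ ∣η₀∣≡)
      rounded : ∃[ z ] z ∈ Span (tail η) × ∣ y - T ^ degree * z ∣ <ᵛ q^ (fromℕ degree) · q^ e
      rounded = splitSpan degree {n} {e} {tail η}
        (λ i → ≤ᵛ-trans (Chain.decreasing chain zero (suc i) ℕ.z≤n) (≤ᵛ-reflexive ∣η₀∣≡)) y∈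
      z : Carrier
      z = proj₁ rounded
      z∈ : z ∈ Span (tail η)
      z∈ = proj₁ (proj₂ rounded)
      w : Carrier
      w = ι lc * η zero + z
      w∈M : w ∈ M
      w∈M = +-closed (𝔸*-closed isSubmodule (𝔸-ι lc) (Chain.η∈M chain zero))
              (Span⊆ isSubmodule {n} (λ i → Chain.η∈M chain (suc i)) z∈)
      w∉ : w ∉ Span (tail η)
      -- Leading coefficients are units of 𝔽_q[T], so `w` in the span of the tail would bring η₀
      -- into it.
      w∉ w∈ = let lc⁻¹ , lc*lc⁻¹≈1 = proj₂ (FiniteField.isField 𝔽) lc lc≉0 in
        η₀∉ (S.resp
          (begin
            ι lc⁻¹ * (ι lc * η zero + z - z)   ≈⟨ regroup (ι lc⁻¹) (ι lc) (η zero) z ⟩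
            ι lc * ι lc⁻¹ * η zero             ≈⟨ *-congʳ (ι.*-homo lc lc⁻¹) ⟨
            ι (lc F.* lc⁻¹) * η zero           ≈⟨ *-congʳ (≈-trans (ι.⟦⟧-cong lc*lc⁻¹≈1) ι.1#-homo) ⟩
            1# * η zero                        ≈⟨ *-identityˡ _ ⟩
            η zero                             ∎)
          (𝔸*-closed (Span-isSubmodule (tail η)) (𝔸-ι lc⁻¹) (sub-closed (Span-isSubmodule (tail η)) w∈ z∈)))
        where
        regroup : ∀ i l e z → i * (l * e + z - z) ≈ l * i * e
        regroup = solve 4 (λ i l e z → i :* (l :* e :+ z :- z) := l :* i :* e) ≈-refl
      -- The subtracted terms are the lower part of `x` times η₀ and the rounding error. Both are
      -- smaller than |x η₀|, as is x η₀ + y by assumption, so |w| < |η₀|, against minimality.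
      Tw≈ : x * η zero + y - (rest * η zero + (y - T ^ degree * z)) ≈ T ^ degree * w
      Tw≈ = ≈-trans (+-congʳ (+-congʳ (*-congʳ ≈rest+))) (regroup rest (ι lc) (T ^ degree) (η zero) y z)
        where
        regroup : ∀ r l t e y z → (r + l * t) * e + y - (r * e + (y - t * z)) ≈ t * (l * e + z)
        regroup = solve 6 (λ r l t e y z → (r :+ l :* t) :* e :+ y :- (r :* e :+ (y :- t :* z)) := t :* (l :* e :+ z)) ≈-refl
      impossible : ¬ ¬ ∣ x * η zero ∣ ≤ᵛ ∣ x * η zero + y ∣
      impossible x+y< = ≤ᵛ-<ᵛ-trans (≤ᵛ-reflexive ∣Tw∣≡) (∣∣-sub-< (<ᵛ-≤ᵛ-trans x+y< (≤ᵛ-reflexive ∣xη₀∣≡))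
          (∣∣-+-< (∣*∣<q^·q^ ∣rest∣< (≤ᵛ-reflexive ∣η₀∣≡)) (proj₂ (proj₂ rounded))))
        (·-monoʳ-≤ (q^ (fromℕ degree)) (≤ᵛ-trans (≤ᵛ-reflexive (sym ∣η₀∣≡)) (proj₂ η₀-min w (w∈M , w∉))))
        where
        ∣Tw∣≡ : q^ (fromℕ degree) · ∣ w ∣ ≡ ∣ x * η zero + y - (rest * η zero + (y - T ^ degree * z)) ∣
        ∣Tw∣≡ = trans (cong (_· ∣ w ∣) (sym (∣T^∣ degree))) (trans (sym (∣∣-mult (T ^ degree) w)) (∣∣-cong (≈-sym Tw≈)))

    -- If |y| exceeds |x η₀|, the ultrametric inequality is an equality by itself. Minimality
    -- enters, through `noCancellation`, only in the opposite case.
    Chain⇒Orthogonal : ∀ {n} {η : Vector Carrier n} → Chain M η → Orthogonal η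
    Chain⇒Orthogonal {zero}      chain = tt
    Chain⇒Orthogonal {suc n} {η} chain = η₀≉0 , (λ x∈𝔸 → orth (leading x∈𝔸)) , Chain⇒Orthogonal {n} (Chain-tail {n = n} chain)
      where
      module S = IsSubmodule (Span-isSubmodule {n} (tail η))
      η₀≉0 : ¬ η zero ≈ 0#
      η₀≉0 η₀≈0 = proj₂ (proj₁ (Chain-head {n = n} chain)) (S.resp (≈-sym η₀≈0) S.0-closed)
      orth : ∀ {x y} → x ≈ 0# ⊎ LeadingForm x → y ∈ Span (tail η) →
             ∣ x * η zero + y ∣ ≡ ∣ x * η zero ∣ ⊔ᵛ ∣ y ∣
      orth {x} {y} (inj₁ x≈0) y∈ = trans (∣∣-cong (≈-trans (+-congʳ xη₀≈0) (+-identityˡ y)))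
        (sym (u≤v⇒u⊔v≡v (≈0⇒∣∣≤ xη₀≈0)))
        where
        xη₀≈0 : x * η zero ≈ 0#
        xη₀≈0 = ≈-trans (*-congʳ x≈0) (zeroˡ _)
      orth {x} {y} (inj₂ l)   y∈ with ∣ y ∣ ≤ᵛ? ∣ x * η zero ∣
      ... | no  x<y = trans (∣∣-cong (+-comm _ _)) (trans (∣∣-isosceles x<y) (sym (u≤v⇒u⊔v≡v (<ᵛ⇒≤ᵛ x<y))))
      ... | yes y≤x = trans (≤ᵛ-antisym (∣∣-+-≤ ≤ᵛ-refl y≤x) (noCancellation {n} chain l y∈)) (sym (v≤u⇒u⊔v≡u y≤x))

  -- Cardinalities of balls

  -- An exact cardinality up to `≈`, whereas the lists in `Finite` may repeat elements.
  record Count {p} (P : Pred Carrier p) (n : ℕ) : Set (c ⊔ ℓ′ ⊔ p) where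
    field
      enum           : Fin n → Carrier
      enum∈          : ∀ i → enum i ∈ P
      enum-injective : ∀ i j → enum i ≈ enum j → i ≡ j
      enum-index     : ∀ {x} → x ∈ P → ∃[ i ] x ≈ enum i

  Count-resp : ∀ {p p′} {P : Pred Carrier p} {P′ : Pred Carrier p′} {n} →
               P ⊆ P′ → P′ ⊆ P → Count P n → Count P′ n
  Count-resp P⊆P′ P′⊆P count = record
    { enum           = enum
    ; enum∈          = P⊆P′ ∘ enum∈
    ; enum-injective = enum-injective
    ; enum-index     = enum-index ∘ P′⊆P
    }
    where open Count count

  Count-scale : ∀ {p} {P : Pred Carrier p} {n e} → ¬ e ≈ 0# → Count P n →
                Count (λ x → ∃[ y ] y ∈ P × x ≈ y * e) n
  Count-scale {P = P} {n} {e} e≉0 count = record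
    { enum           = λ i → enum i * e
    ; enum∈          = λ i → enum i , enum∈ i , ≈-refl
    ; enum-injective = λ i j eq → enum-injective i j (x∙y⁻¹≈ε⇒x≈y _ _ (*-≈0 e≉0 (cancel i j eq)))
    ; enum-index     = λ (y , y∈ , x≈) → let i , y≈ = enum-index y∈ in i , ≈-trans x≈ (*-congʳ y≈)
    }
    where
    open Count count
    regroup : ∀ e x y → e * (x - y) ≈ x * e - y * e
    regroup = solve 3 (λ e x y → e :* (x :- y) := x :* e :- y :* e) ≈-refl
    cancel : ∀ i j → enum i * e ≈ enum j * e → e * (enum i - enum j) ≈ 0#
    cancel i j eq = ≈-trans (regroup e (enum i) (enum j)) (≈-trans (+-congʳ eq) (-‿inverseʳ _))

  module _ {p₁ p₂ p₃} {P : Pred Carrier p₁} {Q : Pred Carrier p₂} {R : Pred Carrier p₃} where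

    Count-⊕ : ∀ {m n} →
              (∀ {x y} → x ∈ P → y ∈ Q → x + y ∈ R) →
              (∀ {z} → z ∈ R → ∃[ x ] ∃[ y ] x ∈ P × y ∈ Q × z ≈ x + y) →
              (∀ {x x′ y y′} → x ∈ P → x′ ∈ P → y ∈ Q → y′ ∈ Q → x + y ≈ x′ + y′ → x ≈ x′ × y ≈ y′) →
              Count P m → Count Q n → Count R (m ℕ.* n)
    Count-⊕ {m} {n} add decompose unique countP countQ = record
      { enum           = λ i → P.enum (proj₁ (remQuot n i)) + Q.enum (proj₂ (remQuot {m} n i))
      ; enum∈          = λ i → add (P.enum∈ _) (Q.enum∈ _)
      ; enum-injective = λ i j eq →
          let x≈ , y≈ = unique (P.enum∈ _) (P.enum∈ _) (Q.enum∈ _) (Q.enum∈ _) eq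
          in trans (sym (Fin.combine-remQuot {m} n i)) (trans
               (cong₂ combine (P.enum-injective _ _ x≈) (Q.enum-injective _ _ y≈))
               (Fin.combine-remQuot {m} n j))
      ; enum-index     = λ z∈ →
          let x , y , x∈ , y∈ , z≈ = decompose z∈
              i , x≈ = P.enum-index x∈
              j , y≈ = Q.enum-index y∈
          in combine i j , ≈-trans z≈ (+-cong
               (≈-trans x≈ (reflexive (cong (P.enum ∘ proj₁) (sym (Fin.remQuot-combine {m} i j)))))
               (≈-trans y≈ (reflexive (cong (Q.enum ∘ proj₂) (sym (Fin.remQuot-combine {m} i j))))))
      }
      where
      module P = Count countP
      module Q = Count countQ

  Constant : Pred Carrier (a ⊔ ℓ′)
  Constant x = ∃[ y ] x ≈ ι y

  Count-Constant : Count Constant q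
  Count-Constant = record
    { enum           = ι ∘ from
    ; enum∈          = λ i → from i , ≈-refl
    ; enum-injective = λ i j eq → trans (sym (strictlyInverseˡ i)) (trans (to-cong (ι-injective eq)) (strictlyInverseˡ j))
    ; enum-index     = λ (y , x≈) → to y , ≈-trans x≈ (ι.⟦⟧-cong (F.sym (strictlyInverseʳ y)))
    }
    where
    open Inverse (FiniteField.enumeration 𝔽)
    module F+ = AbelianGroupProperties F.+-abelianGroup
    ι-injective : ∀ {x y} → ι x ≈ ι y → x F.≈ y
    ι-injective {x} {y} eq = F+.x∙y⁻¹≈ε⇒x≈y x y (ι≈0⇒≈0
      (≈-trans (ι.+-homo x (F.- y)) (≈-trans (+-cong eq (ι.-‿homo y)) (-‿inverseʳ (ι y)))))

  𝔸< : ℕ → Pred Carrier (a ⊔ ℓ′)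
  𝔸< n x = x ∈ 𝔸 × ∣ x ∣ <ᵛ q^ (fromℕ n)

  -- Splitting off the constant term, polynomials of degree at most n are the direct sum of the
  -- constants and of T times those of degree below n, whence the factor `q`. For `n = 0` only zero
  -- remains, as nonzero polynomials have absolute value at least 1.
  Count-𝔸< : ∀ n → Count (𝔸< n) (q ℕ.^ n)
  Count-𝔸< zero = record
    { enum           = λ _ → 0#
    ; enum∈          = λ _ → 𝔸-0 , subst (_<ᵛ q^ (fromℕ 0)) (sym (≈0⇒∣∣≡0 ≈-refl)) 0<q^
    ; enum-injective = λ { zero zero _ → refl }
    ; enum-index     = λ (x∈𝔸 , x<1) → zero , <1⇒≈0 x<1 (leading x∈𝔸)
    }
    where
    <1⇒≈0 : ∀ {x} → ∣ x ∣ <ᵛ q^ (fromℕ 0) → x ≈ 0# ⊎ LeadingForm x → x ≈ 0#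
    <1⇒≈0 x<1 (inj₁ x≈0) = x≈0
    <1⇒≈0 x<1 (inj₂ l)   = contradiction
      (≤ᵛ-trans (q^≤ (fromℕ-mono-≤ ℕ.z≤n)) (≤ᵛ-reflexive (sym (LeadingForm.∣∣≡ l)))) x<1
  Count-𝔸< (suc n) = Count-⊕ add decompose unique Count-Constant (Count-scale T≉0 (Count-𝔸< n))
    where
    add : ∀ {x y} → x ∈ Constant → ∃[ z ] z ∈ 𝔸< n × y ≈ z * T → x + y ∈ 𝔸< (suc n)
    add {x} {y} (u , x≈) (z , (z∈𝔸 , z<n) , y≈) =
      𝔸-resp (≈-sym eq) (𝔸-horner u z∈𝔸)
      , subst (_<ᵛ q^ (fromℕ (suc n))) (∣∣-cong (≈-sym eq)) (∣∣-+-< (∣ι∣<suc u n) (∣T*∣< z<n))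
      where
      eq : x + y ≈ ι u + T * z
      eq = +-cong x≈ (≈-trans y≈ (*-comm z T))
    lower : ∀ {u z} → ∣ ι u + T * z ∣ <ᵛ q^ (fromℕ (suc n)) → ∣ z ∣ <ᵛ q^ (fromℕ n)
    lower {u} {z} x< n≤z = ∣∣-sub-< x< (∣ι∣<suc u n) (≤ᵛ-trans
      (≤ᵛ-trans (≤ᵛ-reflexive (cong q^ (fromℕ-+ 1 n))) (·-monoʳ-≤ (q^ (fromℕ 1)) n≤z))
      (≤ᵛ-reflexive (trans (cong (_· ∣ z ∣) (sym ∣T∣)) (trans (sym (∣∣-mult T z))
        (∣∣-cong (regroup (ι u) (T * z)))))))
      where
      regroup : ∀ x y → y ≈ x + y - x
      regroup = solve 2 (λ x y → y := x :+ y :- x) ≈-refl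
    decompose : ∀ {x} → x ∈ 𝔸< (suc n) →
                ∃[ y ] ∃[ z ] y ∈ Constant × (∃[ w ] w ∈ 𝔸< n × z ≈ w * T) × x ≈ y + z
    decompose (([] , x≈) , x<) = 0# , 0# , (F.0# , ≈-sym ι.0#-homo)
      , (0# , (𝔸-0 , subst (_<ᵛ q^ (fromℕ n)) (sym (≈0⇒∣∣≡0 ≈-refl)) 0<q^) , ≈-sym (zeroˡ T))
      , ≈-trans x≈ (≈-sym (+-identityˡ 0#))
    decompose ((u ∷ f , x≈) , x<) = ι u , evalᴬ f * T , (u , ≈-refl)
      , (evalᴬ f , (𝔸-eval f , lower {u} (subst (_<ᵛ q^ (fromℕ (suc n))) (∣∣-cong x≈) x<)) , ≈-refl)
      , ≈-trans x≈ (+-congˡ (*-comm T _))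
    unique : ∀ {x x′ y y′} → x ∈ Constant → x′ ∈ Constant →
             ∃[ w ] w ∈ 𝔸< n × y ≈ w * T → ∃[ w ] w ∈ 𝔸< n × y′ ≈ w * T →
             x + y ≈ x′ + y′ → x ≈ x′ × y ≈ y′
    unique {x} {x′} {y} {y′} (u , x≈) (u′ , x′≈) (w , (w∈ , _) , y≈) (w′ , (w′∈ , _) , y′≈) eq =
      x≈x′ , y≈y′
      where
      regroup : ∀ x y x′ y′ → x + y - (x′ + y′) ≈ x - x′ + (y - y′)
      regroup = solve 4 (λ x y x′ y′ → x :+ y :- (x′ :+ y′) := x :- x′ :+ (y :- y′)) ≈-refl
      factor : ∀ t w w′ → w * t - w′ * t ≈ t * (w - w′)
      factor = solve 3 (λ t w w′ → w :* t :- w′ :* t := t :* (w :- w′)) ≈-refl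
      w≈w′ : w ≈ w′
      w≈w′ = x∙y⁻¹≈ε⇒x≈y w w′ (constant≈0 (u F.- u′) (𝔸-sub w∈ w′∈) (begin
        ι (u F.- u′) + T * (w - w′)     ≈⟨ +-cong (≈-trans (ι.+-homo u (F.- u′)) (+-congˡ (ι.-‿homo u′))) (≈-sym (factor T w w′)) ⟩
        ι u - ι u′ + (w * T - w′ * T)   ≈⟨ regroup _ _ _ _ ⟨
        ι u + w * T - (ι u′ + w′ * T)   ≈⟨ +-cong (+-cong x≈ y≈) (-‿cong (+-cong x′≈ y′≈)) ⟨
        x + y - (x′ + y′)               ≈⟨ +-congʳ eq ⟩
        x′ + y′ - (x′ + y′)             ≈⟨ -‿inverseʳ _ ⟩
        0#                              ∎))
      y≈y′ : y ≈ y′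
      y≈y′ = ≈-trans y≈ (≈-trans (*-congʳ w≈w′) (≈-sym y′≈))
      cancel : ∀ x y → x ≈ x + y - y
      cancel = solve 2 (λ x y → x := x :+ y :- y) ≈-refl
      x≈x′ : x ≈ x′
      x≈x′ = ≈-trans (cancel x y) (≈-trans (+-cong eq (-‿cong y≈y′)) (≈-sym (cancel x′ y′)))

  -- For `x` of degree d the product has absolute value q^(d+m), so the ball condition is the one
  -- counted by `Fits`; zero satisfies both bounds.
  Fits⇒∣∣< : ∀ {m s n x e} → Fits m s n → ∣ e ∣ ≡ q^ m → x ∈ 𝔸 →
             ∣ x * e ∣ ≤ᵛ q^ s → ∣ x ∣ <ᵛ q^ (fromℕ n)
  Fits⇒∣∣< {m} {s} {n} {x} {e} fits ∣e∣≡ x∈𝔸 xe≤s = byDegree (leading x∈𝔸)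
    where
    byDegree : x ≈ 0# ⊎ LeadingForm x → ∣ x ∣ <ᵛ q^ (fromℕ n)
    byDegree (inj₁ x≈0) = subst (_<ᵛ q^ (fromℕ n)) (sym (≈0⇒∣∣≡0 x≈0)) 0<q^
    byDegree (inj₂ l)   n≤x = ℕ.<⇒≱
      (Equivalence.to (fits degree) (q^-cancel-≤ (subst (_≤ᵛ q^ s) (trans (∣∣-mult x e) (cong₂ _·_ ∣∣≡ ∣e∣≡)) xe≤s)))
      (fromℕ-cancel-≤ (q^-cancel-≤ (subst (q^ (fromℕ n) ≤ᵛ_) ∣∣≡ n≤x)))
      where open LeadingForm l

  ∣∣<⇒Fits : ∀ {m s n x e} → Fits m s n → ∣ e ∣ ≡ q^ m → x ∈ 𝔸 →
             ∣ x ∣ <ᵛ q^ (fromℕ n) → ∣ x * e ∣ ≤ᵛ q^ s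
  ∣∣<⇒Fits {m} {s} {n} {x} {e} fits ∣e∣≡ x∈𝔸 x<n = byDegree (leading x∈𝔸)
    where
    byDegree : x ≈ 0# ⊎ LeadingForm x → ∣ x * e ∣ ≤ᵛ q^ s
    byDegree (inj₁ x≈0) = ≈0⇒∣∣≤ (≈-trans (*-congʳ x≈0) (zeroˡ e))
    byDegree (inj₂ l)   = subst (_≤ᵛ q^ s) (sym (trans (∣∣-mult x e) (cong₂ _·_ ∣∣≡ ∣e∣≡)))
      (q^≤ (Equivalence.from (fits degree) (ℕ.≰⇒> λ n≤d → x<n (≤ᵛ-trans (q^≤ (fromℕ-mono-≤ n≤d)) (≤ᵛ-reflexive (sym ∣∣≡))))))
      where open LeadingForm l

  -- By orthogonality a sum lies in the ball exactly when each of its terms does, so the ball is the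
  -- direct sum of the balls on the lines spanned by the `η i`. Orthogonality also gives uniqueness:
  -- both parts of a vanishing difference vanish.
  Count-Span : ∀ {n} {η : Vector Carrier n} → Orthogonal η →
               ∀ {m : Vector ℚ n} → (∀ i → ∣ η i ∣ ≡ q^ (m i)) →
               ∀ {s} {k : Vector ℕ n} → (∀ i → Fits (m i) s (k i)) →
               Count (λ x → x ∈ Span η × ∣ x ∣ ≤ᵛ q^ s) (q ℕ.^ ℕSum.sum k)
  Count-Span {zero} {η} _ _ {s} _ = record
    { enum           = λ _ → 0#
    ; enum∈          = λ _ → ((λ ()) , ≈-refl) , ≈0⇒∣∣≤ ≈-refl
    ; enum-injective = λ { zero zero _ → refl }
    ; enum-index     = λ ((_ , x≈) , _) → zero , x≈
    }
  Count-Span {suc n} {η} (η₀≉0 , orth , orthTail) {m} ∣η∣≡ {s} {k} fits =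
    subst (Count (λ x → x ∈ Span η × ∣ x ∣ ≤ᵛ q^ s)) (sym (ℕ.^-distribˡ-+-* q (k zero) (ℕSum.sum (tail k))))
      (Count-⊕ add decompose unique (Count-scale η₀≉0 (Count-𝔸< (k zero)))
        (Count-Span {n} orthTail (∣η∣≡ ∘ suc) (fits ∘ suc)))
    where
    module S = IsSubmodule (Span-isSubmodule η)
    module S′ = IsSubmodule (Span-isSubmodule (tail η))
    Multiple : Pred Carrier _
    Multiple x = ∃[ y ] y ∈ 𝔸< (k zero) × x ≈ y * η zero
    Rest : Pred Carrier _
    Rest x = x ∈ Span (tail η) × ∣ x ∣ ≤ᵛ q^ s
    add : ∀ {x y} → x ∈ Multiple → y ∈ Rest → x + y ∈ Span η × ∣ x + y ∣ ≤ᵛ q^ s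
    add {x} {y} (z , (z∈𝔸 , z<k) , x≈) (y∈ , y≤s) = Span-cons η z∈𝔸 y∈ (+-congʳ x≈)
      , ∣∣-+-≤ (subst (_≤ᵛ q^ s) (∣∣-cong (≈-sym x≈)) (∣∣<⇒Fits (fits zero) (∣η∣≡ zero) z∈𝔸 z<k)) y≤s
    decompose : ∀ {x} → x ∈ Span η × ∣ x ∣ ≤ᵛ q^ s → ∃[ y ] ∃[ z ] y ∈ Multiple × z ∈ Rest × x ≈ y + z
    decompose {x} ((f , x≈) , x≤s) = x₀ , x₁
      , (evalᴬ (f zero) , (𝔸-eval (f zero) , Fits⇒∣∣< (fits zero) (∣η∣≡ zero) (𝔸-eval (f zero))
          (≤ᵛ-trans (u≤u⊔v ∣ x₀ ∣ ∣ x₁ ∣) ⊔≤s)) , ≈-refl)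
      , (x₁∈ , ≤ᵛ-trans (v≤u⊔v ∣ x₀ ∣ ∣ x₁ ∣) ⊔≤s) , x≈
      where
      x₀ : Carrier
      x₀ = evalᴬ (f zero) * η zero
      x₁ : Carrier
      x₁ = lin (tail f) (tail η)
      x₁∈ : x₁ ∈ Span (tail η)
      x₁∈ = tail f , ≈-refl
      ⊔≤s : ∣ x₀ ∣ ⊔ᵛ ∣ x₁ ∣ ≤ᵛ q^ s
      ⊔≤s = subst (_≤ᵛ q^ s) (trans (∣∣-cong x≈) (orth (𝔸-eval (f zero)) x₁∈)) x≤s
    unique : ∀ {x x′ y y′} → x ∈ Multiple → x′ ∈ Multiple → y ∈ Rest → y′ ∈ Rest →
             x + y ≈ x′ + y′ → x ≈ x′ × y ≈ y′
    unique {x} {x′} {y} {y′} (z , (z∈ , _) , x≈) (z′ , (z′∈ , _) , x′≈) (y∈ , _) (y′∈ , _) eq =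
      x∙y⁻¹≈ε⇒x≈y x x′ (≈-trans x-x′≈ (∣∣≡0⇒≈0 (vanish (u≤u⊔v _ _))))
      , x∙y⁻¹≈ε⇒x≈y y y′ (∣∣≡0⇒≈0 (vanish (v≤u⊔v _ _)))
      where
      x-x′≈ : x - x′ ≈ (z - z′) * η zero
      x-x′≈ = ≈-trans (+-cong x≈ (-‿cong x′≈)) (factor z (η zero) z′)
        where
        factor : ∀ z e z′ → z * e - z′ * e ≈ (z - z′) * e
        factor = solve 3 (λ z e z′ → z :* e :- z′ :* e := (z :- z′) :* e) ≈-refl
      regroup : ∀ x y x′ y′ → x - x′ + (y - y′) ≈ x + y - (x′ + y′)
      regroup = solve 4 (λ x y x′ y′ → x :- x′ :+ (y :- y′) := x :+ y :- (x′ :+ y′)) ≈-refl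
      difference≈0 : (z - z′) * η zero + (y - y′) ≈ 0#
      difference≈0 = ≈-trans (+-congʳ (≈-sym x-x′≈)) (≈-trans (regroup x y x′ y′)
        (≈-trans (+-congʳ eq) (-‿inverseʳ _)))
      vanish : ∀ {v} → v ≤ᵛ ∣ (z - z′) * η zero ∣ ⊔ᵛ ∣ y - y′ ∣ → v ≡ 0ᵛ
      vanish v≤ = ≤ᵛ-antisym (≤ᵛ-trans v≤ (≤ᵛ-reflexive (trans
        (sym (orth (𝔸-sub z∈ z′∈) (sub-closed (Span-isSubmodule (tail η)) y∈ y′∈))) (≈0⇒∣∣≡0 difference≈0)))) 0≤

  -- Decidable membership and minima of finite lists

  Count⇒Dec : ∀ {p} {P : Pred Carrier p} {n} → (∀ {x y} → x ≈ y → x ∈ P → y ∈ P) →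
              Count P n → ∀ x → Dec (x ∈ P)
  Count⇒Dec resp count x = map′ (λ (i , x≈) → resp (≈-sym x≈) (enum∈ i)) enum-index (Fin.any? (λ i → x ≟ enum i))
    where open Count count

  Orthogonal⇒≉0 : ∀ {n} {η : Vector Carrier n} → Orthogonal η → ∀ i → ¬ η i ≈ 0#
  Orthogonal⇒≉0 (η₀≉0 , _ , _) zero    = η₀≉0
  Orthogonal⇒≉0 {suc n} (_ , _ , orth) (suc i) = Orthogonal⇒≉0 {n} orth i

  ∣∣-bounded : ∀ x → ∃[ s ] ∣ x ∣ ≤ᵛ q^ s
  ∣∣-bounded x with ∣ x ∣
  ... | 0ᵛ   = 0ℚ , 0≤
  ... | q^ s = s , ≤ᵛ-refl

  -- It suffices to search the ball of radius |x| in the span, which `Count-Span` enumerates.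
  Span? : ∀ {n} {η : Vector Carrier n} → Orthogonal η → ∀ x → Dec (x ∈ Span η)
  Span? {n} {η} orth x = map′ proj₁ (_, proj₂ (∣∣-bounded x)) (Count⇒Dec resp
    (Count-Span {n} orth (λ i → proj₂ (≉0⇒∣∣≡q^ (Orthogonal⇒≉0 {n} orth i)))
      (λ i → proj₂ (Fits-exists (proj₁ (≉0⇒∣∣≡q^ (Orthogonal⇒≉0 {n} orth i))) s))) x)
    where
    s : ℚ
    s = proj₁ (∣∣-bounded x)
    resp : ∀ {y z} → y ≈ z → y ∈ Span η × ∣ y ∣ ≤ᵛ q^ s → z ∈ Span η × ∣ z ∣ ≤ᵛ q^ s
    resp y≈z (y∈ , y≤) = IsSubmodule.resp (Span-isSubmodule η) y≈z y∈ , subst (_≤ᵛ q^ s) (∣∣-cong y≈z) y≤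

  x-0≈x : ∀ x → x - 0# ≈ x
  x-0≈x x = ≈-trans (+-congˡ ε⁻¹≈ε) (+-identityʳ x)

  ∣∣≤⇒Ball : ∀ {x s} → ∣ x ∣ ≤ᵛ q^ s → x ∈ Ball 0# s
  ∣∣≤⇒Ball {x} {s} = subst (_≤ᵛ q^ s) (∣∣-cong (≈-sym (x-0≈x x)))

  Ball⇒∣∣≤ : ∀ {x s} → x ∈ Ball 0# s → ∣ x ∣ ≤ᵛ q^ s
  Ball⇒∣∣≤ {x} {s} = subst (_≤ᵛ q^ s) (∣∣-cong (x-0≈x x))

  IsDiscrete : ∀ {p} → Pred Carrier p → Set (c ⊔ ℓ′ ⊔ p)
  IsDiscrete M = ∀ z s → Finite (λ x → x ∈ M × x ∈ Ball z s)

  Finite-⊆ : ∀ {p} {P : Pred Carrier p} → (∀ {x y} → x ≈ y → x ∈ P → y ∈ P) → (∀ x → Dec (x ∈ P)) →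
             ∀ xs → (∀ {x} → x ∈ P → x ∈ˡ xs) → Finite P
  Finite-⊆ resp P? xs P⊆xs = List.filter P? xs
    , λ x → mk⇔ (λ x∈P → MembershipProperties.∈-filter⁺ setoid P? resp (P⊆xs x∈P) x∈P)
                (λ x∈ → proj₂ (MembershipProperties.∈-filter⁻ setoid P? resp {xs = xs} x∈))

  member? : ∀ {p} {M : Pred Carrier p} → IsDiscrete M → ∀ x → Dec (x ∈ M)
  -- A ball centred at `x` contains `x`, so the list decides; the radius 1 is an arbitrary choice.
  member? discrete x = let xs , x∈xs⇔ = discrete x 0ℚ in
    map′ (λ x∈xs → proj₁ (Equivalence.from (x∈xs⇔ x) x∈xs))
         (λ x∈M → Equivalence.to (x∈xs⇔ x) (x∈M , ≈0⇒∣∣≤ (-‿inverseʳ x)))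
         (Any.any? (x ≟_) xs)

  module _ {p} {P : Pred Carrier p} (resp : ∀ {x y} → x ≈ y → x ∈ P → y ∈ P) (P? : ∀ x → Dec (x ∈ P)) where

    minimum : ∀ xs → (∀ {x} → x ∈ˡ xs → x ∉ P) ⊎
                     (∃[ y ] y ∈ˡ xs × y ∈ P × (∀ {x} → x ∈ˡ xs → x ∈ P → ∣ y ∣ ≤ᵛ ∣ x ∣))
    minimum []       = inj₁ λ ()
    minimum (x ∷ xs) with P? x | minimum xs
    ... | no  x∉P | inj₁ none = inj₁ λ { (here y≈x) y∈P → x∉P (resp y≈x y∈P) ; (there y∈xs) → none y∈xs }
    ... | yes x∈P | inj₁ none = inj₂ (x , here ≈-refl , x∈P
          , λ { (here y≈x) _ → ≤ᵛ-reflexive (∣∣-cong (≈-sym y≈x)) ; (there y∈xs) y∈P → contradiction y∈P (none y∈xs) })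
    ... | no  x∉P | inj₂ (y , y∈xs , y∈P , y-min) = inj₂ (y , there y∈xs , y∈P
          , λ { (here z≈x) z∈P → contradiction (resp z≈x z∈P) x∉P ; (there z∈xs) z∈P → y-min z∈xs z∈P })
    ... | yes x∈P | inj₂ (y , y∈xs , y∈P , y-min) with ≤ᵛ-total ∣ x ∣ ∣ y ∣
    ...   | inj₁ x≤y = inj₂ (x , here ≈-refl , x∈P
            , λ { (here z≈x) _ → ≤ᵛ-reflexive (∣∣-cong (≈-sym z≈x)) ; (there z∈xs) z∈P → ≤ᵛ-trans x≤y (y-min z∈xs z∈P) })
    ...   | inj₂ y≤x = inj₂ (y , there y∈xs , y∈P
            , λ { (here z≈x) _ → ≤ᵛ-trans y≤x (≤ᵛ-reflexive (∣∣-cong (≈-sym z≈x))) ; (there z∈xs) z∈P → y-min z∈xs z∈P })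

  -- Existence of successive minimum bases

  -- An upper bound on the rank that presupposes no basis, so that it can be inherited by the
  -- intersection and pulled back to the sum.
  RankBound : ∀ {p} → Pred Carrier p → ℕ → Set _
  RankBound M r = ∀ (v : Vector Carrier (suc r)) → (∀ i → v i ∈ M) → Dependent v

  module _ {p} {M : Pred Carrier p} (isSubmodule : IsSubmodule M) (discrete : IsDiscrete M) where
    open IsSubmodule isSubmodule

    -- The search can be confined to the ball of radius |x|: it contains the candidate `x`, and
    -- everything outside is larger than whatever is found inside.
    Chain-extend : ∀ {n} {η : Vector Carrier n} → Chain M η → ∀ {x} → x ∈ M → x ∉ Span η →
                   ∃[ y ] Chain M (y Vector.∷ η)
    Chain-extend {n} {η} chain {x} x∈M x∉ = extend (minimum S∉-resp (λ y → ¬? (Span? orth y)) xs)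
      where
      orth : Orthogonal η
      orth = Chain⇒Orthogonal isSubmodule {n} chain
      S∉-resp : ∀ {y z} → y ≈ z → y ∉ Span η → z ∉ Span η
      S∉-resp y≈z y∉ z∈ = y∉ (IsSubmodule.resp (Span-isSubmodule η) (≈-sym y≈z) z∈)
      s : ℚ
      s = proj₁ (∣∣-bounded x)
      xs : List Carrier
      xs = proj₁ (discrete 0# s)
      ∈xs : ∀ {y} → y ∈ M → ∣ y ∣ ≤ᵛ q^ s → y ∈ˡ xs
      ∈xs {y} y∈M y≤s = Equivalence.to (proj₂ (discrete 0# s) y) (y∈M , ∣∣≤⇒Ball y≤s)
      extend : (∀ {y} → y ∈ˡ xs → ¬ y ∉ Span η) ⊎
               (∃[ y ] y ∈ˡ xs × y ∉ Span η × (∀ {z} → z ∈ˡ xs → z ∉ Span η → ∣ y ∣ ≤ᵛ ∣ z ∣)) →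
               ∃[ y ] Chain M (y Vector.∷ η)
      extend (inj₁ none) = contradiction x∉ (none (∈xs x∈M (proj₂ (∣∣-bounded x))))
      extend (inj₂ (y , y∈xs , y∉ , y-min)) = y , Chain-cons {n = n} chain ((y∈M , y∉) , minimal)
        where
        y∈ : y ∈ M × y ∈ Ball 0# s
        y∈ = Equivalence.from (proj₂ (discrete 0# s) y) y∈xs
        y∈M : y ∈ M
        y∈M = proj₁ y∈
        minimal : ∀ z → z ∈ M × z ∉ Span η → ∣ y ∣ ≤ᵛ ∣ z ∣
        minimal z (z∈M , z∉) with ∣ z ∣ ≤ᵛ? q^ s
        ... | yes z≤s = y-min (∈xs z∈M z≤s) z∉
        ... | no  s<z = ≤ᵛ-trans (Ball⇒∣∣≤ (proj₂ y∈)) (<ᵛ⇒≤ᵛ s<z)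

    -- As long as the chain has fewer than `r` vectors, its span cannot contain all of the
    -- independent `b i`, and one outside it starts the next extension.
    Chain-exists : ∀ {r} {b : Vector Carrier r} → (∀ i → b i ∈ M) → LinearlyIndependent b →
                   ∀ k → k ℕ.≤ r → Σ[ η ∈ Vector Carrier k ] Chain M η
    Chain-exists         b∈M independent zero    _   = Vector.[] , Chain-[]
    Chain-exists {r} {b} b∈M independent (suc k) k<r =
      let η , chain = Chain-exists b∈M independent k (ℕ.<⇒≤ k<r)
      in extend chain (Fin.any? (λ i → ¬? (Span? (Chain⇒Orthogonal isSubmodule {k} chain) (b i))))
      where
      extend : ∀ {η : Vector Carrier k} → Chain M η → Dec (∃[ i ] b i ∉ Span η) →
               Σ[ η ∈ Vector Carrier (suc k) ] Chain M η
      extend {η} chain (yes (i , bi∉)) = let y , chain′ = Chain-extend {k} chain (b∈M i) bi∉ in y Vector.∷ η , chain′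
      extend {η} chain (no all∈)       = contradiction independent (dependent⇒¬independent {r} (Span-dependent {r} {k}
        (λ i → decidable-stable (Span? (Chain⇒Orthogonal isSubmodule {k} chain) (b i)) (λ bi∉ → all∈ (i , bi∉))) k<r))

    -- A chain of length `r` spans all of `M`, not merely a submodule of finite index: an element
    -- outside the span would extend it to `r + 1` orthogonal, hence independent, vectors.
    SuccessiveMinimumBasis-exists : ∀ {r} {b : Vector Carrier r} → (∀ i → b i ∈ M) → LinearlyIndependent b →
      RankBound M r → Σ[ η ∈ Vector Carrier r ] IsSuccessiveMinimumBasis η M
    SuccessiveMinimumBasis-exists {r} b∈M independent bound = η , record
      { isBasis    = (λ x → mk⇔ (M⊆Span {x}) (Span⊆ isSubmodule {r} (Chain.η∈M chain))) , orthogonal⇒independent {r} orth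
      ; decreasing = Chain.decreasing chain
      ; minimal    = Chain.minimal chain
      }
      where
      η : Vector Carrier r
      η = proj₁ (Chain-exists b∈M independent r ℕ.≤-refl)
      chain : Chain M η
      chain = proj₂ (Chain-exists b∈M independent r ℕ.≤-refl)
      orth : Orthogonal η
      orth = Chain⇒Orthogonal isSubmodule {r} chain
      M⊆Span : M ⊆ Span η
      M⊆Span {x} x∈M = decidable-stable (Span? orth x) λ x∉ →
        let y , chain′ = Chain-extend {r} chain x∈M x∉
        in dependent⇒¬independent {suc r} {y Vector.∷ η} (bound (y Vector.∷ η) (Chain.η∈M chain′))
             (orthogonal⇒independent {suc r} {y Vector.∷ η} (Chain⇒Orthogonal isSubmodule {suc r} {y Vector.∷ η} chain′))

  -- Intersections, sums and common denominators

  sum-closed : ∀ {p} {M : Pred Carrier p} → IsSubmodule M → ∀ {n} {t : Vector Carrier n} → (∀ i → t i ∈ M) → sum t ∈ M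
  sum-closed isSubmodule {zero}  t∈M = IsSubmodule.0-closed isSubmodule
  sum-closed isSubmodule {suc n} t∈M = IsSubmodule.+-closed isSubmodule (t∈M zero) (sum-closed isSubmodule {n} (t∈M ∘ suc))

  -- Through `Span⊆` this extends a common denominator from generators to the whole module.
  Quotient-isSubmodule : ∀ {p} {M : Pred Carrier p} → IsSubmodule M → ∀ e → IsSubmodule (λ x → e * x ∈ M)
  Quotient-isSubmodule isSubmodule e = record
    { resp     = λ x≈y → resp (*-congˡ x≈y)
    ; 0-closed = resp (≈-sym (zeroʳ e)) 0-closed
    ; +-closed = λ x∈ y∈ → resp (≈-sym (distribˡ e _ _)) (+-closed x∈ y∈)
    ; •-closed = λ f x∈ → resp (≈-trans (≈-sym (*-assoc _ e _)) (≈-trans (*-congʳ (*-comm _ e)) (*-assoc e _ _))) (•-closed f x∈)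
    }
    where open IsSubmodule isSubmodule

  ∩-isSubmodule : ∀ {p p′} {M : Pred Carrier p} {N : Pred Carrier p′} →
                  IsSubmodule M → IsSubmodule N → IsSubmodule (M ∩ N)
  ∩-isSubmodule m n = record
    { resp     = λ x≈y (x∈M , x∈N) → M.resp x≈y x∈M , N.resp x≈y x∈N
    ; 0-closed = M.0-closed , N.0-closed
    ; +-closed = λ (x∈M , x∈N) (y∈M , y∈N) → M.+-closed x∈M y∈M , N.+-closed x∈N y∈N
    ; •-closed = λ f (x∈M , x∈N) → M.•-closed f x∈M , N.•-closed f x∈N
    }
    where
    module M = IsSubmodule m
    module N = IsSubmodule n

  +ᴸ-isSubmodule : ∀ {p p′} {M : Pred Carrier p} {N : Pred Carrier p′} →
                   IsSubmodule M → IsSubmodule N → IsSubmodule (M +ᴸ N)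
  +ᴸ-isSubmodule m n = record
    { resp     = λ x≈y (u , v , u∈ , v∈ , x≈) → u , v , u∈ , v∈ , ≈-trans (≈-sym x≈y) x≈
    ; 0-closed = 0# , 0# , M.0-closed , N.0-closed , ≈-sym (+-identityˡ 0#)
    ; +-closed = λ (u , v , u∈ , v∈ , x≈) (u′ , v′ , u′∈ , v′∈ , y≈) → u + u′ , v + v′
        , M.+-closed u∈ u′∈ , N.+-closed v∈ v′∈ , ≈-trans (+-cong x≈ y≈) (interchange u v u′ v′)
    ; •-closed = λ f (u , v , u∈ , v∈ , x≈) → evalᴬ f * u , evalᴬ f * v
        , M.•-closed f u∈ , N.•-closed f v∈ , ≈-trans (*-congˡ x≈) (distribˡ _ u v)
    }
    where
    module M = IsSubmodule m
    module N = IsSubmodule n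
    interchange : ∀ u v u′ v′ → u + v + (u′ + v′) ≈ u + u′ + (v + v′)
    interchange = solve 4 (λ u v u′ v′ → u :+ v :+ (u′ :+ v′) := u :+ u′ :+ (v :+ v′)) ≈-refl

  ∩-discrete : ∀ {p p′} {M : Pred Carrier p} {N : Pred Carrier p′} →
               IsSubmodule M → IsSubmodule N → IsDiscrete M → IsDiscrete N → IsDiscrete (M ∩ N)
  ∩-discrete {M = M} {N} m n discreteM discreteN z s = Finite-⊆
    (λ x≈y ((x∈M , x∈N) , x∈B) → (IsSubmodule.resp m x≈y x∈M , IsSubmodule.resp n x≈y x∈N)
      , subst (_≤ᵛ q^ s) (∣∣-cong (+-congʳ x≈y)) x∈B)
    (λ x → (member? discreteM x ×-dec member? discreteN x) ×-dec (∣ x - z ∣ ≤ᵛ? q^ s))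
    (proj₁ (discreteM z s))
    (λ {x} ((x∈M , _) , x∈B) → Equivalence.to (proj₂ (discreteM z s) x) (x∈M , x∈B))

  module _ {p p′} {Λ : Pred Carrier p} {M : Pred Carrier p′} (isSubmodule : IsSubmodule Λ)
           {r} {b : Vector Carrier r} (b∈Λ : ∀ i → b i ∈ Λ) (independent : LinearlyIndependent b)
           (Λ⊆M : Λ ⊆ M) (bound : RankBound M r) where
    open IsSubmodule isSubmodule

    -- In a relation between `x` and the `r` vectors `b` the coefficient of `x` is nonzero, since
    -- otherwise `b` would be dependent; it is the denominator.
    clearDenominator : ∀ {x} → x ∈ M → ∃[ f ] f ∈ 𝔸 × ¬ f ≈ 0# × f * x ∈ Λ
    clearDenominator {x} x∈M = fromRelation (bound (x Vector.∷ b) (λ { zero → x∈M ; (suc i) → Λ⊆M (b∈Λ i) }))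
      where
      fromRelation : Dependent (x Vector.∷ b) → ∃[ f ] f ∈ 𝔸 × ¬ f ≈ 0# × f * x ∈ Λ
      fromRelation (g , g∈𝔸 , (k , gk≉0) , rel) = g zero , g∈𝔸 zero , g₀≉0 k gk≉0
        , resp (≈-sym (inverseˡ-unique _ _ rel))
            (neg-closed isSubmodule (sum-closed isSubmodule {r} (λ i → 𝔸*-closed isSubmodule (g∈𝔸 (suc i)) (b∈Λ i))))
        where
        g₀≉0 : ∀ k → ¬ g k ≈ 0# → ¬ g zero ≈ 0#
        g₀≉0 zero    g₀≉0 = g₀≉0
        g₀≉0 (suc k) gk≉0 g₀≈0 = dependent⇒¬independent {r} (g ∘ suc , g∈𝔸 ∘ suc , (k , gk≉0)
          , ≈-trans (≈-sym (≈-trans (+-congʳ (≈-trans (*-congʳ g₀≈0) (zeroˡ x))) (+-identityˡ _))) rel) independent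

    clearDenominators : ∀ {n} {g : Vector Carrier n} → (∀ i → g i ∈ M) →
                        ∃[ f ] f ∈ 𝔸 × ¬ f ≈ 0# × (∀ i → f * g i ∈ Λ)
    clearDenominators {zero}      g∈M = 1# , 𝔸-1 , 1≉0 , λ ()
    clearDenominators {suc n} {g} g∈M =
      let f₀ , f₀∈𝔸 , f₀≉0 , f₀g₀∈Λ = clearDenominator (g∈M zero)
          f , f∈𝔸 , f≉0 , fg∈Λ = clearDenominators {n} (g∈M ∘ suc)
      in f * f₀ , 𝔸-* f∈𝔸 f₀∈𝔸 , *-≉0 f≉0 f₀≉0 , λ where
           zero    → resp (≈-sym (*-assoc f f₀ (g zero))) (𝔸*-closed isSubmodule f∈𝔸 f₀g₀∈Λ)
           (suc i) → resp (≈-sym (≈-trans (*-congʳ (*-comm f f₀)) (*-assoc f₀ f _))) (𝔸*-closed isSubmodule f₀∈𝔸 (fg∈Λ i))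

  bounded : ∀ {n} (v : Vector Carrier n) → ∃[ s ] (∀ i → ∣ v i ∣ ≤ᵛ q^ s)
  bounded {zero}  v = 0ℚ , λ ()
  bounded {suc n} v =
    let s , v₀≤s = ∣∣-bounded (v zero)
        t , v≤t = bounded (v ∘ suc)
    in s ℚ.⊔ t , λ where
         zero    → ≤ᵛ-trans v₀≤s (q^≤ (ℚ.p≤p⊔q s t))
         (suc i) → ≤ᵛ-trans (v≤t i) (q^≤ (ℚ.p≤q⊔p s t))

  -- Coefficients are reduced modulo `f`. A remainder is smaller than `f`, so its term is bounded by
  -- `∣ f * g i ∣`; the bound depends on the generators and not on `x`.
  divideSpan : ∀ {f} → f ∈ 𝔸 → ¬ f ≈ 0# → ∀ {n s} {g : Vector Carrier n} → (∀ i → ∣ f * g i ∣ ≤ᵛ q^ s) →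
               ∀ {x} → x ∈ Span g → ∃[ y ] y ∈ Span g × ∣ x - f * y ∣ ≤ᵛ q^ s
  divideSpan {f} f∈𝔸 f≉0 {zero}  {s} {g} fg≤s {x} (_ , x≈) = 0# , ((λ ()) , ≈-refl)
    , ≈0⇒∣∣≤ (≈-trans (+-cong x≈ (-‿cong (zeroʳ f))) (-‿inverseʳ 0#))
  divideSpan {f} f∈𝔸 f≉0 {suc n} {s} {g} fg≤s {x} (h , x≈) =
    let w , w∈𝔸 , remainder< = divide (𝔸-eval (h zero)) f∈𝔸 f≉0
        y , y∈ , x-fy≤s = divideSpan f∈𝔸 f≉0 {n} {s} {tail g} (fg≤s ∘ suc) (h ∘ suc , ≈-refl)
    in w * g zero + y , Span-cons g w∈𝔸 y∈ ≈-refl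
     , ≤ᵛ-trans (≤ᵛ-reflexive (∣∣-cong (≈-trans (+-congʳ x≈) (regroup (evalᴬ (h zero)) (g zero) _ f w y))))
         (∣∣-+-≤ (≤ᵛ-trans (≤ᵛ-reflexive (∣∣-mult _ (g zero)))
            (≤ᵛ-trans (·-monoˡ-≤ ∣ g zero ∣ (<ᵛ⇒≤ᵛ remainder<)) (≤ᵛ-trans (≤ᵛ-reflexive (sym (∣∣-mult f (g zero)))) (fg≤s zero)))) x-fy≤s)
    where
    regroup : ∀ h g z f w y → h * g + z - f * (w * g + y) ≈ (h - f * w) * g + (z - f * y)
    regroup = solve 6 (λ h g z f w y → h :* g :+ z :- f :* (w :* g :+ y) := (h :- f :* w) :* g :+ (z :- f :* y)) ≈-refl

  1<q : 1 ℕ.< q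
  1<q = distinct⇒1< (to F.0#) (to F.1#) (λ eq → 𝔽-1≉0 (F.trans (F.sym (strictlyInverseʳ F.1#))
    (F.trans (from-cong (sym eq)) (strictlyInverseʳ F.0#))))
    where
    open Inverse (FiniteField.enumeration 𝔽)
    distinct⇒1< : ∀ {n} (i j : Fin n) → ¬ i ≡ j → 1 ℕ.< n
    distinct⇒1< {suc zero}    zero zero i≢j = contradiction refl i≢j
    distinct⇒1< {suc (suc n)} _    _    _   = ℕ.s≤s (ℕ.s≤s ℕ.z≤n)

  x≈y+[x-y] : ∀ x y → x ≈ y + (x - y)
  x≈y+[x-y] = solve 2 (λ x y → x := y :+ (x :- y)) ≈-refl

  -- The exact sequence of balls

  Small : ∀ {p} → ℚ → Pred Carrier p → Pred Carrier p
  Small s M x = x ∈ M × ∣ x ∣ ≤ᵛ q^ s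

  -- The cardinalities in 0 → M ∩ N → M × N → M + N → 0, all restricted to a ball.
  module _ {p p′} {M : Pred Carrier p} {N : Pred Carrier p′} (m : IsSubmodule M) (n : IsSubmodule N) {s}
           (decompose : ∀ {x} → x ∈ Small s (M +ᴸ N) → ∃[ y ] ∃[ z ] y ∈ Small s M × z ∈ Small s N × x ≈ y + z)
           {n∩ n₊ n₁ n₂} (count∩ : Count (Small s (M ∩ N)) n∩) (count₊ : Count (Small s (M +ᴸ N)) n₊)
           (count₁ : Count (Small s M) n₁) (count₂ : Count (Small s N) n₂) where
    private
      module ∩ = Count count∩
      module + = Count count₊
      module ₁ = Count count₁
      module ₂ = Count count₂

      y : Fin n₊ → Carrier
      y u = proj₁ (decompose (+.enum∈ u))
      z : Fin n₊ → Carrier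
      z u = proj₁ (proj₂ (decompose (+.enum∈ u)))
      y∈ : ∀ u → y u ∈ Small s M
      y∈ u = proj₁ (proj₂ (proj₂ (decompose (+.enum∈ u))))
      z∈ : ∀ u → z u ∈ Small s N
      z∈ u = proj₁ (proj₂ (proj₂ (proj₂ (decompose (+.enum∈ u)))))
      y+z : ∀ u → +.enum u ≈ y u + z u
      y+z u = proj₂ (proj₂ (proj₂ (proj₂ (decompose (+.enum∈ u)))))

      add : ∀ {p} {M : Pred Carrier p} → IsSubmodule M → ∀ {x y} → x ∈ Small s M → y ∈ Small s M → x + y ∈ Small s M
      add m (x∈ , x≤) (y∈ , y≤) = IsSubmodule.+-closed m x∈ y∈ , ∣∣-+-≤ x≤ y≤
      sub : ∀ {p} {M : Pred Carrier p} → IsSubmodule M → ∀ {x y} → x ∈ Small s M → y ∈ Small s M → x - y ∈ Small s M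
      sub m (x∈ , x≤) (y∈ , y≤) = sub-closed m x∈ y∈ , ∣∣-sub-≤ x≤ y≤

      w∈M : ∀ i → ∩.enum i ∈ Small s M
      w∈M i = let (w∈ , _) , w≤ = ∩.enum∈ i in w∈ , w≤
      w∈N : ∀ i → ∩.enum i ∈ Small s N
      w∈N i = let (_ , w∈) , w≤ = ∩.enum∈ i in w∈ , w≤

      index≈ : ∀ {p} {P : Pred Carrier p} {n} (count : Count P n) {x x′} (x∈ : x ∈ P) (x′∈ : x′ ∈ P) →
               proj₁ (Count.enum-index count x∈) ≡ proj₁ (Count.enum-index count x′∈) → x ≈ x′
      index≈ count x∈ x′∈ eq = ≈-trans (proj₂ (Count.enum-index count x∈))
        (≈-trans (reflexive (cong (Count.enum count) eq)) (≈-sym (proj₂ (Count.enum-index count x′∈))))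

    -- Send (w, u), where u = y + z is the chosen decomposition, to (w + y, z - w). The sum of the
    -- two components recovers u, hence y, and then w.
    n∩n₊≤n₁n₂ : n∩ ℕ.* n₊ ℕ.≤ n₁ ℕ.* n₂
    n∩n₊≤n₁n₂ = ×-injective⇒≤ f f-injective
      where
      f₁∈ : ∀ i u → ∩.enum i + y u ∈ Small s M
      f₁∈ i u = add m (w∈M i) (y∈ u)
      f₂∈ : ∀ i u → z u - ∩.enum i ∈ Small s N
      f₂∈ i u = sub n (z∈ u) (w∈N i)
      f : Fin n∩ → Fin n₊ → Fin n₁ × Fin n₂
      f i u = proj₁ (₁.enum-index (f₁∈ i u)) , proj₁ (₂.enum-index (f₂∈ i u))
      regroup : ∀ w y z → y + z ≈ w + y + (z - w)
      regroup = solve 3 (λ w y z → y :+ z := w :+ y :+ (z :- w)) ≈-refl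
      cancel : ∀ w y → w ≈ w + y - y
      cancel = solve 2 (λ w y → w := w :+ y :- y) ≈-refl
      f-injective : ∀ {i i′ u u′} → f i u ≡ f i′ u′ → i ≡ i′ × u ≡ u′
      f-injective {i} {i′} {u} {u′} eq = ∩.enum-injective i i′ w≈ , u≡
        where
        eq₁ : ∩.enum i + y u ≈ ∩.enum i′ + y u′
        eq₁ = index≈ count₁ (f₁∈ i u) (f₁∈ i′ u′) (cong proj₁ eq)
        eq₂ : z u - ∩.enum i ≈ z u′ - ∩.enum i′
        eq₂ = index≈ count₂ (f₂∈ i u) (f₂∈ i′ u′) (cong proj₂ eq)
        u≡ : u ≡ u′
        u≡ = +.enum-injective u u′ (begin
          +.enum u                                    ≈⟨ y+z u ⟩
          y u + z u                                   ≈⟨ regroup (∩.enum i) (y u) (z u) ⟩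
          ∩.enum i + y u + (z u - ∩.enum i)           ≈⟨ +-cong eq₁ eq₂ ⟩
          ∩.enum i′ + y u′ + (z u′ - ∩.enum i′)       ≈⟨ regroup (∩.enum i′) (y u′) (z u′) ⟨
          y u′ + z u′                                 ≈⟨ y+z u′ ⟨
          +.enum u′                                   ∎)
        w≈ : ∩.enum i ≈ ∩.enum i′
        w≈ = begin
          ∩.enum i                   ≈⟨ cancel (∩.enum i) (y u) ⟩
          ∩.enum i + y u - y u       ≈⟨ +-cong eq₁ (-‿cong (reflexive (cong y u≡))) ⟩
          ∩.enum i′ + y u′ - y u′    ≈⟨ cancel (∩.enum i′) (y u′) ⟨
          ∩.enum i′                  ∎

    -- Send (a, b) to (a - y, a + b), where y + z is the chosen decomposition of a + b. The first
    -- component also equals z - b and so lies in both modules; the second determines y, which gives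
    -- back a and then b.
    n₁n₂≤n∩n₊ : n₁ ℕ.* n₂ ℕ.≤ n∩ ℕ.* n₊
    n₁n₂≤n∩n₊ = ×-injective⇒≤ g g-injective
      where
      sum∈ : ∀ j k → ₁.enum j + ₂.enum k ∈ Small s (M +ᴸ N)
      sum∈ j k = let (x∈ , x≤) = ₁.enum∈ j ; (x′∈ , x′≤) = ₂.enum∈ k in
        (₁.enum j , ₂.enum k , x∈ , x′∈ , ≈-refl) , ∣∣-+-≤ x≤ x′≤
      u : Fin n₁ → Fin n₂ → Fin n₊
      u j k = proj₁ (+.enum-index (sum∈ j k))
      sum≈ : ∀ j k → ₁.enum j + ₂.enum k ≈ y (u j k) + z (u j k)
      sum≈ j k = ≈-trans (proj₂ (+.enum-index (sum∈ j k))) (y+z (u j k))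
      transfer : ∀ {a b c d} → a + b ≈ c + d → d - b ≈ a - c
      transfer {a} {b} {c} {d} eq = begin
        d - b                ≈⟨ left b c d ⟩
        c + d - (c + b)      ≈⟨ +-congʳ eq ⟨
        a + b - (c + b)      ≈⟨ right a b c ⟩
        a - c                ∎
        where
        left : ∀ b c d → d - b ≈ c + d - (c + b)
        left = solve 3 (λ b c d → d :- b := c :+ d :- (c :+ b)) ≈-refl
        right : ∀ a b c → a + b - (c + b) ≈ a - c
        right = solve 3 (λ a b c → a :+ b :- (c :+ b) := a :- c) ≈-refl
      difference∈ : ∀ j k → ₁.enum j - y (u j k) ∈ Small s (M ∩ N)
      difference∈ j k =
        let d∈M , d≤ = sub m (₁.enum∈ j) (y∈ (u j k))
            d∈N , _  = sub n (z∈ (u j k)) (₂.enum∈ k)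
        in (d∈M , IsSubmodule.resp n (transfer (sum≈ j k)) d∈N) , d≤
      g : Fin n₁ → Fin n₂ → Fin n∩ × Fin n₊
      g j k = proj₁ (∩.enum-index (difference∈ j k)) , u j k
      cancelˡ : ∀ w y → w ≈ w - y + y
      cancelˡ = solve 2 (λ w y → w := w :- y :+ y) ≈-refl
      cancelʳ : ∀ x y → y ≈ x + y - x
      cancelʳ = solve 2 (λ x y → y := x :+ y :- x) ≈-refl
      g-injective : ∀ {j j′ k k′} → g j k ≡ g j′ k′ → j ≡ j′ × k ≡ k′
      g-injective {j} {j′} {k} {k′} eq = ₁.enum-injective j j′ x≈ , ₂.enum-injective k k′ (begin
          ₂.enum k                               ≈⟨ cancelʳ (₁.enum j) (₂.enum k) ⟩
          ₁.enum j + ₂.enum k - ₁.enum j         ≈⟨ +-cong (index≈ count₊ (sum∈ j k) (sum∈ j′ k′) (cong proj₂ eq)) (-‿cong x≈) ⟩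
          ₁.enum j′ + ₂.enum k′ - ₁.enum j′      ≈⟨ cancelʳ (₁.enum j′) (₂.enum k′) ⟨
          ₂.enum k′                              ∎)
        where
        x≈ : ₁.enum j ≈ ₁.enum j′
        x≈ = begin
          ₁.enum j                                  ≈⟨ cancelˡ (₁.enum j) (y (u j k)) ⟩
          ₁.enum j - y (u j k) + y (u j k)          ≈⟨ +-cong (index≈ count∩ (difference∈ j k) (difference∈ j′ k′) (cong proj₁ eq))
                                                         (reflexive (cong y (cong proj₂ eq))) ⟩
          ₁.enum j′ - y (u j′ k′) + y (u j′ k′)     ≈⟨ cancelˡ (₁.enum j′) (y (u j′ k′)) ⟨
          ₁.enum j′                                 ∎

    count-exact : n∩ ℕ.* n₊ ≡ n₁ ℕ.* n₂
    count-exact = ℕ.≤-antisym n∩n₊≤n₁n₂ n₁n₂≤n∩n₊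

  -- Rank bounds and covolumes of bases

  RankBound-basis : ∀ {p} {M : Pred Carrier p} {r} {η : Vector Carrier r} → Generates η M → RankBound M r
  RankBound-basis {r = r} {η} generates v v∈M = Span-dependent {suc r} {r} {v} {η}
    (λ i → Equivalence.to (generates (v i)) (v∈M i)) ℕ.≤-refl

  -- Multiplication by `f` is linear and injective, so a relation between the multiples `f * v i` in
  -- `N` is one between the `v i`.
  RankBound-quotient : ∀ {p p′} {M : Pred Carrier p} {N : Pred Carrier p′} {r f} → ¬ f ≈ 0# →
                       (∀ {x} → x ∈ M → f * x ∈ N) → RankBound N r → RankBound M r
  RankBound-quotient {r = r} {f} f≉0 fM⊆N bound v v∈M =
    let g , g∈𝔸 , nonzero , rel = bound (λ i → f * v i) (λ i → fM⊆N (v∈M i))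
    in g , g∈𝔸 , nonzero , *-≈0 f≉0 (begin
      f * sum (λ i → g i * v i)        ≈⟨ *-distribˡ-sum {suc r} f (λ i → g i * v i) ⟩
      sum (λ i → f * (g i * v i))      ≈⟨ sum-cong-≋ {suc r} (λ i → swap f (g i) (v i)) ⟩
      sum (λ i → g i * (f * v i))      ≈⟨ rel ⟩
      0#                               ∎)
    where
    swap : ∀ f g v → f * (g * v) ≈ g * (f * v)
    swap = solve 3 (λ f g v → f :* (g :* v) := g :* (f :* v)) ≈-refl

  SMB : ∀ {p} → ℕ → Pred Carrier p → Set (a ⊔ ℓ ⊔ c ⊔ ℓ′ ⊔ p)
  SMB r M = Σ[ η ∈ Vector Carrier r ] IsSuccessiveMinimumBasis η M

  module _ {p} {M : Pred Carrier p} (m : IsSubmodule M) {r : ℕ} where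

    SMB-orthogonal : ((η , _) : SMB r M) → Orthogonal η
    SMB-orthogonal (η , smb) = Chain⇒Orthogonal m {r} {η} (record
      { decreasing = IsSuccessiveMinimumBasis.decreasing smb
      ; minimal    = IsSuccessiveMinimumBasis.minimal smb
      })

    exponent : SMB r M → Vector ℚ r
    exponent B i = proj₁ (≉0⇒∣∣≡q^ (Orthogonal⇒≉0 {r} (SMB-orthogonal B) i))

    ∣η∣≡q^exponent : (B : SMB r M) → ∀ i → ∣ proj₁ B i ∣ ≡ q^ (exponent B i)
    ∣η∣≡q^exponent B i = proj₂ (≉0⇒∣∣≡q^ (Orthogonal⇒≉0 {r} (SMB-orthogonal B) i))

    logCovolume : SMB r M → ℚ
    logCovolume B = ℚSum.sum (exponent B)

    ∏∣η∣≡ : (B : SMB r M) → ∏ᵛ (λ i → ∣ proj₁ B i ∣) ≡ q^ (logCovolume B)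
    ∏∣η∣≡ B = product r (λ i → ∣ proj₁ B i ∣) (exponent B) (∣η∣≡q^exponent B)
      where
      product : ∀ n (v : Vector Value n) (e : Vector ℚ n) → (∀ i → v i ≡ q^ (e i)) → ∏ᵛ v ≡ q^ (ℚSum.sum e)
      product zero    v e v≡ = refl
      product (suc n) v e v≡ = cong₂ _·_ (v≡ zero) (product n (tail v) (tail e) (v≡ ∘ suc))

    Count-Small : (B : SMB r M) → ∀ {s} {k : Vector ℕ r} → (∀ i → Fits (exponent B i) s (k i)) →
                  Count (Small s M) (q ℕ.^ ℕSum.sum k)
    Count-Small B@(η , smb) fits = Count-resp
      (λ {x} (x∈ , x≤) → Equivalence.from (generates x) x∈ , x≤)
      (λ {x} (x∈ , x≤) → Equivalence.to (generates x) x∈ , x≤)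
      (Count-Span {r} {η} (SMB-orthogonal B) (∣η∣≡q^exponent B) fits)
      where
      generates : Generates η M
      generates = proj₁ (IsSuccessiveMinimumBasis.isBasis smb)

    SMB⇒lattice : IsDiscrete M → SMB r M → IsLatticeOfRank r M
    SMB⇒lattice discrete (η , smb) = record
      { isSubmodule       = m
      ; finitelyGenerated = r , η , proj₁ (IsSuccessiveMinimumBasis.isBasis smb)
      ; discrete          = discrete
      } , η , IsSuccessiveMinimumBasis.isBasis smb

    -- Independence of the basis is a hypothesis here because it will be deduced from the covolume
    -- identity, stated for arbitrary bases.
    isLogCovolume : (B : SMB r M) → (∀ B′ → logCovolume B′ ≡ logCovolume B) → IsLogCovolume r M (logCovolume B)
    isLogCovolume B unique = B , λ η smb → trans (∏∣η∣≡ (η , smb)) (cong q^ (unique (η , smb)))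

  -- Two lattices with a common sublattice of full rank

  module _ {p r} {Λ Λ₁ Λ₂ : Pred Carrier p}
           (Λ-lattice : IsLatticeOfRank r Λ) (Λ₁-lattice : IsLatticeOfRank r Λ₁) (Λ₂-lattice : IsLatticeOfRank r Λ₂)
           (Λ⊆ : Λ ⊆ (Λ₁ ∩ Λ₂)) where
    private
      module L  = IsLattice (proj₁ Λ-lattice)
      module L₁ = IsLattice (proj₁ Λ₁-lattice)
      module L₂ = IsLattice (proj₁ Λ₂-lattice)

      basis : Vector Carrier r
      basis = proj₁ (proj₂ Λ-lattice)
      generates : Generates basis Λ
      generates = proj₁ (proj₂ (proj₂ Λ-lattice))
      independent : LinearlyIndependent basis
      independent = proj₂ (proj₂ (proj₂ Λ-lattice))
      basis∈Λ : ∀ i → basis i ∈ Λ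
      basis∈Λ i = Equivalence.from (generates (basis i)) (η∈Span basis i)

      bound : RankBound Λ r
      bound = RankBound-basis {η = basis} generates

    rankBound : ∀ {M : Pred Carrier p} → IsLatticeOfRank r M → RankBound M r
    rankBound (_ , η , generates , _) = RankBound-basis {η = η} generates

    module _ {M : Pred Carrier p} (M-lattice : IsLatticeOfRank r M) (Λ⊆M : Λ ⊆ M) where
      private
        module M = IsLattice (proj₁ M-lattice)
        n : ℕ
        n = proj₁ M.finitelyGenerated
        g : Vector Carrier n
        g = proj₁ (proj₂ M.finitelyGenerated)
        g-generates : Generates g M
        g-generates = proj₂ (proj₂ M.finitelyGenerated)

      commonDenominator : ∃[ f ] f ∈ 𝔸 × ¬ f ≈ 0# × (∀ {x} → x ∈ M → f * x ∈ Λ)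
      commonDenominator =
        let f , f∈𝔸 , f≉0 , fg∈Λ = clearDenominators L.isSubmodule {r} {basis} basis∈Λ independent Λ⊆M (rankBound M-lattice)
              {n} {g} (λ i → Equivalence.from (g-generates (g i)) (η∈Span g i))
        in f , f∈𝔸 , f≉0 , λ {x} x∈M →
             Span⊆ (Quotient-isSubmodule L.isSubmodule f) {n} {g} fg∈Λ (Equivalence.to (g-generates x) x∈M)

      -- With `f` a common denominator, `f * y` lies in Λ for every y in M; dividing by `f`
      -- therefore leaves a representative modulo Λ, of size at most the maximum of the
      -- `∣ f * g i ∣`.
      reduceModΛ : ∃[ R ] (∀ {x} → x ∈ M → ∃[ y ] y ∈ Small R M × x - y ∈ Λ)
      reduceModΛ =
        let f , f∈𝔸 , f≉0 , fM⊆Λ = commonDenominator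
            R , fg≤R = bounded {n} (λ i → f * g i)
        in R , λ {x} x∈M →
          let y , y∈ , x-fy≤R = divideSpan f∈𝔸 f≉0 {n} {R} {g} fg≤R (Equivalence.to (g-generates x) x∈M)
              y∈M = Equivalence.from (g-generates y) y∈
          in x - f * y , (sub-closed M.isSubmodule x∈M (𝔸*-closed M.isSubmodule f∈𝔸 y∈M) , x-fy≤R)
           , IsSubmodule.resp L.isSubmodule (cancel x (f * y)) (fM⊆Λ y∈M)
        where
        cancel : ∀ x y → y ≈ x - (x - y)
        cancel = solve 2 (λ x y → y := x :- (x :- y)) ≈-refl

    Λ⊆Λ₁ : Λ ⊆ Λ₁
    Λ⊆Λ₁ x∈Λ = proj₁ (Λ⊆ x∈Λ)

    Λ⊆Λ₂ : Λ ⊆ Λ₂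
    Λ⊆Λ₂ x∈Λ = proj₂ (Λ⊆ x∈Λ)

    Λ⊆Λ₁+Λ₂ : Λ ⊆ (Λ₁ +ᴸ Λ₂)
    Λ⊆Λ₁+Λ₂ {x} x∈Λ = x , 0# , Λ⊆Λ₁ x∈Λ , IsSubmodule.0-closed L₂.isSubmodule , ≈-sym (+-identityʳ x)

    radius : ℚ
    radius = proj₁ (reduceModΛ Λ₁-lattice Λ⊆Λ₁)

    ∩-submodule : IsSubmodule (Λ₁ ∩ Λ₂)
    ∩-submodule = ∩-isSubmodule L₁.isSubmodule L₂.isSubmodule

    +-submodule : IsSubmodule (Λ₁ +ᴸ Λ₂)
    +-submodule = +ᴸ-isSubmodule L₁.isSubmodule L₂.isSubmodule

    -- The difference between the first summand and its reduction lies in Λ, hence in Λ₂, and is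
    -- absorbed by the second summand.
    +-decompose : ∀ {x} → x ∈ (Λ₁ +ᴸ Λ₂) → ∃[ y ] ∃[ z ] y ∈ Small radius Λ₁ × z ∈ Λ₂ × x ≈ y + z
    +-decompose {x} (u , v , u∈ , v∈ , x≈) =
      let y , y∈ , u-y∈Λ = proj₂ (reduceModΛ Λ₁-lattice Λ⊆Λ₁) u∈
      in y , u - y + v , y∈ , IsSubmodule.+-closed L₂.isSubmodule (Λ⊆Λ₂ u-y∈Λ) v∈ , ≈-trans x≈ (regroup u v y)
      where
      regroup : ∀ u v y → u + v ≈ y + (u - y + v)
      regroup = solve 3 (λ u v y → u :+ v := y :+ (u :- y :+ v)) ≈-refl

    -- Once `s` reaches `radius` the first summand is in the ball; the second is then a difference
    -- of two elements of the ball.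
    +-decompose-Small : ∀ {s} → radius ℚ.≤ s → ∀ {x} → x ∈ Small s (Λ₁ +ᴸ Λ₂) →
                        ∃[ y ] ∃[ z ] y ∈ Small s Λ₁ × z ∈ Small s Λ₂ × x ≈ y + z
    +-decompose-Small {s} R≤s {x} (x∈ , x≤s) =
      let y , z , (y∈ , y≤R) , z∈ , x≈ = +-decompose x∈
          y≤s = ≤ᵛ-trans y≤R (q^≤ R≤s)
      in y , z , (y∈ , y≤s) , (z∈ , subst (_≤ᵛ q^ s) (∣∣-cong (≈-trans (+-congʳ x≈) (cancel y z))) (∣∣-sub-≤ x≤s y≤s)) , x≈
      where
      cancel : ∀ y z → y + z - y ≈ z
      cancel = solve 2 (λ y z → y :+ z :- y := z) ≈-refl

    -- By `+-decompose` only the finitely many first summands within `radius` have to be tried.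
    +-member? : ∀ x → Dec (x ∈ (Λ₁ +ᴸ Λ₂))
    +-member? x = map′ from to (Any.any? (λ y → member? L₂.discrete (x - y)) ys)
      where
      ys : List Carrier
      ys = proj₁ (L₁.discrete 0# radius)
      from : Any (λ y → x - y ∈ Λ₂) ys → x ∈ (Λ₁ +ᴸ Λ₂)
      from any = let y , y∈ys , x-y∈ = find any in
        y , x - y , proj₁ (Equivalence.from (proj₂ (L₁.discrete 0# radius) y) y∈ys) , x-y∈ , x≈y+[x-y] x y
      to : x ∈ (Λ₁ +ᴸ Λ₂) → Any (λ y → x - y ∈ Λ₂) ys
      to x∈ =
        let y , z , (y∈ , y≤R) , z∈ , x≈ = +-decompose x∈
        in lose (λ u≈v → IsSubmodule.resp L₂.isSubmodule (+-congˡ (-‿cong u≈v)))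
             (Equivalence.to (proj₂ (L₁.discrete 0# radius) y) (y∈ , ∣∣≤⇒Ball y≤R))
             (IsSubmodule.resp L₂.isSubmodule (≈-sym (≈-trans (+-congʳ x≈) (cancel y z))) z∈)
        where
        cancel : ∀ y z → y + z - y ≈ z
        cancel = solve 2 (λ y z → y :+ z :- y := z) ≈-refl

    +-denominator : ∃[ f ] ¬ f ≈ 0# × (∀ {x} → x ∈ (Λ₁ +ᴸ Λ₂) → f * x ∈ Λ)
    +-denominator =
      let f₁ , f₁∈𝔸 , f₁≉0 , f₁Λ₁⊆Λ = commonDenominator Λ₁-lattice Λ⊆Λ₁
          f₂ , f₂∈𝔸 , f₂≉0 , f₂Λ₂⊆Λ = commonDenominator Λ₂-lattice Λ⊆Λ₂
      in f₁ * f₂ , *-≉0 f₁≉0 f₂≉0 , λ {x} (u , v , u∈ , v∈ , x≈) →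
           IsSubmodule.resp L.isSubmodule (≈-sym (≈-trans (*-congˡ x≈) (regroup f₁ f₂ u v)))
             (IsSubmodule.+-closed L.isSubmodule
               (𝔸*-closed L.isSubmodule f₂∈𝔸 (f₁Λ₁⊆Λ u∈)) (𝔸*-closed L.isSubmodule f₁∈𝔸 (f₂Λ₂⊆Λ v∈)))
      where
      regroup : ∀ f₁ f₂ u v → f₁ * f₂ * (u + v) ≈ f₂ * (f₁ * u) + f₁ * (f₂ * v)
      regroup = solve 4 (λ f₁ f₂ u v → f₁ :* f₂ :* (u :+ v) := f₂ :* (f₁ :* u) :+ f₁ :* (f₂ :* v)) ≈-refl

    -- A sum of discrete modules need not be discrete. Here multiplication by a common denominator
    -- `f` maps the sum into Λ and the ball around `z` into one around `f * z`, so `f⁻¹` times a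
    -- finite list of Λ covers the original ball.
    +-discrete : IsDiscrete (Λ₁ +ᴸ Λ₂)
    +-discrete z s =
      let f , f≉0 , fM⊆Λ = +-denominator
          e , ∣f∣≡ = ≉0⇒∣∣≡q^ f≉0
          f⁻¹ , ff⁻¹≈1 = inverse f≉0
          ys , ∈ys⇔ = L.discrete (f * z) (e ℚ.+ s)
      in Finite-⊆
        (λ x≈y (x∈ , x∈B) → IsSubmodule.resp +-submodule x≈y x∈ , subst (_≤ᵛ q^ s) (∣∣-cong (+-congʳ x≈y)) x∈B)
        (λ x → +-member? x ×-dec (∣ x - z ∣ ≤ᵛ? q^ s))
        (List.map (f⁻¹ *_) ys)
        (λ {x} (x∈ , x∈B) → MembershipProperties.∈-resp-≈ setoid (recover f f⁻¹ x ff⁻¹≈1)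
          (MembershipProperties.∈-map⁺ setoid setoid *-congˡ (Equivalence.to (∈ys⇔ (f * x))
            (fM⊆Λ x∈ , subst (_≤ᵛ q^ (e ℚ.+ s)) (trans (cong (_· ∣ x - z ∣) (sym ∣f∣≡)) (trans (sym (∣∣-mult f (x - z)))
              (∣∣-cong (expand f x z)))) (·-monoʳ-≤ (q^ e) x∈B)))))
      where
      recover : ∀ f f⁻¹ x → f * f⁻¹ ≈ 1# → f⁻¹ * (f * x) ≈ x
      recover f f⁻¹ x eq = ≈-trans (≈-sym (*-assoc f⁻¹ f x)) (≈-trans (*-congʳ (≈-trans (*-comm f⁻¹ f) eq)) (*-identityˡ x))
      expand : ∀ f x z → f * (x - z) ≈ f * x - f * z
      expand = solve 3 (λ f x z → f :* (x :- z) := f :* x :- f :* z) ≈-refl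

    discrete∩ : IsDiscrete (Λ₁ ∩ Λ₂)
    discrete∩ = ∩-discrete L₁.isSubmodule L₂.isSubmodule L₁.discrete L₂.discrete

    B₁ : SMB r Λ₁
    B₁ = SuccessiveMinimumBasis-exists L₁.isSubmodule L₁.discrete {r} {basis} (Λ⊆Λ₁ ∘ basis∈Λ) independent (rankBound Λ₁-lattice)

    B₂ : SMB r Λ₂
    B₂ = SuccessiveMinimumBasis-exists L₂.isSubmodule L₂.discrete {r} {basis} (Λ⊆Λ₂ ∘ basis∈Λ) independent (rankBound Λ₂-lattice)

    B∩ : SMB r (Λ₁ ∩ Λ₂)
    B∩ = SuccessiveMinimumBasis-exists ∩-submodule discrete∩ {r} {basis} (Λ⊆ ∘ basis∈Λ) independent
      (λ v v∈ → rankBound Λ₁-lattice v (proj₁ ∘ v∈))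

    B₊ : SMB r (Λ₁ +ᴸ Λ₂)
    B₊ = SuccessiveMinimumBasis-exists +-submodule +-discrete {r} {basis} (Λ⊆Λ₁+Λ₂ ∘ basis∈Λ) independent
      (let f , f≉0 , fM⊆Λ = +-denominator in RankBound-quotient {M = Λ₁ +ᴸ Λ₂} {N = Λ} {r} f≉0 fM⊆Λ bound)

    -- At every radius from `radius` on, `count-exact` equates two products of powers of `q`. Since
    -- `q` exceeds 1 the exponents agree, which is the hypothesis of `balance`. The bases are left
    -- arbitrary so that each can be varied separately.
    logCovolume-exact : (C∩ : SMB r (Λ₁ ∩ Λ₂)) (C₊ : SMB r (Λ₁ +ᴸ Λ₂)) (C₁ : SMB r Λ₁) (C₂ : SMB r Λ₂) →
      logCovolume ∩-submodule C∩ ℚ.+ logCovolume +-submodule C₊ ≡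
      logCovolume L₁.isSubmodule C₁ ℚ.+ logCovolume L₂.isSubmodule C₂
    logCovolume-exact C∩ C₊ C₁ C₂ = balance {r} e radius λ s R≤s k fits →
      ^-injectiveʳ {q} 1<q (trans (ℕ.^-distribˡ-+-* q (ℕSum.sum (k 0F)) (ℕSum.sum (k 1F))) (trans
        (count-exact L₁.isSubmodule L₂.isSubmodule {s} (+-decompose-Small R≤s)
          (Count-Small ∩-submodule C∩ (fits 0F)) (Count-Small +-submodule C₊ (fits 1F))
          (Count-Small L₁.isSubmodule C₁ (fits 2F)) (Count-Small L₂.isSubmodule C₂ (fits 3F)))
        (sym (ℕ.^-distribˡ-+-* q (ℕSum.sum (k 2F)) (ℕSum.sum (k 3F))))))
      where
      e : Fin 4 → Vector ℚ r
      e 0F = exponent ∩-submodule C∩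
      e 1F = exponent +-submodule C₊
      e 2F = exponent L₁.isSubmodule C₁
      e 3F = exponent L₂.isSubmodule C₂

    -- Comparing logCovolume-exact for two bases of one of the four lattices
    -- shows that their covolumes do not depend on the basis.
    covolumes : IsLatticeOfRank r (Λ₁ ∩ Λ₂) × IsLatticeOfRank r (Λ₁ +ᴸ Λ₂) ×
      (∃[ d∩ ] ∃[ d₊ ] ∃[ d₁ ] ∃[ d₂ ]
        (IsLogCovolume r (Λ₁ ∩ Λ₂) d∩ × IsLogCovolume r (Λ₁ +ᴸ Λ₂) d₊ ×
         IsLogCovolume r Λ₁ d₁ × IsLogCovolume r Λ₂ d₂ × d∩ ℚ.+ d₊ ≡ d₁ ℚ.+ d₂))
    covolumes = SMB⇒lattice ∩-submodule discrete∩ B∩ , SMB⇒lattice +-submodule +-discrete B₊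
      , d∩ , d₊ , d₁ , d₂
      , isLogCovolume ∩-submodule B∩ (λ C → ℚ+.∙-cancelʳ d₊ (logCovolume ∩-submodule C) d∩
          (trans (logCovolume-exact C B₊ B₁ B₂) (sym exact)))
      , isLogCovolume +-submodule B₊ (λ C → ℚ+.∙-cancelˡ d∩ (logCovolume +-submodule C) d₊
          (trans (logCovolume-exact B∩ C B₁ B₂) (sym exact)))
      , isLogCovolume L₁.isSubmodule B₁ (λ C → ℚ+.∙-cancelʳ d₂ (logCovolume L₁.isSubmodule C) d₁
          (trans (sym (logCovolume-exact B∩ B₊ C B₂)) exact))
      , isLogCovolume L₂.isSubmodule B₂ (λ C → ℚ+.∙-cancelˡ d₁ (logCovolume L₂.isSubmodule C) d₂
          (trans (sym (logCovolume-exact B∩ B₊ B₁ C)) exact))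
      , exact
      where
      d∩ d₊ d₁ d₂ : ℚ
      d∩ = logCovolume ∩-submodule B∩
      d₊ = logCovolume +-submodule B₊
      d₁ = logCovolume L₁.isSubmodule B₁
      d₂ = logCovolume L₂.isSubmodule B₂
      exact : d∩ ℚ.+ d₊ ≡ d₁ ℚ.+ d₂
      exact = logCovolume-exact B∩ B₊ B₁ B₂

open import Data.Nat.Base using (_≤_)
open import Data.Rational.Base using (_+_)

theorem2p6 : ∀ {a ℓ c ℓ′ p} (q : ℕ) (𝔽 : FiniteField a ℓ q) (ℂ : ℂ∞ 𝔽 c ℓ′) →
    let open Lattices ℂ in
    (r : ℕ) → 1 ≤ r →
    (Λ Λ₁ Λ₂ : Pred (ℂ∞.Carrier ℂ) p) →
    IsLatticeOfRank r Λ → IsLatticeOfRank r Λ₁ → IsLatticeOfRank r Λ₂ →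
    Λ ⊆ (Λ₁ ∩ Λ₂) →
    IsLatticeOfRank r (Λ₁ ∩ Λ₂) ×
    IsLatticeOfRank r (Λ₁ +ᴸ Λ₂) ×
    (∃[ d∩ ] ∃[ d₊ ] ∃[ d₁ ] ∃[ d₂ ]
    (IsLogCovolume r (Λ₁ ∩ Λ₂) d∩ ×
    IsLogCovolume r (Λ₁ +ᴸ Λ₂) d₊ ×
    IsLogCovolume r Λ₁ d₁ ×
    IsLogCovolume r Λ₂ d₂ ×
    d∩ + d₊ ≡ d₁ + d₂))
theorem2p6 q 𝔽 ℂ r _ Λ Λ₁ Λ₂ Λ-lattice Λ₁-lattice Λ₂-lattice Λ⊆ =
  Covolume.covolumes ℂ Λ-lattice Λ₁-lattice Λ₂-lattice Λ⊆
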